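{- Let $\lambda$ be an infinite cardinal and let $\mathfrak s=(\mathfrak k,S^{bs},\mathrm{nf})$ be a good $\lambda$-frame minus stability. Let $M\preceq M_0\preceq N$ be models in $K_\lambda$ and let $P\subseteq S^{bs}(M_0)$. Let $\mathcal F$ be the family of all sets $J\subseteq |N|$ such that $J$ is independent in $(M,M_0,N)$ and $\mathrm{tp}(a,M_0,N)\in P$ for every $a\in J$. Let $J_1,J_2$ be two $\subseteq$-maximal members of $\mathcal F$. Assume that the independence relation has continuity, or $J_1$ is finite, or $J_2$ is finite. Then $|J_1|=|J_2|$ or both $J_1$ and $J_2$ are finite.
   Context: A.e.c. For a model $M$, $|M|$ is its universe and $\|M\|$ its cardinality. A pair $\mathfrak k=(K,\preceq)$, with $K$ a class of models of a fixed vocabulary and $\preceq$ a binary relation on $K$, is an abstract elementary class (a.e.c.) if: (a) $K$ and $\preceq$ are closed under isomorphisms; (b) $\preceq$ is a partial order contained in the submodel relation $\subseteq$; (c) if $\langle M_\alpha:\alpha<\delta\rangle$ is $\preceq$-increasing and continuous, then $M_0\preceq\bigcup_{\alpha<\delta}M_\alpha\in K$; (d) (smoothness) if moreover $M_\alpha\preceq N$ for all $\alpha<\delta$, then $\bigcup_{\alpha<\delta}M_\alpha\preceq N$; (e) if $M_0\subseteq M_1\subseteq M_2$, $M_0\preceq M_2$ and $M_1\preceq M_2$, then $M_0\preceq M_1$; (f) there is a least cardinal $LST(\mathfrak k)$ such that for every $N\in K$ and $A\subseteq |N|$ there is $M\in K$ with $A\subseteq M\preceq N$ and $\|M\|\le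 LST(\mathfrak k)+|A|$. $K_\lambda=\{M\in K:\|M\|=\lambda\}$; $M\prec N$ means $M\preceq N$ and $M\ne N$. An embedding $f:M\to N$ is an isomorphism of $M$ onto some $f[M]\preceq N$; it is over $A$ if it is the identity on $A$. An amalgamation of $M_1,M_2$ over $M_0$ (where $M_0\preceq M_1,M_2$) is $(f_1,f_2,M_3)$ with $f_n:M_n\to M_3$ embeddings over $M_0$. Types. On triples $(M,N,a)$ with $M\preceq N$ in $K$, $a\in N$, let $(M_0,N_0,a_0)E^*(M_1,N_1,a_1)$ iff $M_0=M_1$ and for some $N_2\succeq N_1$ there is an embedding $f:N_0\to N_2$ over $M_0$ with $f(a_0)=a_1$. $E$ is the transitive closure of $E^*$ and $\mathrm{tp}(a,M,N)$ is the $E$-class of $(M,N,a)$. $S(M)$ is the set of all types over $M$; for $p=\mathrm{tp}(a,M_1,N)$ and $M_0\preceq M_1$, $p\restriction M_0=\mathrm{tp}(a,M_0,N)$. Frame. $\mathfrak s=(\mathfrak k,S^{bs},\mathrm{nf})$ is a good $\lambda$-frame minus stability if (models below are in $K_\lambda$): (1) $\mathfrak k$ is an a.e.c., $LST(\mathfrak k)\le\lambda$, $K_\lambda$ has joint embedding and amalgamation, and no $\preceq$-maximal model. (2) $S^{bs}$ is a function on $K_\lambda$, respecting isomorphisms, with $S^{bs}(M)\subseteq\{\mathrm{tp}(a,M,N):M\prec N\in K_\lambda,\ a\in N-M\}$, and (density) whenever $M\prec N$ there is $a\in N-M$ with $\mathrm{tp}(a,M,N)\in S^{bs}(M)$. (3)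 $\mathrm{nf}$ is a 4-place relation, invariant under isomorphisms, such that: (a) $\mathrm{nf}(M_0,M_1,a,M_3)$ implies $M_0\preceq M_1\preceq M_3$, $a\in M_3-M_1$, and $\mathrm{tp}(a,M_n,M_3)\in S^{bs}(M_n)$ for $n<2$. (b) Monotonicity: if $M_0\preceq M_0^*\preceq M_1^*\preceq M_1\preceq M_3\preceq M_3^*$ and $M_1^*\cup\{a\}\subseteq M_3^{**}\preceq M_3^*$, then $\mathrm{nf}(M_0,M_1,a,M_3)$ implies $\mathrm{nf}(M_0^*,M_1^*,a,M_3^{**})$. One says "$\mathrm{tp}(a,M_1,M_3)$ does not fork over $M_0$" for $\mathrm{nf}(M_0,M_1,a,M_3)$. (c) Local character: if $\delta$ is limit, $\langle M_\alpha:\alpha\le\delta\rangle$ is increasing continuous, $M_\delta\preceq M_{\delta+1}$ and $\mathrm{tp}(a,M_\delta,M_{\delta+1})\in S^{bs}(M_\delta)$, then this type does not fork over $M_\alpha$ for some $\alpha<\delta$. (d) Uniqueness: if $p,q\in S^{bs}(N)$ do not fork over $M$ and $p\restriction M=q\restriction M$, then $p=q$. (e) Symmetry: if $M_0\preceq M_1\preceq M_3$, $a_1\in M_1$, $\mathrm{tp}(a_1,M_0,M_3)\in S^{bs}(M_0)$ and $\mathrm{tp}(a_2,M_1,M_3)$ does not fork over $M_0$, then for some $M_2,M_3^*$: $a_2\in M_2$, $M_0\preceq M_2\preceq M_3^*$, $M_3\preceq M_3^*$ and $\mathrm{tp}(a_1,M_2,M_3^*)$ does not fork over $M_0$. (f)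 Extension: if $p\in S^{bs}(M)$ and $M\prec N$, some $q\in S^{bs}(N)$ does not fork over $M$ and satisfies $q\restriction M=p$. (g) Continuity: if $\delta$ is limit, $\langle M_\alpha:\alpha\le\delta\rangle$ is increasing continuous, $p\in S(M_\delta)$ and $p\restriction M_\alpha$ does not fork over $M_0$ for all $\alpha<\delta$, then $p\in S^{bs}(M_\delta)$ and $p$ does not fork over $M_0$. Independence (all models in $K_\lambda$). $\langle M_\alpha,a_\alpha:\alpha<\alpha^*\rangle^\frown\langle M_{\alpha^*}\rangle$ is independent over $M$ when $\langle M_\alpha:\alpha\le\alpha^*\rangle$ is an increasing continuous sequence of models in $K_\lambda$, $M\preceq M_0$, and for every $\alpha<\alpha^*$ the type $\mathrm{tp}(a_\alpha,M_\alpha,M_{\alpha+1})$ does not fork over $M$. A set $J$ is independent in $(M,A,N)$ ($A$ a set or a model) when there is a sequence $\langle M'_\alpha,a_\alpha:\alpha<\alpha^*\rangle^\frown\langle M'_{\alpha^*}\rangle$ independent over $M$ with $J=\{a_\alpha:\alpha<\alpha^*\}$, $A\subseteq M'_0$, and a model $N^+$ with $M'_{\alpha^*}\preceq N^+$ and $N\preceq N^+$. The independence relation has continuity when: for every limit ordinal $\delta$, every increasing continuous sequence $\langle M_\alpha:\alpha\le\delta\rangle$ of models with $M\preceq M_0$, $M_\delta\preceq M^+$, and every $J\subseteq M^+$, if $J$ is independent in $(M,M_\alpha,M^+)$ for all $\alpha<\delta$, then $J$ is independent in $(M,M_\delta,M^+)$. -}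

module Defs where

open import Level using (0ℓ; Setω) renaming (suc to lsuc)
open import Axiom.ExcludedMiddle using (ExcludedMiddle)
open import Axiom.Extensionality.Propositional using (Extensionality)
open import Data.Fin using (Fin)
open import Data.Nat using (ℕ)
open import Data.Product using (Σ; Σ-syntax; ∃; ∃-syntax; _×_; _,_; proj₁; proj₂)
open import Data.Sum using (_⊎_)
open import Data.Sum.Relation.Binary.Pointwise using (_⊎ₛ_)
open import Data.Vec using (Vec; map)
open import Data.Vec.Relation.Unary.All using (All)
open import Function using (_on_)
open import Function.Bundles using (_⇔_; Bijection; Injection)
open import Function.Definitions using (Injective)
open import Induction.WellFounded using (WellFounded)
open import Relation.Binary.Bundles using (Setoid)
open import Relation.Binary.Core using (Rel)
open import Relation.Binary.Structures using (IsStrictTotalOrder; IsPartialOrder)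
open import Relation.Binary.Construct.Closure.Transitive using (TransClosure)
import Relation.Binary.Construct.On as On
open import Relation.Binary.PropositionalEquality using (_≡_; _≢_; setoid)
open import Relation.Nullary using (¬_)
open import Relation.Unary using (Pred; _∈_; _∉_; _⊆_; _≐_)

1ℓ 2ℓ : Level.Level
1ℓ = lsuc 0ℓ
2ℓ = lsuc 1ℓ

-- The mathematics takes place in ZFC.  Types in Set play the role of sets and
-- types in Set₁ that of classes of sets.  Excluded middle for all types (not
-- only propositions) picks an element of every inhabited type; together with
-- extensionality this yields the axiom of choice for sets and quotients.

record Classical : Setω where
  field
    excluded-middle : ∀ {ℓ} → ExcludedMiddle ℓ
    extensionality  : ∀ {a b} → Extensionality a b

-- The elements of a subset, compared in the ambient type, so that different
-- membership proofs do not count as different elements.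
Elements : ∀ {a ℓ} {A : Set a} → Pred A ℓ → Setoid _ _
Elements {A = A} P = On.setoid {B = Σ A P} (setoid A) proj₁

Finite : ∀ {a ℓ} → Setoid a ℓ → Set _
Finite S = ∃[ n ] Bijection S (setoid (Fin n))

record WellOrder : Set₁ where
  infix 4 _<_ _≤_
  field
    Carrier            : Set
    _<_                : Rel Carrier 0ℓ
    isStrictTotalOrder : IsStrictTotalOrder _≡_ _<_
    wellFounded        : WellFounded _<_

  _≤_ : Rel Carrier 0ℓ
  α ≤ β = α < β ⊎ α ≡ β

  IsZero : Carrier → Set
  IsZero α = ∀ β → ¬ β < α

  IsLimit : Carrier → Set
  IsLimit δ = (∃[ α ] α < δ) × (∀ α → α < δ → ∃[ β ] (α < β × β < δ))

  IsSuccessor : Carrier → Carrier → Set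
  IsSuccessor α β = α < β × (∀ γ → α < γ → β ≤ γ)

-- An ordinal δ is given by a point of a well-order W: it is the order type of
-- {α ∣ α < δ}.  A sequence indexed by α < δ or by α ≤ δ is a function on all
-- of W whose values at other indices are never used.

record Vocabulary : Set₁ where
  field
    FunSym RelSym : Set
    funArity      : FunSym → ℕ
    relArity      : RelSym → ℕ

-- The class from which the elements of models are taken.  As with the class of
-- all sets, every set A has a copy in it that is disjoint from any given set
-- of points.
record Points : Set₂ where
  field
    Point : Set₁
    fresh : (A B : Set) (b : B → Point) →
            ∃[ g ] (Injective (_≡_ {A = A}) (_≡_ {A = Point}) g × (∀ x y → g x ≢ b y))

module Models (τ : Vocabulary) (𝕌 : Points) where
  open Vocabulary τ
  open Points 𝕌

  -- Only the values of rel and fun on tuples from the universe matter; they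
  -- are ignored elsewhere by _⊑_, hence by the equality _≐ₘ_ of models.
  record Structure : Set₂ where
    field
      ∣_∣    : Pred Point 1ℓ
      rel    : (R : RelSym) → Pred (Vec Point (relArity R)) 1ℓ
      fun    : (F : FunSym) → Vec Point (funArity F) → Point
      closed : ∀ F {xs} → All ∣_∣ xs → fun F xs ∈ ∣_∣

  open Structure public

  infix 4 _⊑_ _≐ₘ_

  record _⊑_ (M N : Structure) : Set₁ where
    field
      incl : ∣ M ∣ ⊆ ∣ N ∣
      rel⇔ : ∀ R {xs} → All ∣ M ∣ xs → (xs ∈ rel M R) ⇔ (xs ∈ rel N R)
      fun≡ : ∀ F {xs} → All ∣ M ∣ xs → fun M F xs ≡ fun N F xs

  _≐ₘ_ : Rel Structure 1ℓ
  M ≐ₘ N = M ⊑ N × N ⊑ M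

  -- f restricts to an isomorphism of M onto N; its values off ∣ M ∣ are
  -- irrelevant.
  record IsIso (f : Point → Point) (M N : Structure) : Set₁ where
    field
      maps : ∀ {x} → x ∈ ∣ M ∣ → f x ∈ ∣ N ∣
      inj  : ∀ {x y} → x ∈ ∣ M ∣ → y ∈ ∣ M ∣ → f x ≡ f y → x ≡ y
      surj : ∀ {y} → y ∈ ∣ N ∣ → ∃[ x ] (x ∈ ∣ M ∣ × f x ≡ y)
      rel⇔ : ∀ R {xs} → All ∣ M ∣ xs → (xs ∈ rel M R) ⇔ (map f xs ∈ rel N R)
      fun≡ : ∀ F {xs} → All ∣ M ∣ xs → f (fun M F xs) ≡ fun N F (map f xs)

  HasCard : Structure → Set → Set₁
  HasCard M κ = Bijection (Elements ∣ M ∣) (setoid κ)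

  -- N is the union of the models M i, i ∈ I.  For a nonempty chain this
  -- determines N up to _≐ₘ_, since symbols have finite arity.
  IsUnion : {A : Set} → Pred A 0ℓ → (A → Structure) → Structure → Set₁
  IsUnion I M N = (∀ i → i ∈ I → M i ⊑ N)
                × (∀ {x} → x ∈ ∣ N ∣ → ∃[ i ] (i ∈ I × x ∈ ∣ M i ∣))

  -- I is (_< δ) or (_≤ δ) in all uses.
  IncreasingContinuous : Rel Structure 2ℓ → (W : WellOrder) (let open WellOrder W) →
                         Pred Carrier 0ℓ → (Carrier → Structure) → Set₂
  IncreasingContinuous _⪯_ W I M =
      (∀ α β → α ∈ I → β ∈ I → α < β → M α ⪯ M β)
    × (∀ γ → γ ∈ I → IsLimit γ → IsUnion (_< γ) M (M γ))
    where open WellOrder W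

  record AEC : Set₃ where
    infix 4 _⪯_
    field
      K   : Pred Structure 2ℓ
      _⪯_ : Rel Structure 2ℓ

      ⪯⇒K     : ∀ {M N} → M ⪯ N → M ∈ K × N ∈ K
      -- the universe of a model is a set
      K-small : ∀ {M} → M ∈ K → ∃[ κ ] HasCard M κ

      K-iso : ∀ {f M N} → IsIso f M N → M ∈ K → N ∈ K
      ⪯-iso : ∀ {f M N M′ N′} → IsIso f N N′ → IsIso f M M′ → M ⪯ N → M′ ⪯ N′

      ⪯-isPartialOrder : IsPartialOrder {A = Σ Structure K} (_≐ₘ_ on proj₁) (_⪯_ on proj₁)
      ⪯⇒⊑              : ∀ {M N} → M ⪯ N → M ⊑ N

      union : ∀ (W : WellOrder) (let open WellOrder W) (δ : Carrier) M →
              IsLimit δ → IncreasingContinuous _⪯_ W (_< δ) M →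
              ∀ N → IsUnion (_< δ) M N →
              N ∈ K × (∀ o → IsZero o → M o ⪯ N)

      smoothness : ∀ (W : WellOrder) (let open WellOrder W) (δ : Carrier) M →
                   IsLimit δ → IncreasingContinuous _⪯_ W (_< δ) M →
                   ∀ N → IsUnion (_< δ) M N →
                   ∀ N′ → (∀ α → α < δ → M α ⪯ N′) → N ⪯ N′

      coherence : ∀ {M₀ M₁ M₂} → M₀ ⊑ M₁ → M₁ ⊑ M₂ → M₀ ⪯ M₂ → M₁ ⪯ M₂ → M₀ ⪯ M₁

    IsLSTNumber : Set → Set₂
    IsLSTNumber κ = ∀ {N} → N ∈ K → (A : Pred Point 1ℓ) → A ⊆ ∣ N ∣ →
      ∃[ M ] (A ⊆ ∣ M ∣ × M ⪯ N
              × Injection (Elements ∣ M ∣) (setoid κ ⊎ₛ Elements A))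

    field
      LST       : Set
      LST-holds : IsLSTNumber LST
      LST-least : ∀ κ → IsLSTNumber κ → Injection (setoid LST) (setoid κ)

  -- The cardinal λ is given by the type Λ.
  module Types (𝔨 : AEC) (Λ : Set) where
    open AEC 𝔨

    infix 4 _≺_ _E*_ _≡tp_

    Kλ : Pred Structure 2ℓ
    Kλ M = M ∈ K × HasCard M Λ

    KλSequence : (W : WellOrder) (let open WellOrder W) → Carrier → (Carrier → Structure) → Set₂
    KλSequence W δ M = (∀ α → α ≤ δ → M α ∈ Kλ) × IncreasingContinuous _⪯_ W (_≤ δ) M
      where open WellOrder W

    _≺_ : Rel Structure 2ℓ
    M ≺ N = M ⪯ N × ¬ (M ≐ₘ N)

    IsEmbedding : (Point → Point) → Structure → Structure → Set₂
    IsEmbedding f M N = ∃[ M′ ] (IsIso f M M′ × M′ ⪯ N)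

    IdentityOn : Structure → (Point → Point) → Set₁
    IdentityOn M f = ∀ {x} → x ∈ ∣ M ∣ → f x ≡ x

    -- tp a N _ _ is the triple (M , N , a).  Types over M are represented by
    -- such triples, with _≡tp_ as their equality.
    record TypeOver (M : Structure) : Set₂ where
      constructor tp
      field
        pt    : Point
        ext   : Structure
        M⪯ext : M ⪯ ext
        pt∈   : pt ∈ ∣ ext ∣

    open TypeOver public

    _E*_ : ∀ {M} → Rel (TypeOver M) 2ℓ
    _E*_ {M} p q = ∃[ N₂ ] (ext q ⪯ N₂ ×
      ∃[ f ] (IsEmbedding f (ext p) N₂ × IdentityOn M f × f (pt p) ≡ pt q))

    _≡tp_ : ∀ {M} → Rel (TypeOver M) 2ℓ
    _≡tp_ = TransClosure _E*_

    restrict : ∀ {M₀ M₁} → M₀ ⪯ M₁ → TypeOver M₁ → TypeOver M₀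
    restrict M₀⪯M₁ (tp a N M₁⪯N a∈N) = tp a N (⪯-trans M₀⪯M₁ M₁⪯N) a∈N
      where
      ⪯-trans : ∀ {A B C} → A ⪯ B → B ⪯ C → A ⪯ C
      ⪯-trans r s = IsPartialOrder.trans ⪯-isPartialOrder
        {_ , proj₁ (⪯⇒K r)} {_ , proj₁ (⪯⇒K s)} {_ , proj₂ (⪯⇒K s)} r s

    -- A set of types over M is a set of representatives closed under _≡tp_.
    RespectsTypes : ∀ {M} → Pred (TypeOver M) 2ℓ → Set₂
    RespectsTypes P = ∀ {p q} → p ≡tp q → p ∈ P → q ∈ P

  record GoodFrameMinusStability (Λ : Set) : Set₃ where
    field
      𝔨 : AEC

    open AEC 𝔨 public
    open Types 𝔨 Λ public

    field
      LST≤λ : Injection (setoid LST) (setoid Λ)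

      jointEmbedding : ∀ {M₁ M₂} → M₁ ∈ Kλ → M₂ ∈ Kλ →
        ∃[ M₃ ] (M₃ ∈ Kλ × (∃[ f₁ ] IsEmbedding f₁ M₁ M₃) × (∃[ f₂ ] IsEmbedding f₂ M₂ M₃))

      amalgamation : ∀ {M₀ M₁ M₂} → M₀ ∈ Kλ → M₁ ∈ Kλ → M₂ ∈ Kλ → M₀ ⪯ M₁ → M₀ ⪯ M₂ →
        ∃[ M₃ ] (M₃ ∈ Kλ × (∃[ f₁ ] (IsEmbedding f₁ M₁ M₃ × IdentityOn M₀ f₁))
                         × (∃[ f₂ ] (IsEmbedding f₂ M₂ M₃ × IdentityOn M₀ f₂)))

      noMaximal : ∀ {M} → M ∈ Kλ → ∃[ N ] (N ∈ Kλ × M ≺ N)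

      Sbs          : (M : Structure) → Pred (TypeOver M) 2ℓ
      Sbs-respects : ∀ {M} → RespectsTypes (Sbs M)
      Sbs-⊆        : ∀ {M} {p : TypeOver M} → p ∈ Sbs M →
        M ∈ Kλ × (∃[ q ] (p ≡tp q × M ≺ ext q × ext q ∈ Kλ × pt q ∉ ∣ M ∣))
      Sbs-iso      : ∀ {f M M′ N N′ a} → IsIso f N N′ → IsIso f M M′ →
        (M⪯N : M ⪯ N) (M′⪯N′ : M′ ⪯ N′) (a∈N : a ∈ ∣ N ∣) (fa∈N′ : f a ∈ ∣ N′ ∣) →
        tp a N M⪯N a∈N ∈ Sbs M → tp (f a) N′ M′⪯N′ fa∈N′ ∈ Sbs M′

    -- tp(a,M,N) ∈ Sbs(M)
    Basic : Point → Structure → Structure → Set₂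
    Basic a M N = Σ[ M⪯N ∈ M ⪯ N ] Σ[ a∈N ∈ a ∈ ∣ N ∣ ] tp a N M⪯N a∈N ∈ Sbs M

    field
      density : ∀ {M N} → M ∈ Kλ → N ∈ Kλ → M ≺ N →
        ∃[ a ] (a ∈ ∣ N ∣ × a ∉ ∣ M ∣ × Basic a M N)

      nf     : Structure → Structure → Point → Structure → Set₂
      nf-iso : ∀ {f M₀ M₁ a M₃ M₀′ M₁′ M₃′} →
        IsIso f M₃ M₃′ → IsIso f M₀ M₀′ → IsIso f M₁ M₁′ →
        nf M₀ M₁ a M₃ → nf M₀′ M₁′ (f a) M₃′
      nf-Kλ  : ∀ {M₀ M₁ a M₃} → nf M₀ M₁ a M₃ → M₀ ∈ Kλ × M₁ ∈ Kλ × M₃ ∈ Kλ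
      nf-bs  : ∀ {M₀ M₁ a M₃} → nf M₀ M₁ a M₃ →
        M₀ ⪯ M₁ × M₁ ⪯ M₃ × a ∈ ∣ M₃ ∣ × a ∉ ∣ M₁ ∣ × Basic a M₀ M₃ × Basic a M₁ M₃

      monotonicity : ∀ {M₀ M₀* M₁* M₁ M₃ M₃* M₃** a} →
        M₀* ∈ Kλ → M₁* ∈ Kλ → M₃* ∈ Kλ → M₃** ∈ Kλ →
        M₀ ⪯ M₀* → M₀* ⪯ M₁* → M₁* ⪯ M₁ → M₁ ⪯ M₃ → M₃ ⪯ M₃* →
        ∣ M₁* ∣ ⊆ ∣ M₃** ∣ → a ∈ ∣ M₃** ∣ → M₃** ⪯ M₃* →
        nf M₀ M₁ a M₃ → nf M₀* M₁* a M₃**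

    -- nf is a relation on triples, so a type does not fork when some triple
    -- representing it does not.
    DoesNotFork : ∀ {N} → TypeOver N → Structure → Set₂
    DoesNotFork {N} p M = ∃[ q ] (p ≡tp q × nf M N (pt q) (ext q))

    field
      localCharacter : ∀ (W : WellOrder) (let open WellOrder W) (δ : Carrier) M {N a} →
        IsLimit δ → KλSequence W δ M → N ∈ Kλ → M δ ⪯ N → Basic a (M δ) N →
        ∃[ α ] (α < δ × nf (M α) (M δ) a N)

      uniqueness : ∀ {M N} {p q : TypeOver N} (M⪯N : M ⪯ N) →
        p ∈ Sbs N → q ∈ Sbs N → DoesNotFork p M → DoesNotFork q M →
        restrict M⪯N p ≡tp restrict M⪯N q → p ≡tp q

      symmetry : ∀ {M₀ M₁ M₃ a₁ a₂} →
        M₀ ∈ Kλ → M₁ ∈ Kλ → M₃ ∈ Kλ → M₀ ⪯ M₁ → M₁ ⪯ M₃ →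
        a₁ ∈ ∣ M₁ ∣ → Basic a₁ M₀ M₃ → nf M₀ M₁ a₂ M₃ →
        ∃[ M₂ ] ∃[ M₃* ] (M₂ ∈ Kλ × M₃* ∈ Kλ × a₂ ∈ ∣ M₂ ∣ × M₀ ⪯ M₂ × M₂ ⪯ M₃*
                          × M₃ ⪯ M₃* × nf M₀ M₂ a₁ M₃*)

      extension : ∀ {M N} {p : TypeOver M} → p ∈ Sbs M → N ∈ Kλ → (M≺N : M ≺ N) →
        ∃[ q ] (q ∈ Sbs N × DoesNotFork q M × restrict (proj₁ M≺N) q ≡tp p)

      continuity : ∀ (W : WellOrder) (let open WellOrder W) (δ : Carrier) M (p : TypeOver (M δ)) →
        IsLimit δ → KλSequence W δ M → ∀ o → IsZero o →
        (∀ α → α < δ → (Mα⪯Mδ : M α ⪯ M δ) → DoesNotFork (restrict Mα⪯Mδ p) (M o)) →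
        p ∈ Sbs (M δ) × DoesNotFork p (M o)

  module Independence {Λ : Set} (𝔰 : GoodFrameMinusStability Λ) where
    open GoodFrameMinusStability 𝔰

    IndependentSequence : (W : WellOrder) (let open WellOrder W) → Carrier →
                          (Carrier → Structure) → (Carrier → Point) → Structure → Set₂
    IndependentSequence W α* M′ a M =
        M ∈ Kλ
      × KλSequence W α* M′
      × (∀ o → IsZero o → M ⪯ M′ o)
      × (∀ α β → α < α* → IsSuccessor α β → nf M (M′ α) (a α) (M′ β))
      where open WellOrder W

    Independent : (J : Pred Point 1ℓ) (M : Structure) (A : Pred Point 1ℓ) (N : Structure) → Set₂
    Independent J M A N = N ∈ Kλ ×
      Σ[ W ∈ WellOrder ] let open WellOrder W in
      ∃[ α* ] ∃[ M′ ] ∃[ a ]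
        ( IndependentSequence W α* M′ a M
        × J ≐ (λ x → ∃[ α ] (α < α* × a α ≡ x))
        × (∀ o → IsZero o → A ⊆ ∣ M′ o ∣)
        × ∃[ N⁺ ] (N⁺ ∈ Kλ × M′ α* ⪯ N⁺ × N ⪯ N⁺))

    IndependenceHasContinuity : Set₂
    IndependenceHasContinuity =
      ∀ (W : WellOrder) (let open WellOrder W) (δ : Carrier) M′ M M⁺ (J : Pred Point 1ℓ) →
      IsLimit δ → KλSequence W δ M′ → M ∈ Kλ → M⁺ ∈ Kλ →
      (∀ o → IsZero o → M ⪯ M′ o) → M′ δ ⪯ M⁺ → J ⊆ ∣ M⁺ ∣ →
      (∀ α → α < δ → Independent J M ∣ M′ α ∣ M⁺) →
      Independent J M ∣ M′ δ ∣ M⁺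

    Family : (M : Structure) {M₀ N : Structure} → M₀ ⪯ N → Pred (TypeOver M₀) 2ℓ →
             Pred (Pred Point 1ℓ) 2ℓ
    Family M {M₀} {N} M₀⪯N P J =
        J ⊆ ∣ N ∣
      × Independent J M ∣ M₀ ∣ N
      × (∀ {a} → a ∈ J → (a∈N : a ∈ ∣ N ∣) → tp a N M₀⪯N a∈N ∈ P)

    IsMaximal : Pred (Pred Point 1ℓ) 2ℓ → Pred (Pred Point 1ℓ) 2ℓ
    IsMaximal 𝓕 J = J ∈ 𝓕 × (∀ {J′} → J′ ∈ 𝓕 → J ⊆ J′ → J′ ⊆ J)

{-# OPTIONS --safe #-}
module Submission where

open import Defs
open import Level using (Level; _⊔_; 0ℓ; Lift)
open import Data.Bool using (Bool; true; false)
open import Data.Empty using (⊥)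
open import Data.Fin as Fin using (Fin)
import Data.Fin.Properties as Finₚ
open import Data.Maybe using (Maybe; just; nothing)
open import Data.Nat as ℕ using (ℕ; zero; suc)
import Data.Nat.Induction as ℕᵢ
import Data.Nat.Properties as ℕₚ
open import Data.Product
import Data.Product.Relation.Binary.Lex.Strict as Lex
open import Data.Sum using (_⊎_; inj₁; inj₂; [_,_]′)
import Data.Sum.Relation.Binary.Pointwise as SumRel
open import Data.Unit using (⊤; tt)
open import Data.Vec as Vec using (Vec; []; _∷_)
open import Data.Vec.Relation.Unary.All as VAll using ([]; _∷_)
open import Function using (_∘_; id; _on_)
open import Function.Bundles using (Bijection; Injection; _⇔_; mk⇔; Equivalence)
open import Induction.WellFounded using (WellFounded; Acc; acc; module All; module FixPoint)
open import Relation.Binary.Construct.Closure.Transitive using ([_]; _∷_)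
import Relation.Binary.Construct.On as On
open import Relation.Binary.Core using (Rel)
open import Relation.Binary.Definitions using (tri<; tri≈; tri>; Trichotomous)
open import Relation.Binary.PropositionalEquality
open import Relation.Binary.Structures using (IsStrictTotalOrder; IsPartialOrder)
open import Relation.Nullary using (¬_; Dec; yes; no)
open import Relation.Nullary.Decidable using (decidable-stable; does)
open import Relation.Nullary.Negation using (contradiction)
open import Relation.Unary using (Pred; _∈_; _∉_; _⊆_; _≐_; U)

-- Let J₁ be maximal and J₂ = {b_k} independent.  If J₂ is infinite and does not
-- inject into J₁, let δ be least such that the same holds for {b_k ∣ k < δ}.  Then
-- δ is a limit ordinal, and every function from J₁ to δ is bounded.  The models
-- N_k (k < δ) over which the b_k are free can be enlarged until their union is an
-- extension of N: an element c outside of the union whose type over it is basic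
-- does not fork over some N_k, and by symmetry, extension and uniqueness c can be
-- put into N_k.  So some N_k already contains J₁, and as b_k is free over N_k, the
-- set J₁ ∪ {b_k} is independent, contradicting maximality.

-- Putting `c` into one model forces all later models to move: `b k` was free over the old `N k`,
-- and need not be free over a model that contains `c`. The models are therefore rebuilt by
-- recursion on the index, inside extensions of images of the top model. The obstacle is the limit
-- stage, where the embeddings built so far must extend to the top model without moving `c`;
-- uniqueness of the nonforking type of `c` over the union of the earlier models makes this
-- possible. Rebuilt models may exceed the union of the earlier ones at limits, so the chains are
-- not continuous, while the axioms speak of continuous chains; hence the detour through unions.
-- Every rebuilding also enlarges the top model and creates new points to be covered, whence a
-- transfinite iteration over its points, repeated ω times. The boundedness of functions from `J₁`
-- to δ rests on κ·κ = κ for infinite κ. For finite `J₁` the same argument runs with δ = ω.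

private
  variable
    a b c p q r : Level
    A B C : Set a
    P : Pred A p
    Q : Pred B q
    R : Pred C r

-- Well-orders.

module WellOrderProperties (W : WellOrder) where
  open WellOrder W
  open IsStrictTotalOrder isStrictTotalOrder public using (compare) renaming (trans to <-trans; irrefl to <-irrefl)

  <-irreflexive : ∀ {α} → ¬ α < α
  <-irreflexive = <-irrefl refl

  <-≤-trans : ∀ {α β γ} → α < β → β ≤ γ → α < γ
  <-≤-trans p (inj₁ q)    = <-trans p q
  <-≤-trans p (inj₂ refl) = p

  ≤-<-trans : ∀ {α β γ} → α ≤ β → β < γ → α < γ
  ≤-<-trans (inj₁ p)    q = <-trans p q
  ≤-<-trans (inj₂ refl) q = q

  ≤-trans : ∀ {α β γ} → α ≤ β → β ≤ γ → α ≤ γ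
  ≤-trans p (inj₁ q)    = inj₁ (≤-<-trans p q)
  ≤-trans p (inj₂ refl) = p

  ≮⇒≥ : ∀ {α β} → ¬ α < β → β ≤ α
  ≮⇒≥ {α} {β} ≮ with compare α β
  ... | tri< p _ _    = contradiction p ≮
  ... | tri≈ _ refl _ = inj₂ refl
  ... | tri> _ _ p    = inj₁ p

  ≤⊎> : ∀ α β → α ≤ β ⊎ β < α
  ≤⊎> α β with compare α β
  ... | tri< p _ _ = inj₁ (inj₁ p)
  ... | tri≈ _ p _ = inj₁ (inj₂ p)
  ... | tri> _ _ p = inj₂ p

  ≤-total : ∀ α β → α ≤ β ⊎ β ≤ α
  ≤-total α β with ≤⊎> α β
  ... | inj₁ p = inj₁ p
  ... | inj₂ p = inj₂ (inj₁ p)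

  ≤⇒≯ : ∀ {α β} → α ≤ β → ¬ β < α
  ≤⇒≯ p q = <-irreflexive (≤-<-trans p q)

  zero-≤ : ∀ {o} → IsZero o → ∀ α → o ≤ α
  zero-≤ {o} z α = ≮⇒≥ (z α)

-- Injections between subsets, finite and idempotent sets.

infix 4 _≲_

-- The value may depend on the proof of membership. `inj` compares values across all proofs, so
-- fixing one proof for each point leaves a genuine injection; this spares every construction a
-- proof of independence.
record _≲_ {a b p q} {A : Set a} {B : Set b} (P : Pred A p) (Q : Pred B q) : Set (a ⊔ b ⊔ p ⊔ q) where
  constructor mk≲
  field
    to  : ∀ x → x ∈ P → B
    to∈ : ∀ {x} (px : x ∈ P) → to x px ∈ Q
    inj : ∀ {x y} (px : x ∈ P) (py : y ∈ P) → to x px ≡ to y py → x ≡ y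

≲-trans : P ≲ Q → Q ≲ R → P ≲ R
≲-trans f g = mk≲ (λ x px → G.to _ (F.to∈ px)) (λ px → G.to∈ _) (λ px py e → F.inj px py (G.inj _ _ e))
  where
  module F = _≲_ f
  module G = _≲_ g

⊆⇒≲ : {P : Pred A p} {Q : Pred A q} → P ⊆ Q → P ≲ Q
⊆⇒≲ P⊆Q = mk≲ (λ x _ → x) P⊆Q (λ _ _ e → e)

infixr 5 _⊗_
_⊗_ : ∀ {a b p q} {A : Set a} {B : Set b} → Pred A p → Pred B q → Pred (A × B) (p ⊔ q)
(P ⊗ Q) (x , y) = P x × Q y

⊗-mono : ∀ {a′ b′ p′ q′} {A′ : Set a′} {B′ : Set b′} {P′ : Pred A′ p′} {Q′ : Pred B′ q′} →
         P ≲ P′ → Q ≲ Q′ → (P ⊗ Q) ≲ (P′ ⊗ Q′)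
⊗-mono f g = mk≲ (λ (x , y) (px , qy) → F.to x px , G.to y qy) (λ (px , qy) → F.to∈ px , G.to∈ qy)
  (λ (px , qy) (px′ , qy′) e → cong₂ _,_ (F.inj px px′ (cong proj₁ e)) (G.inj qy qy′ (cong proj₂ e)))
  where
  module F = _≲_ f
  module G = _≲_ g

Fin-⊗ : ∀ {m n} → (U {A = Fin m} ⊗ U {A = Fin n}) ≲ U {A = Fin (m ℕ.* n)}
Fin-⊗ {m} {n} = mk≲ (λ (i , j) _ → Fin.combine i j) (λ _ → tt)
  (λ { {i , j} {i′ , j′} _ _ e → cong₂ _,_ (Finₚ.combine-injectiveˡ i j i′ j′ e) (Finₚ.combine-injectiveʳ i j i′ j′ e) })

Fin-≰ : ∀ n → ¬ U {A = Fin (suc n)} ≲ U {A = Fin n}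
Fin-≰ n f = ℕₚ.<-irrefl refl (Finₚ.injective⇒≤ {f = λ i → F.to i tt} (F.inj tt tt))
  where module F = _≲_ f

FiniteSet : Pred A p → Set _
FiniteSet P = ∃[ n ] P ≲ U {A = Fin n}

Idempotent : Pred A p → Set _
Idempotent P = (P ⊗ P) ≲ P

≲-finite : P ≲ Q → FiniteSet Q → FiniteSet P
≲-finite f (n , g) = n , ≲-trans f g

⊗-finite : FiniteSet P → FiniteSet Q → FiniteSet (P ⊗ Q)
⊗-finite (m , f) (n , g) = m ℕ.* n , ≲-trans (⊗-mono f g) Fin-⊗

-- Adjoining a point is allowed to add nothing, so that no decision is needed.
_∪₁_ : ∀ {a p} {A : Set a} → Pred A p → A → Pred A (a ⊔ p)
(P ∪₁ y) x = P x ⊎ x ≡ y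

-- Choice, Cantor-Bernstein, finite sets and recursion.

module SetTheory (cl : Classical) where
  open Classical cl public renaming (excluded-middle to em)

  by-contradiction : {X : Set a} → ¬ ¬ X → X
  by-contradiction = decidable-stable em

  ∪₁-finite : {P : Pred A p} {y : A} → FiniteSet P → FiniteSet (P ∪₁ y)
  ∪₁-finite {P = P} {y} (n , f) = suc n , mk≲ to (λ _ → tt) inj
    where
    module F = _≲_ f
    to : ∀ x → x ∈ P ∪₁ y → Fin (suc n)
    to x (inj₁ px) = Fin.suc (F.to x px)
    to x (inj₂ _)  = Fin.zero
    inj : ∀ {x x′} (px : x ∈ P ∪₁ y) (py : x′ ∈ P ∪₁ y) → to x px ≡ to x′ py → x ≡ x′
    inj (inj₁ px) (inj₁ py) e = F.inj px py (Finₚ.suc-injective e)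
    inj (inj₂ refl) (inj₂ refl) e = refl

  -- Excluded middle is asked for `P x` without looking at the given proof, so the same proof comes
  -- back each time. Composing with this map makes a function independent of membership proofs.
  canonical : (P : Pred A p) → ∀ x → x ∈ P → x ∈ P
  canonical P x px with em {P = P x}
  ... | yes px′ = px′
  ... | no ¬px  = contradiction px ¬px

  canonical-const : (P : Pred A p) → ∀ x (px px′ : x ∈ P) → canonical P x px ≡ canonical P x px′
  canonical-const P x px px′ with em {P = P x}
  ... | yes _  = refl
  ... | no ¬px = contradiction px ¬px

  record _≅_ {a b p q} {A : Set a} {B : Set b} (P : Pred A p) (Q : Pred B q) : Set (a ⊔ b ⊔ p ⊔ q) where
    field
      to    : ∀ x → x ∈ P → B
      to∈   : ∀ {x} (px : x ∈ P) → to x px ∈ Q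
      const : ∀ {x} (px px′ : x ∈ P) → to x px ≡ to x px′
      inj   : ∀ {x y} (px : x ∈ P) (py : y ∈ P) → to x px ≡ to y py → x ≡ y
      surj  : ∀ {y} → y ∈ Q → ∃[ x ] Σ[ px ∈ x ∈ P ] to x px ≡ y

  ≅⇒Bijection : {P : Pred A p} {Q : Pred B q} → P ≅ Q → Bijection (Elements P) (Elements Q)
  ≅⇒Bijection P≅Q = record
    { to        = λ (x , px) → to x px , to∈ px
    ; cong      = λ { {_ , px} {_ , px′} refl → const px px′ }
    ; bijective = (λ {x} {y} e → inj (proj₂ x) (proj₂ y) e)
                , λ (y , qy) → let (x , px , e) = surj qy in (x , px) , λ { {_ , px′} refl → trans (const px′ px) e } }
    where open _≅_ P≅Q

  ≅⇒Bijection-setoid : {P : Pred A p} → P ≅ U {A = B} → Bijection (Elements P) (setoid B)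
  ≅⇒Bijection-setoid P≅Q = record
    { to        = λ (x , px) → to x px
    ; cong      = λ { {_ , px} {_ , px′} refl → const px px′ }
    ; bijective = (λ {x} {y} e → inj (proj₂ x) (proj₂ y) e)
                , λ y → let (x , px , e) = surj {y} tt in (x , px) , λ { {_ , px′} refl → trans (const px′ px) e } }
    where open _≅_ P≅Q

  -- Cantor–Bernstein: Orbit collects the points of P whose backward orbit under
  -- the two injections ends in P.
  module CantorBernstein {A : Set a} {B : Set b} {P : Pred A p} {Q : Pred B q} (P≲Q : P ≲ Q) (Q≲P : Q ≲ P) where
    private
      module F = _≲_ P≲Q
      module G = _≲_ Q≲P

    f : ∀ x → x ∈ P → B
    f x px = F.to x (canonical P x px)

    g : ∀ y → y ∈ Q → A
    g y qy = G.to y (canonical Q y qy)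

    f-const : ∀ {x} (px px′ : x ∈ P) → f x px ≡ f x px′
    f-const px px′ = cong (F.to _) (canonical-const P _ px px′)

    g-const : ∀ {y} (qy qy′ : y ∈ Q) → g y qy ≡ g y qy′
    g-const qy qy′ = cong (G.to _) (canonical-const Q _ qy qy′)

    g-cong : ∀ {y y′} (qy : y ∈ Q) (qy′ : y′ ∈ Q) → y ≡ y′ → g y qy ≡ g y′ qy′
    g-cong qy qy′ refl = g-const qy qy′

    InRange : Pred A _
    InRange x = ∃[ y ] Σ[ qy ∈ y ∈ Q ] g y qy ≡ x

    data Orbit : A → Set (a ⊔ b ⊔ p ⊔ q) where
      start : ∀ {x} → x ∈ P → ¬ InRange x → Orbit x
      step  : ∀ {x} (px : x ∈ P) (qy : f x px ∈ Q) → Orbit x → Orbit (g (f x px) qy)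

    notOrbit⇒InRange : ∀ {x} → x ∈ P → ¬ Orbit x → InRange x
    notOrbit⇒InRange px ¬o = by-contradiction λ ¬r → ¬o (start px ¬r)

    -- The decision is an argument, so that each property can be shown for every decision by pattern
    -- matching; `em` is inserted at the end. Many later definitions by cases have this form.
    h′ : ∀ x → x ∈ P → Dec (Orbit x) → B
    h′ x px (yes _) = f x px
    h′ x px (no ¬o) = proj₁ (notOrbit⇒InRange (canonical P x px) ¬o)

    h′∈ : ∀ {x} (px : x ∈ P) d → h′ x px d ∈ Q
    h′∈ px (yes _) = F.to∈ _
    h′∈ px (no ¬o) = proj₁ (proj₂ (notOrbit⇒InRange (canonical P _ px) ¬o))

    h′-const : ∀ {x} (px px′ : x ∈ P) d → h′ x px d ≡ h′ x px′ d
    h′-const px px′ (yes _) = f-const px px′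
    h′-const px px′ (no ¬o) = cong (λ z → proj₁ (notOrbit⇒InRange z ¬o)) (canonical-const P _ px px′)

    h′-inj : ∀ {x y} (px : x ∈ P) (py : y ∈ P) d e → h′ x px d ≡ h′ y py e → x ≡ y
    h′-inj px py (yes _) (yes _) eq = F.inj _ _ eq
    h′-inj {x} {y} px py (yes o) (no ¬o) eq with notOrbit⇒InRange (canonical P y py) ¬o
    -- Here `y` is the image under `g` of `f x`, and so continues the orbit of `x`.
    ... | (z , qz , gz≡y) = contradiction (subst Orbit (trans (g-cong qfx qz eq) gz≡y) (step px qfx o)) ¬o
      where qfx = F.to∈ (canonical P x px)
    h′-inj {x} {y} px py (no ¬o) (yes o) eq with notOrbit⇒InRange (canonical P x px) ¬o
    ... | (z , qz , gz≡x) = contradiction (subst Orbit (trans (g-cong qfy qz (sym eq)) gz≡x) (step py qfy o)) ¬o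
      where qfy = F.to∈ (canonical P y py)
    h′-inj {x} {y} px py (no ¬o) (no ¬o′) eq
      with notOrbit⇒InRange (canonical P x px) ¬o | notOrbit⇒InRange (canonical P y py) ¬o′
    ... | (z , qz , e) | (z′ , qz′ , e′) = trans (sym e) (trans (g-cong qz qz′ eq) e′)

    h′-surj-orbit : ∀ {x y} → Orbit x → (qy : y ∈ Q) → g y qy ≡ x → ∃[ x ] Σ[ px ∈ x ∈ P ] h′ x px em ≡ y
    h′-surj-orbit (start _ ¬r) qy e = contradiction (_ , qy , e) ¬r
    h′-surj-orbit (step {x} px qfx o) qy e = x , px , lemma em
      where
      lemma : ∀ d → h′ x px d ≡ _
      lemma (yes _) = sym (G.inj _ _ e)
      lemma (no ¬o) = contradiction o ¬o

    h′-surj : ∀ {y} → y ∈ Q → ∃[ x ] Σ[ px ∈ x ∈ P ] h′ x px em ≡ y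
    h′-surj {y} qy with em {P = Orbit (g y qy)}
    ... | yes o = h′-surj-orbit o qy refl
    ... | no ¬o = g y qy , px , lemma em
      where
      px = G.to∈ (canonical Q y qy)
      lemma : ∀ d → h′ (g y qy) px d ≡ y
      lemma (yes o) = contradiction o ¬o
      lemma (no ¬o) with notOrbit⇒InRange (canonical P _ px) ¬o
      ... | (z , qz , e) = G.inj _ _ e

    ≲-antisym : P ≅ Q
    ≲-antisym = record
      { to    = λ x px → h′ x px em
      ; to∈   = λ px → h′∈ px em
      ; const = λ px px′ → h′-const px px′ em
      ; inj   = λ px py → h′-inj px py em em
      ; surj  = h′-surj }

  open CantorBernstein public using (≲-antisym)

  Bijection⇒≲ : {P : Pred A p} → Bijection (Elements P) (setoid B) → P ≲ U {A = B}
  Bijection⇒≲ bij = mk≲ (λ x px → to (x , px)) (λ _ → tt) (λ px py → injective)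
    where open Bijection bij

  Bijection⇒≳ : {P : Pred A p} → Bijection (Elements P) (setoid B) → U {A = B} ≲ P
  Bijection⇒≳ {P = P} bij = mk≲ (λ y _ → proj₁ (proj₁ (surjective y))) (λ {y} _ → proj₂ (proj₁ (surjective y)))
    λ {y} {y′} _ _ e → trans (sym (proj₂ (surjective y) {proj₁ (surjective y)} refl))
                             (proj₂ (surjective y′) {proj₁ (surjective y)} e)
    where open Bijection bij

  ≲-antisym-setoid : ∀ {B : Set b} → U {A = A} ≲ U {A = B} → U {A = B} ≲ U {A = A} → Bijection (setoid A) (setoid B)
  ≲-antisym-setoid f g = record
    { to = λ x → to x tt ; cong = λ { refl → refl }
    ; bijective = (λ e → inj tt tt e) , λ y → let (x , _ , e) = surj {y} tt in x , λ { refl → e } }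
    where open _≅_ (≲-antisym f g)

  Fin≲-extend : ∀ {P : Pred A p} n → U {A = Fin n} ≲ P → P ≲ U {A = Fin n} ⊎ U {A = Fin (suc n)} ≲ P
  Fin≲-extend {A = A} {P = P} n f with em {P = ∃[ x ] (x ∈ P × (∀ i → F.to i tt ≢ x))}
    where module F = _≲_ f
  ... | yes (x , px , new) = inj₂ (mk≲ (λ i _ → to i) (λ {i} _ → to∈ i) (λ {i} {j} _ _ → inj i j))
    where
    module F = _≲_ f
    to : Fin (suc n) → A
    to Fin.zero    = x
    to (Fin.suc i) = F.to i tt
    to∈ : ∀ i → to i ∈ P
    to∈ Fin.zero    = px
    to∈ (Fin.suc i) = F.to∈ tt
    inj : ∀ i j → to i ≡ to j → i ≡ j
    inj Fin.zero Fin.zero e = refl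
    inj Fin.zero (Fin.suc j) e = contradiction (sym e) (new j)
    inj (Fin.suc i) Fin.zero e = contradiction e (new i)
    inj (Fin.suc i) (Fin.suc j) e = cong Fin.suc (F.inj tt tt e)
  ... | no ¬new = inj₁ (mk≲ (λ x px → proj₁ (old x px)) (λ _ → tt)
                  λ {x} {y} px py e → trans (sym (proj₂ (old x px))) (trans (cong (λ i → F.to i tt) e) (proj₂ (old y py))))
    where
    module F = _≲_ f
    old : ∀ x → x ∈ P → ∃[ i ] F.to i tt ≡ x
    old x px = by-contradiction λ ¬∃ → ¬new (x , px , λ i e → ¬∃ (i , e))

  Fin≲⊎≅ : ∀ (P : Pred A p) n → (∃[ m ] (P ≲ U {A = Fin m} × U {A = Fin m} ≲ P)) ⊎ U {A = Fin n} ≲ P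
  Fin≲⊎≅ P zero = inj₂ (mk≲ (λ ()) (λ {}) λ {})
  Fin≲⊎≅ P (suc n) with Fin≲⊎≅ P n
  ... | inj₁ m = inj₁ m
  ... | inj₂ f with Fin≲-extend n f
  ...   | inj₁ g = inj₁ (n , g , f)
  ...   | inj₂ g = inj₂ g

  infinite⇒Fin≲ : {P : Pred A p} → ¬ FiniteSet P → ∀ n → U {A = Fin n} ≲ P
  infinite⇒Fin≲ {P = P} ¬fin n with Fin≲⊎≅ P n
  ... | inj₁ (m , f , _) = contradiction (m , f) ¬fin
  ... | inj₂ f = f

  FiniteSet⇒≅Fin : {P : Pred A p} → FiniteSet P → ∃[ m ] (P ≲ U {A = Fin m} × U {A = Fin m} ≲ P)
  FiniteSet⇒≅Fin {P = P} (n , f) with Fin≲⊎≅ P (suc n)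
  ... | inj₁ m = m
  ... | inj₂ g = contradiction (≲-trans g f) (Fin-≰ n)

  FiniteSet⇒Finite : {P : Pred A p} → FiniteSet P → Finite (Elements P)
  FiniteSet⇒Finite fin = let (m , f , g) = FiniteSet⇒≅Fin fin in m , ≅⇒Bijection-setoid (≲-antisym f g)

  module Recursion {w s ℓ ℓ′} {W : Set w} {_<_ : Rel W ℓ} (wf : WellFounded _<_) {State : Set s} (default : State)
    (Ext : ∀ j → (∀ k → k < j → State) → State → Set ℓ′) where

    pick : ∀ {ℓ} {Q : Pred State ℓ} → Dec (∃[ x ] Q x) → State
    pick (yes (x , _)) = x
    pick (no _)        = default

    pick-satisfies : ∀ {ℓ} {Q : Pred State ℓ} (d : Dec (∃[ x ] Q x)) → ∃[ x ] Q x → Q (pick d)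
    pick-satisfies (yes (_ , qx)) _ = qx
    pick-satisfies (no ¬∃)        ∃x = contradiction ∃x ¬∃

    next : ∀ j → (∀ {k} → k < j → State) → State
    next j h = pick (em {P = ∃[ x ] Ext j (λ k p → h p) x})

    open FixPoint wf (λ _ → State) next
      (λ x {h} {h′} e → cong (λ (g : ∀ k → k < x → State) → pick (em {P = ∃[ y ] Ext x g y}))
                          (extensionality λ k → extensionality λ p → e p))
      using (unfold-wfRec)

    family : W → State
    family = All.wfRec wf _ (λ _ → State) next

    -- Excluded middle on inhabited types picks a state that fits the earlier ones. A fitting state
    -- need only exist for histories whose members fit themselves; on the other histories `next` may
    -- fall back on `default`.
    recursion : (∀ j (s : W → State) → (∀ k → k < j → Ext k (λ l _ → s l) (s k)) → ∃[ x ] Ext j (λ l _ → s l) x) →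
                ∃[ s ] (∀ j → Ext j (λ l _ → s l) (s j))
    recursion step = family , All.wfRec wf _ (λ j → Ext j (λ l _ → family l) (family j))
      λ j ih → subst (Ext j _) (sym unfold-wfRec) (pick-satisfies em (step j family λ k p → ih p))

  least : ∀ {w ℓ} {W : Set w} {_<_ : Rel W ℓ} → WellFounded _<_ → {P : Pred W p} →
          ∀ {x} → P x → ∃[ x ] (P x × (∀ y → y < x → ¬ P y))
  least wf {P} {x} Px = by-contradiction λ ¬∃ →
    All.wfRec wf _ (λ x → ¬ P x) (λ x ih Px → ¬∃ (x , Px , λ y y<x → ih y<x)) x Px

  -- Each `z` is sent to a point of `D` that no earlier index has taken. If none were left, mapping
  -- every point of `D` to an index that took it would inject `D` into the predecessors of `z`.
  greedy : ∀ {w ℓ} {W : Set w} {_<_ : Rel W ℓ} → WellFounded _<_ → (∀ {x y} → x ≢ y → x < y ⊎ y < x) →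
           {E : Pred W q} {D : Pred A p} → (∀ z → z ∈ E → ¬ (D ≲ (_< z))) → E ≲ D
  greedy {A = A} {W = W} {_<_} wf connected {E} {D} room with em {P = ∃[ z ] E z}
  ... | no ¬E =
    mk≲ (λ x ex → contradiction (x , ex) ¬E) (λ ex → contradiction (_ , ex) ¬E) (λ ex _ → contradiction (_ , ex) ¬E)
  ... | yes (z₀ , ez₀) = mk≲ (λ z _ → s z) (λ {z} ez → proj₁ (s-ok z ez))
        λ {z} {z′} ez ez′ e → by-contradiction λ z≢z′ →
          [ (λ z<z′ → proj₂ (s-ok z′ ez′) z z<z′ e) , (λ z′<z → proj₂ (s-ok z ez) z′ z′<z (sym e)) ]′ (connected z≢z′)
    where
    nonempty : ∃[ x ] D x
    -- An empty `D` would inject into any segment. The point found serves as the default state of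
    -- the recursion.
    nonempty = by-contradiction λ ¬D → room z₀ ez₀
      (mk≲ (λ x dx → contradiction (x , dx) ¬D) (λ dx → contradiction (_ , dx) ¬D) (λ dx _ → contradiction (_ , dx) ¬D))
    Ext : ∀ j → (∀ k → k < j → A) → A → Set _
    Ext j h x = j ∈ E → x ∈ D × (∀ k (p : k < j) → h k p ≢ x)
    step : ∀ j (s : W → A) → (∀ k → k < j → Ext k (λ l _ → s l) (s k)) → ∃[ x ] Ext j (λ l _ → s l) x
    step j s _ with em {P = ∃[ x ] (x ∈ D × (∀ k → k < j → s k ≢ x))}
    ... | yes (x , dx , new) = x , λ _ → dx , new
    ... | no ¬new = proj₁ nonempty , λ ej → contradiction
            (mk≲ (λ x dx → proj₁ (old x dx)) (λ {x} dx → proj₁ (proj₂ (old x dx)))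
               (λ {x} {y} dx dy e → trans (sym (proj₂ (proj₂ (old x dx)))) (trans (cong s e) (proj₂ (proj₂ (old y dy))))))
            (room j ej)
      where
      old : ∀ x → x ∈ D → ∃[ k ] (k < j × s k ≡ x)
      old x dx = by-contradiction λ ¬∃ → ¬new (x , dx , λ k k<j e → ¬∃ (k , k<j , e))
    family = Recursion.recursion wf (proj₁ nonempty) Ext step
    s = proj₁ family
    s-ok = proj₂ family

-- An ordinal is given as a point of a well-order, so sequences indexed by the whole order, or
-- longer by one, require a point above all others.
withTop : WellOrder → WellOrder
withTop W = record
  { Carrier = Maybe Carrier
  ; _<_ = _<⁺_
  ; isStrictTotalOrder = record
    { isStrictPartialOrder = record
      { isEquivalence = isEquivalence
      ; irrefl = λ { {just x} refl → <-irreflexive ; {nothing} refl () }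
      ; trans = λ {x} {y} {z} → <⁺-trans x y z
      ; <-resp-≈ = resp₂ _<⁺_ }
    ; compare = cmp }
  ; wellFounded = wf }
  where
  open WellOrder W
  open WellOrderProperties W
  _<⁺_ : Rel (Maybe Carrier) 0ℓ
  just x  <⁺ just y  = x < y
  just x  <⁺ nothing = ⊤
  nothing <⁺ _       = ⊥
  <⁺-trans : ∀ x y z → x <⁺ y → y <⁺ z → x <⁺ z
  <⁺-trans (just x) (just y) (just z) = <-trans
  <⁺-trans (just x) (just y) nothing _ _ = tt
  <⁺-trans (just x) nothing z _ ()
  <⁺-trans nothing y z ()
  cmp : Trichotomous _≡_ _<⁺_
  cmp (just x) (just y) with compare x y
  ... | tri< p ¬q ¬r    = tri< p (λ { refl → ¬q refl }) ¬r
  ... | tri≈ ¬p refl ¬r = tri≈ ¬p refl ¬r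
  ... | tri> ¬p ¬q r    = tri> ¬p (λ { refl → ¬q refl }) r
  cmp (just x) nothing = tri< tt (λ ()) (λ ())
  cmp nothing (just y) = tri> (λ ()) (λ ()) tt
  cmp nothing nothing  = tri≈ (λ ()) refl (λ ())
  acc-just : ∀ {x} → Acc _<_ x → Acc _<⁺_ (just x)
  acc-just (acc rs) = acc λ { {just y} y<x → acc-just (rs y<x) }
  wf : WellFounded _<⁺_
  wf (just x) = acc-just (wellFounded x)
  wf nothing  = acc λ { {just y} _ → acc-just (wellFounded y) }

ℕ-wellOrder : WellOrder
ℕ-wellOrder = record
  { Carrier = ℕ ; _<_ = ℕ._<_ ; isStrictTotalOrder = ℕₚ.<-isStrictTotalOrder ; wellFounded = ℕᵢ.<-wellFounded }

-- Cardinal arithmetic: Hessenberg and Zermelo.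

module Cardinals (cl : Classical) where
  open SetTheory cl public

  -- Two distinct points `x₀`, `x₁` suffice: an old `x` becomes the pair `(x , x₀)`, the new point
  -- `(x₀ , x₁)`, and the second coordinate separates them. With fewer than two points the set is
  -- finite.
  idempotent⇒∪₁ : {P : Pred A p} {y : A} → Idempotent P → FiniteSet P ⊎ (P ∪₁ y) ≲ P
  idempotent⇒∪₁ {A = A} {P = P} {y} P²≲P with em {P = ∃[ x₀ ] ∃[ x₁ ] (x₀ ∈ P × x₁ ∈ P × x₀ ≢ x₁)}
  ... | yes (x₀ , x₁ , p₀ , p₁ , x₀≢x₁) = inj₂ (≲-trans (mk≲ to to∈ inj) P²≲P)
    where
    to : ∀ x → x ∈ P ∪₁ y → A × A
    to x (inj₁ _) = x , x₀
    to x (inj₂ _) = x₀ , x₁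
    to∈ : ∀ {x} (px : x ∈ P ∪₁ y) → to x px ∈ P ⊗ P
    to∈ (inj₁ px) = px , p₀
    to∈ (inj₂ _)  = p₀ , p₁
    inj : ∀ {x x′} (px : x ∈ P ∪₁ y) (px′ : x′ ∈ P ∪₁ y) → to x px ≡ to x′ px′ → x ≡ x′
    inj (inj₁ _) (inj₁ _) e = cong proj₁ e
    inj (inj₁ _) (inj₂ _) e = contradiction (cong proj₂ e) x₀≢x₁
    inj (inj₂ _) (inj₁ _) e = contradiction (sym (cong proj₂ e)) x₀≢x₁
    inj (inj₂ refl) (inj₂ refl) _ = refl
  ... | no ¬∃ = inj₁ (1 , mk≲ (λ _ _ → Fin.zero) (λ _ → tt)
                  λ {x} {y} px py _ → by-contradiction λ x≢y → ¬∃ (x , y , px , py , x≢y))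

  -- A point is coded by the pair of an index of a member containing it and its code within that
  -- member.
  ⋃-≲ : ∀ {c s} {C : Set c} {D : Pred C s} {I : Pred A p} {X : A → Pred B q} {Y : Pred B r} →
        Idempotent D → I ≲ D → (∀ {i} → i ∈ I → X i ≲ D) →
        (∀ {x} → x ∈ Y → ∃[ i ] (i ∈ I × x ∈ X i)) → Y ≲ D
  ⋃-≲ {A = A} {B = B} {C = C} {D} {I} {X} {Y} D² I≲ X≲ cover =
    ≲-trans (mk≲ (λ x y → to x (cover y)) (λ y → to∈ (cover y)) (λ y y′ e → inj (cover y) (cover y′) e)) D²
    where
    idx : ∀ i (i∈ : i ∈ I) → X i ≲ D
    -- Two points with the same index must be coded by the same injection, although their membership
    -- proofs for the index may differ.
    idx i i∈ = X≲ (canonical I i i∈)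
    to : ∀ x → ∃[ i ] (i ∈ I × x ∈ X i) → C × C
    to x (i , i∈ , x∈) = _≲_.to I≲ i i∈ , _≲_.to (idx i i∈) x x∈
    to∈ : ∀ {x} (c : ∃[ i ] (i ∈ I × x ∈ X i)) → to x c ∈ D ⊗ D
    to∈ (i , i∈ , x∈) = _≲_.to∈ I≲ i∈ , _≲_.to∈ (idx i i∈) x∈
    inj-at : ∀ {i x x′} {f g : X i ≲ D} → f ≡ g → (x∈ : x ∈ X i) (x′∈ : x′ ∈ X i) →
             _≲_.to f x x∈ ≡ _≲_.to g x′ x′∈ → x ≡ x′
    inj-at {f = f} refl x∈ x′∈ e = _≲_.inj f x∈ x′∈ e
    inj : ∀ {x x′} (c : ∃[ i ] (i ∈ I × x ∈ X i)) (c′ : ∃[ i ] (i ∈ I × x′ ∈ X i)) → to x c ≡ to x′ c′ → x ≡ x′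
    inj (i , i∈ , x∈) (j , j∈ , x′∈) e with _≲_.inj I≲ i∈ j∈ (cong proj₁ e)
    ... | refl = inj-at (cong X≲ (canonical-const I i i∈ j∈)) x∈ x′∈ (cong proj₂ e)

  FinOrIdempotent : Pred A p → Set _
  FinOrIdempotent P = FiniteSet P ⊎ Idempotent P

  -- Pairs are sent to new elements one after another along Gödel's ordering, in
  -- which the predecessors of a pair lie in the square of a smaller segment.
  module Hessenberg (W : WellOrder) where
    open WellOrder W
    open WellOrderProperties W

    max : Carrier → Carrier → Carrier
    max x y with ≤⊎> x y
    ... | inj₁ _ = y
    ... | inj₂ _ = x

    max-≤ˡ : ∀ x y → x ≤ max x y
    max-≤ˡ x y with ≤⊎> x y
    ... | inj₁ p = p
    ... | inj₂ _ = inj₂ refl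

    max-≤ʳ : ∀ x y → y ≤ max x y
    max-≤ʳ x y with ≤⊎> x y
    ... | inj₁ _ = inj₂ refl
    ... | inj₂ p = inj₁ p

    max-∈ : (D : Pred Carrier p) → ∀ {x y} → x ∈ D → y ∈ D → max x y ∈ D
    max-∈ D {x} {y} dx dy with ≤⊎> x y
    ... | inj₁ _ = dy
    ... | inj₂ _ = dx

    key : Carrier × Carrier → Carrier × Carrier × Carrier
    key (x , y) = max x y , x , y

    _≺₂_ : Rel (Carrier × Carrier) 0ℓ
    _≺₂_ = Lex.×-Lex _≡_ _<_ _<_

    _≺₃_ : Rel (Carrier × Carrier × Carrier) 0ℓ
    _≺₃_ = Lex.×-Lex _≡_ _<_ _≺₂_

    _≺_ : Rel (Carrier × Carrier) 0ℓ
    _≺_ = _≺₃_ on key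

    ≺-wellFounded : WellFounded _≺_
    ≺-wellFounded = On.wellFounded key
      (Lex.×-wellFounded {_<₁_ = _<_} {_<₂_ = _≺₂_} wellFounded
        (Lex.×-wellFounded {_<₁_ = _<_} {_<₂_ = _<_} wellFounded wellFounded))

    ≺-connected : ∀ {z z′} → z ≢ z′ → z ≺ z′ ⊎ z′ ≺ z
    ≺-connected {z} {z′} z≢z′ with
      Lex.×-compare {_<₁_ = _<_} {_<₂_ = _≺₂_} sym compare
        (Lex.×-compare {_<₁_ = _<_} {_<₂_ = _<_} sym compare compare) (key z) (key z′)
    ... | tri< p _ _ = inj₁ p
    ... | tri≈ _ (_ , refl , refl) _ = contradiction refl z≢z′
    ... | tri> _ _ p = inj₂ p

    ≺⇒max≤ : ∀ {z z′} → z ≺ z′ → max (proj₁ z) (proj₂ z) ≤ max (proj₁ z′) (proj₂ z′)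
    ≺⇒max≤ (inj₁ p)       = inj₁ p
    ≺⇒max≤ (inj₂ (e , _)) = inj₂ e

    ≺⊆ : ∀ {z} (let m = max (proj₁ z) (proj₂ z)) → (_≺ z) ⊆ (((_< m) ∪₁ m) ⊗ ((_< m) ∪₁ m))
    ≺⊆ {z} {x , y} p = ≤-trans (max-≤ˡ x y) (≺⇒max≤ {x , y} {z} p) , ≤-trans (max-≤ʳ x y) (≺⇒max≤ {x , y} {z} p)

    -- If `D` injects into a proper segment, it inherits the property from there. Otherwise pairs
    -- can be numbered greedily: the predecessors of a pair lie in the square of a segment enlarged
    -- by its bound, which is finite or again injects into the segment, so they never use up an
    -- infinite `D`.
    initialSegment : (D : Pred Carrier p) → (∀ {β} → β ∈ D → (_< β) ⊆ D) →
                     (∀ {β} → β ∈ D → FinOrIdempotent (_< β)) → FinOrIdempotent D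
    initialSegment D down below with em {P = ∃[ β ] (β ∈ D × D ≲ (_< β))}
    ... | yes (β , β∈D , D≲β) with below β∈D
    ...   | inj₁ fin = inj₁ (≲-finite D≲β fin)
    ...   | inj₂ idem = inj₂ (≲-trans (⊗-mono D≲β D≲β) (≲-trans idem (⊆⇒≲ (down β∈D))))
    initialSegment D down below | no initial with em {P = FiniteSet D}
    ... | yes fin = inj₁ fin
    ... | no ¬fin = inj₂ (greedy ≺-wellFounded ≺-connected room)
      where
      room : ∀ z → z ∈ D ⊗ D → ¬ D ≲ (_≺ z)
      room z (dx , dy) D≲z with below (max-∈ D dx dy)
      ... | inj₁ fin = ¬fin (≲-finite D≲z (≲-finite (⊆⇒≲ (≺⊆ {z})) (⊗-finite (∪₁-finite fin) (∪₁-finite fin))))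
      ... | inj₂ idem with idempotent⇒∪₁ {y = max (proj₁ z) (proj₂ z)} idem
      ...   | inj₁ fin = ¬fin (≲-finite D≲z (≲-finite (⊆⇒≲ (≺⊆ {z})) (⊗-finite (∪₁-finite fin) (∪₁-finite fin))))
      ...   | inj₂ f   = initial (_ , max-∈ D dx dy , ≲-trans D≲z (≲-trans (⊆⇒≲ (≺⊆ {z})) (≲-trans (⊗-mono f f) idem)))

    segment : ∀ β → FinOrIdempotent (_< β)
    segment = All.wfRec wellFounded _ (λ β → FinOrIdempotent (_< β))
      λ β ih → initialSegment (_< β) (λ γ<β δ<γ → <-trans δ<γ γ<β) (λ γ<β → ih γ<β)

    all : FinOrIdempotent (U {A = Carrier})
    all = initialSegment U (λ _ _ → tt) (λ {β} _ → segment β)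

  -- Zermelo's theorem: the tower of subsets obtained by repeatedly adjoining a
  -- chosen new element is well-ordered by inclusion, and every x is the element
  -- adjoined to the largest member of the tower that omits x.
  module Zermelo (X : Set) where
    -- Boolean-valued functions keep the power set in `Set`, so that families of subsets can be
    -- joined inside `Tower`; by excluded middle no subset is lost.
    𝒫 : Set
    𝒫 = X → Bool

    infix 4 _∈ᵇ_ _⊆ᵇ_
    _∈ᵇ_ : ∀ {A : Set} → A → (A → Bool) → Set
    x ∈ᵇ s = s x ≡ true

    _⊆ᵇ_ : 𝒫 → 𝒫 → Set
    s ⊆ᵇ t = ∀ x → x ∈ᵇ s → x ∈ᵇ t

    ⌊_⌋ : ∀ {A : Set} → Pred A 0ℓ → A → Bool
    ⌊ P ⌋ x = does (em {P = P x})

    ⌊⌋⁺ : ∀ {A : Set} {P : Pred A 0ℓ} {x} → P x → x ∈ᵇ ⌊ P ⌋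
    ⌊⌋⁺ {P = P} {x} px with em {P = P x}
    ... | yes _ = refl
    ... | no ¬p = contradiction px ¬p

    ⌊⌋⁻ : ∀ {A : Set} {P : Pred A 0ℓ} {x} → x ∈ᵇ ⌊ P ⌋ → P x
    ⌊⌋⁻ {P = P} {x} e with em {P = P x}
    ⌊⌋⁻ e  | yes px = px
    ⌊⌋⁻ () | no _

    ⊆ᵇ-antisym : ∀ {s t} → s ⊆ᵇ t → t ⊆ᵇ s → s ≡ t
    ⊆ᵇ-antisym {s} {t} s⊆t t⊆s = extensionality λ x → eq x (s x) (t x) refl refl
      where
      eq : ∀ x u v → s x ≡ u → t x ≡ v → s x ≡ t x
      eq x true  _     sx tx = trans sx (sym (s⊆t x sx))
      eq x false true  sx tx = trans (t⊆s x tx) (sym tx)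
      eq x false false sx tx = trans sx (sym tx)

    Proper : 𝒫 → Set
    Proper s = ∃[ x ] ¬ x ∈ᵇ s

    choose : ∀ s → Proper s → Proper s
    choose s e = canonical (λ (_ : ⊤) → Proper s) tt e

    Succ : 𝒫 → Pred X 0ℓ
    Succ s x = x ∈ᵇ s ⊎ Σ[ e ∈ Proper s ] proj₁ (choose s e) ≡ x

    succ : 𝒫 → 𝒫
    succ s = ⌊ Succ s ⌋

    Union : (𝒫 → Bool) → Pred X 0ℓ
    Union F x = ∃[ s ] (s ∈ᵇ F × x ∈ᵇ s)

    ⋃ : (𝒫 → Bool) → 𝒫
    ⋃ F = ⌊ Union F ⌋

    data Tower : 𝒫 → Set where
      succᵗ : ∀ {s} → Tower s → Tower (succ s)
      ⋃ᵗ    : ∀ {F} → (∀ s → s ∈ᵇ F → Tower s) → Tower (⋃ F)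

    s⊆succ : ∀ s → s ⊆ᵇ succ s
    s⊆succ s x xs = ⌊⌋⁺ {P = Succ s} (inj₁ xs)

    ⊆⋃ : ∀ {F s} → s ∈ᵇ F → s ⊆ᵇ ⋃ F
    ⊆⋃ {F} sF x xs = ⌊⌋⁺ {P = Union F} (_ , sF , xs)

    ⋃⊆ : ∀ {F t} → (∀ s → s ∈ᵇ F → s ⊆ᵇ t) → ⋃ F ⊆ᵇ t
    ⋃⊆ {F} h x x∈ = let (s , sF , xs) = ⌊⌋⁻ {P = Union F} x∈ in h s sF x xs

    -- The extreme points from the proof of the Bourbaki-Witt fixed point theorem: they are
    -- comparable with the whole tower, and every member of the tower turns out to be one.
    Extreme : 𝒫 → Set
    Extreme s = ∀ {t} → Tower t → t ⊆ᵇ s → t ≢ s → succ t ⊆ᵇ s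

    compareExtreme : ∀ {s} → Extreme s → ∀ {t} → Tower t → t ⊆ᵇ s ⊎ succ s ⊆ᵇ t
    compareExtreme {s} ex (succᵗ {t} T) with compareExtreme ex T
    ... | inj₂ le = inj₂ λ x xs → s⊆succ t x (le x xs)
    ... | inj₁ t⊆s with em {P = t ≡ s}
    ...   | yes refl = inj₂ λ x xs → xs
    ...   | no t≢s   = inj₁ (ex T t⊆s t≢s)
    compareExtreme {s} ex (⋃ᵗ {F} T) with em {P = ∃[ t ] (t ∈ᵇ F × succ s ⊆ᵇ t)}
    ... | yes (t , tF , le) = inj₂ λ x xs → ⊆⋃ tF x (le x xs)
    ... | no ¬∃ = inj₁ (⋃⊆ λ t tF → [ id , (λ le → contradiction (t , tF , le) ¬∃) ]′ (compareExtreme ex (T t tF)))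

    extreme : ∀ {s} → Tower s → Extreme s
    extreme (succᵗ {s} S) {t} T t⊆ t≢ with compareExtreme (extreme S) T
    ... | inj₂ ⊆t = contradiction (⊆ᵇ-antisym t⊆ ⊆t) t≢
    ... | inj₁ t⊆s with em {P = t ≡ s}
    ...   | yes refl = λ x xt → xt
    ...   | no t≢s   = λ x xt → s⊆succ s x (extreme S T t⊆s t≢s x xt)
    extreme (⋃ᵗ {F} S) {t} T t⊆ t≢ with em {P = ∃[ s ] (s ∈ᵇ F × ¬ s ⊆ᵇ t)}
    ... | no ¬∃ = contradiction (⊆ᵇ-antisym t⊆ (⋃⊆ λ s sF → by-contradiction λ s⊈t → ¬∃ (s , sF , s⊈t))) t≢
    ... | yes (s , sF , s⊈t) with compareExtreme (extreme (S s sF)) T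
    ...   | inj₂ le = contradiction (λ x xs → le x (s⊆succ s x xs)) s⊈t
    ...   | inj₁ t⊆s = λ x xt → ⊆⋃ sF x (extreme (S s sF) T t⊆s (λ { refl → s⊈t (λ _ z → z) }) x xt)

    compareTower : ∀ {s t} → Tower s → Tower t → t ⊆ᵇ s ⊎ succ s ⊆ᵇ t
    compareTower S T = compareExtreme (extreme S) T

    Omitting : X → Pred 𝒫 0ℓ
    Omitting y s = Tower s × ¬ y ∈ᵇ s

    before : X → 𝒫
    before y = ⋃ ⌊ Omitting y ⌋

    before-tower : ∀ y → Tower (before y)
    before-tower y = ⋃ᵗ λ s sF → proj₁ (⌊⌋⁻ {P = Omitting y} sF)

    omits : ∀ y → ¬ y ∈ᵇ before y
    omits y y∈ = let (s , sF , ys) = ⌊⌋⁻ {P = Union ⌊ Omitting y ⌋} y∈ in proj₂ (⌊⌋⁻ {P = Omitting y} sF) ys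

    largest : ∀ {y s} → Tower s → ¬ y ∈ᵇ s → s ⊆ᵇ before y
    largest {y} {s} S y∉ = ⊆⋃ (⌊⌋⁺ {P = Omitting y} (S , y∉))

    -- Otherwise the successor of `before y` would be a member of the tower omitting `y`, hence
    -- contained in `before y`, although it has a chosen element outside.
    ∈succ-before : ∀ y → y ∈ᵇ succ (before y)
    ∈succ-before y = by-contradiction λ y∉ →
      let e = choose (before y) (y , omits y) in
      proj₂ e (largest (succᵗ (before-tower y)) y∉ (proj₁ e) (⌊⌋⁺ {P = Succ (before y)} (inj₂ ((y , omits y) , refl))))

    chosen : ∀ y (e : Proper (before y)) → proj₁ (choose (before y) e) ≡ y
    chosen y e with ⌊⌋⁻ {P = Succ (before y)} (∈succ-before y)
    ... | inj₁ y∈ = contradiction y∈ (omits y)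
    ... | inj₂ (e′ , eq) = trans (cong proj₁ (canonical-const (λ (_ : ⊤) → Proper (before y)) tt e e′)) eq

    before-injective : ∀ {x y} → before x ≡ before y → x ≡ y
    before-injective {x} {y} e = trans (sym (chosen x (x , omits x)))
      (trans (choose-cong e (x , omits x) (y , omits y)) (chosen y (y , omits y)))
      where
      choose-cong : ∀ {s t} → s ≡ t → ∀ (e : Proper s) (e′ : Proper t) → proj₁ (choose s e) ≡ proj₁ (choose t e′)
      choose-cong {s} refl e e′ = cong proj₁ (canonical-const (λ (_ : ⊤) → Proper s) tt e e′)

    _<_ : Rel X 0ℓ
    x < y = x ∈ᵇ before y

    <-irrefl : ∀ {x} → ¬ x < x
    <-irrefl = omits _

    <-trans : ∀ {x y z} → x < y → y < z → x < z
    <-trans {x} {y} {z} x<y y<z with compareTower (before-tower y) (before-tower z)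
    ... | inj₁ le = contradiction (le y y<z) (omits y)
    ... | inj₂ le = le x (s⊆succ (before y) x x<y)

    ⊆before⇒≤ : ∀ {x y} → ¬ x < y → before y ⊆ᵇ before x
    ⊆before⇒≤ {x} {y} x≮y = largest (before-tower y) x≮y

    compare : Trichotomous _≡_ _<_
    compare x y with em {P = x < y} | em {P = y < x}
    ... | yes x<y | yes y<x = contradiction (<-trans x<y y<x) <-irrefl
    ... | yes x<y | no y≮x  = tri< x<y (λ { refl → <-irrefl x<y }) y≮x
    ... | no x≮y  | yes y<x = tri> x≮y (λ { refl → <-irrefl y<x }) y<x
    ... | no x≮y  | no y≮x  = tri≈ x≮y (before-injective (⊆ᵇ-antisym (⊆before⇒≤ y≮x) (⊆before⇒≤ x≮y))) y≮x

    -- Induction on the tower. For `x` in `succ s` the predecessors of `x` lie in `s`: by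
    -- comparability `before x` would otherwise contain `succ s`, and with it `x`.
    accessible : ∀ {s} → Tower s → ∀ x → x ∈ᵇ s → Acc _<_ x
    accessible (succᵗ {s} S) x x∈ = acc λ {y} y<x → accessible S y (before⊆ y y<x)
      where
      before⊆ : before x ⊆ᵇ s
      before⊆ with compareTower S (before-tower x)
      ... | inj₁ le = le
      ... | inj₂ le = contradiction (le x x∈) (omits x)
    accessible (⋃ᵗ {F} S) x x∈ = let (s , sF , xs) = ⌊⌋⁻ {P = Union F} x∈ in accessible (S s sF) x xs

    wellOrder : WellOrder
    wellOrder = record
      { Carrier = X
      ; _<_ = _<_
      ; isStrictTotalOrder = record
        { isStrictPartialOrder = record
          { isEquivalence = isEquivalence
          ; irrefl = λ { refl → <-irrefl }
          ; trans = λ {x} {y} {z} → <-trans {x} {y} {z}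
          ; <-resp-≈ = resp₂ _<_ }
        ; compare = compare }
      ; wellFounded = λ x → accessible (succᵗ (before-tower x)) x (∈succ-before x) }

  module Infinite {Λ : Set} (infinite : ¬ Finite (setoid Λ)) where

    ¬finite : ¬ FiniteSet (U {A = Λ})
    ¬finite fin = let (m , f , g) = FiniteSet⇒≅Fin fin in infinite (m , ≲-antisym-setoid f g)

    Λ²≲Λ : Idempotent (U {A = Λ})
    Λ²≲Λ with Hessenberg.all (Zermelo.wellOrder Λ)
    ... | inj₁ fin  = contradiction fin ¬finite
    ... | inj₂ idem = idem

    ℕ≲Λ : U {A = ℕ} ≲ U {A = Λ}
    ℕ≲Λ = greedy ℕᵢ.<-wellFounded connected
            λ n _ f → ¬finite (n , ≲-trans f (mk≲ (λ m m<n → Fin.fromℕ< m<n) (λ _ → tt)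
              λ {m} {m′} p p′ e → trans (sym (Finₚ.toℕ-fromℕ< p)) (trans (cong Fin.toℕ e) (Finₚ.toℕ-fromℕ< p′))))
      where
      connected : ∀ {m n} → m ≢ n → m ℕ.< n ⊎ n ℕ.< m
      connected {m} {n} m≢n with ℕₚ.<-cmp m n
      ... | tri< p _ _ = inj₁ p
      ... | tri≈ _ p _ = contradiction p m≢n
      ... | tri> _ _ p = inj₂ p

  -- The least large ordinal and bounded functions into it.

  module Regularity (W₁ : WellOrder) (α₁ : WellOrder.Carrier W₁) (W₂ : WellOrder) (α₂ : WellOrder.Carrier W₂) where
    module W₁ = WellOrder W₁
    open WellOrder W₂
    open WellOrderProperties W₂

    D : Pred W₁.Carrier 0ℓ
    D = W₁._< α₁

    -- Admitting all finite sets makes this closed under adjoining a point even when `D` is finite.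
    -- The least ordinal that fails it is then a limit, namely ω for finite `D`.
    AtMost : Pred A p → Set _
    AtMost P = FiniteSet P ⊎ P ≲ D

    atMost-≲ : P ≲ Q → AtMost Q → AtMost P
    atMost-≲ f (inj₁ fin) = inj₁ (≲-finite f fin)
    atMost-≲ f (inj₂ g)   = inj₂ (≲-trans f g)

    finOrIdempotent : FinOrIdempotent D
    finOrIdempotent = Hessenberg.segment W₁ α₁

    atMost-∪₁ : {P : Pred A p} {y : A} → AtMost P → AtMost (P ∪₁ y)
    atMost-∪₁ (inj₁ fin) = inj₁ (∪₁-finite fin)
    atMost-∪₁ {A = A} {P = P} {y} (inj₂ f) = by-cases finOrIdempotent
      where
      module F = _≲_ f
      to : ∀ x → x ∈ P ∪₁ y → W₁.Carrier
      to x (inj₁ px) = F.to x px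
      -- The bound `α₁` lies just outside `D`, so it is free to receive the new point; idempotence
      -- then brings `D` with `α₁` back into `D`.
      to x (inj₂ _)  = α₁
      to∈ : ∀ {x} (px : x ∈ P ∪₁ y) → to x px ∈ D ∪₁ α₁
      to∈ (inj₁ px) = inj₁ (F.to∈ px)
      to∈ (inj₂ _)  = inj₂ refl
      ≢α₁ : ∀ {x} (px : x ∈ P) → F.to x px ≢ α₁
      ≢α₁ px e = WellOrderProperties.<-irreflexive W₁ (subst (_∈ D) e (F.to∈ px))
      inj : ∀ {x x′} (px : x ∈ P ∪₁ y) (px′ : x′ ∈ P ∪₁ y) → to x px ≡ to x′ px′ → x ≡ x′
      inj (inj₁ px) (inj₁ px′) e = F.inj px px′ e
      inj (inj₁ px) (inj₂ _) e = contradiction e (≢α₁ px)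
      inj (inj₂ _) (inj₁ px) e = contradiction (sym e) (≢α₁ px)
      inj (inj₂ refl) (inj₂ refl) _ = refl
      by-cases : FinOrIdempotent D → AtMost (P ∪₁ y)
      by-cases (inj₁ fin) = inj₁ (∪₁-finite (≲-finite f fin))
      by-cases (inj₂ idem) with idempotent⇒∪₁ {y = α₁} idem
      ... | inj₁ fin = inj₁ (∪₁-finite (≲-finite f fin))
      ... | inj₂ g = inj₂ (≲-trans (mk≲ to to∈ inj) g)

    module _ (large : ¬ AtMost (_< α₂)) where

      private
        first : ∃[ δ ] ((δ ≤ α₂ × ¬ AtMost (_< δ)) × (∀ β → β < δ → ¬ (β ≤ α₂ × ¬ AtMost (_< β))))
        first = least wellFounded {P = λ δ → δ ≤ α₂ × ¬ AtMost (_< δ)} (inj₂ refl , large)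

      δ : Carrier
      δ = proj₁ first

      δ≤α₂ : δ ≤ α₂
      δ≤α₂ = proj₁ (proj₁ (proj₂ first))

      δ-large : ¬ AtMost (_< δ)
      δ-large = proj₂ (proj₁ (proj₂ first))

      below-δ : ∀ {β} → β < δ → AtMost (_< β)
      below-δ {β} β<δ = by-contradiction λ ¬s → proj₂ (proj₂ first) β β<δ (inj₁ (<-≤-trans β<δ δ≤α₂) , ¬s)

      δ-nonempty : ∃[ α ] α < δ
      δ-nonempty = by-contradiction λ ¬∃ → δ-large (inj₁ (0 ,
        mk≲ (λ x p → contradiction (x , p) ¬∃) (λ _ → tt) λ {x} p _ _ → contradiction (x , p) ¬∃))

      -- If nothing lay between `α` and `δ`, the segment below `δ` would be the one below `α` with
      -- `α` adjoined, which is still not large.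
      δ-dense : ∀ α → α < δ → ∃[ β ] (α < β × β < δ)
      δ-dense α α<δ = by-contradiction λ ¬∃ →
        δ-large (atMost-≲ (⊆⇒≲ λ {β} β<δ → ≮⇒≥ λ α<β → ¬∃ (β , α<β , β<δ)) (atMost-∪₁ {y = α} (below-δ α<δ)))

      Bounded : (W₁.Carrier → Carrier) → Set
      Bounded f = ∃[ m ] (m < δ × (∀ i → i ∈ D → f i ≤ m))

      Fin-bounded : ∀ n (g : Fin n → Carrier) → (∀ i → g i < δ) → ∃[ m ] (m < δ × (∀ i → g i ≤ m))
      Fin-bounded zero g g< = let (m , m<δ) = δ-nonempty in m , m<δ , λ ()
      Fin-bounded (suc n) g g< with Fin-bounded n (g ∘ Fin.suc) (g< ∘ Fin.suc)
      ... | m , m<δ , ub with ≤-total (g Fin.zero) m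
      ...   | inj₁ g≤m = m , m<δ , λ { Fin.zero → g≤m ; (Fin.suc i) → ub i }
      ...   | inj₂ m≤g = g Fin.zero , g< Fin.zero , λ { Fin.zero → inj₂ refl ; (Fin.suc i) → ≤-trans (ub i) m≤g }

      -- Otherwise the segment below δ is a union of at most ∣ D ∣ segments, none of
      -- which exceeds D.
      bounded : ∀ f → (∀ i → i ∈ D → f i < δ) → Bounded f
      bounded f f< = by-cases em
        where
        by-cases : Dec (FiniteSet D) → Bounded f
        by-cases (yes fin) = m , m<δ , ub′
          where
          size = FiniteSet⇒≅Fin fin
          open _≅_ (≲-antisym (proj₁ (proj₂ size)) (proj₂ (proj₂ size)))
          point : Fin (proj₁ size) → W₁.Carrier
          point k = proj₁ (surj {k} tt)
          max = Fin-bounded (proj₁ size) (f ∘ point) (λ k → f< (point k) (proj₁ (proj₂ (surj {k} tt))))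
          m = proj₁ max
          m<δ = proj₁ (proj₂ max)
          ub′ : ∀ i → i ∈ D → f i ≤ m
          ub′ i i∈ = subst (λ z → f z ≤ m) (inj (proj₁ (proj₂ (surj {to i i∈} tt))) i∈ (proj₂ (proj₂ (surj {to i i∈} tt))))
                       (proj₂ (proj₂ max) (to i i∈))
        by-cases (no ¬fin) = by-contradiction λ ¬b → δ-large (inj₂ (⋃-≲ idem (⊆⇒≲ {P = D} id) X≲ (cover ¬b)))
          where
          idem : Idempotent D
          idem with finOrIdempotent
          ... | inj₁ fin = contradiction fin ¬fin
          ... | inj₂ i = i
          X≲ : ∀ {i} → i ∈ D → (_< f i) ≲ D
          X≲ {i} i∈ with below-δ (f< i i∈)
          ... | inj₁ (n , g) = ≲-trans g (infinite⇒Fin≲ ¬fin n)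
          ... | inj₂ g = g
          cover : ¬ Bounded f → ∀ {x} → x < δ → ∃[ i ] (i ∈ D × x < f i)
          cover ¬b {x} x<δ = by-contradiction λ ¬∃ → ¬b (x , x<δ , λ i i∈ → ≮⇒≥ λ x<fi → ¬∃ (i , i∈ , x<fi))

-- Structures, isomorphisms and unions of chains.

⇔-trans : A ⇔ B → B ⇔ C → A ⇔ C
⇔-trans f g = mk⇔ (Equivalence.to g ∘ Equivalence.to f) (Equivalence.from f ∘ Equivalence.from g)

⇔-sym : A ⇔ B → B ⇔ A
⇔-sym f = mk⇔ (Equivalence.from f) (Equivalence.to f)

≡⇒⇔ : {A B : Set a} → A ≡ B → A ⇔ B
≡⇒⇔ refl = mk⇔ id id

map-agree : ∀ {n} {P : Pred A p} {f g : A → B} → (∀ {x} → x ∈ P → f x ≡ g x) →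
            {xs : Vec A n} → VAll.All P xs → Vec.map f xs ≡ Vec.map g xs
map-agree f≗g []         = refl
map-agree f≗g (px ∷ pxs) = cong₂ _∷_ (f≗g px) (map-agree f≗g pxs)

map-cancel : ∀ {n} {P : Pred A p} {f : A → B} {g : B → A} → (∀ {x} → x ∈ P → g (f x) ≡ x) →
             {xs : Vec A n} → VAll.All P xs → Vec.map g (Vec.map f xs) ≡ xs
map-cancel gf []         = refl
map-cancel gf (px ∷ pxs) = cong₂ _∷_ (gf px) (map-cancel gf pxs)

map-∘ : ∀ {n} (f : A → B) (g : B → C) (xs : Vec A n) → Vec.map g (Vec.map f xs) ≡ Vec.map (g ∘ f) xs
map-∘ f g []       = refl
map-∘ f g (x ∷ xs) = cong (g (f x) ∷_) (map-∘ f g xs)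

map-id′ : ∀ {n} (xs : Vec A n) → Vec.map (λ x → x) xs ≡ xs
map-id′ []       = refl
map-id′ (x ∷ xs) = cong (x ∷_) (map-id′ xs)

All-map : ∀ {n} {P : Pred A p} {Q : Pred B q} {f : A → B} → (∀ {x} → x ∈ P → f x ∈ Q) →
          {xs : Vec A n} → VAll.All P xs → VAll.All Q (Vec.map f xs)
All-map f∈ []         = []
All-map f∈ (px ∷ pxs) = f∈ px ∷ All-map f∈ pxs

module StructureTheory (cl : Classical) (τ : Vocabulary) (𝕌 : Points) where
  open Cardinals cl public
  open Vocabulary τ public
  open Points 𝕌 public
  open Models τ 𝕌 public

  Map : Set₁
  Map = Point → Point

  infix 4 _≗[_]_
  _≗[_]_ : Map → Structure → Map → Set₁
  f ≗[ M ] g = ∀ {x} → x ∈ ∣ M ∣ → f x ≡ g x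

  module ⊑ {M N} (p : M ⊑ N) = _⊑_ p
  module Iso {f M N} (p : IsIso f M N) = IsIso p

  ⊑-refl : ∀ {M} → M ⊑ M
  ⊑-refl = record { incl = id ; rel⇔ = λ _ _ → mk⇔ id id ; fun≡ = λ _ _ → refl }

  ≐ₘ-refl : ∀ {M} → M ≐ₘ M
  ≐ₘ-refl = ⊑-refl , ⊑-refl

  ≐ₘ-sym : ∀ {M N} → M ≐ₘ N → N ≐ₘ M
  ≐ₘ-sym (p , q) = q , p

  ⊆⇒⊑ : ∀ {M N P} → M ⊑ P → N ⊑ P → ∣ M ∣ ⊆ ∣ N ∣ → M ⊑ N
  ⊆⇒⊑ p q M⊆N = record
    { incl = M⊆N
    ; rel⇔ = λ R xs → ⇔-trans (⊑.rel⇔ p R xs) (⇔-sym (⊑.rel⇔ q R (VAll.map M⊆N xs)))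
    ; fun≡ = λ F xs → trans (⊑.fun≡ p F xs) (sym (⊑.fun≡ q F (VAll.map M⊆N xs))) }

  ≐ₘ⇒iso : ∀ {M N} → M ≐ₘ N → IsIso (λ x → x) M N
  ≐ₘ⇒iso {M} {N} (p , q) = record
    { maps = ⊑.incl p
    ; inj  = λ _ _ e → e
    ; surj = λ y∈ → _ , ⊑.incl q y∈ , refl
    ; rel⇔ = λ R {xs} xs∈ → ⇔-trans (⊑.rel⇔ p R xs∈) (≡⇒⇔ (cong (rel N R) (sym (map-id′ xs))))
    ; fun≡ = λ F {xs} xs∈ → trans (⊑.fun≡ p F xs∈) (cong (fun N F) (sym (map-id′ xs))) }

  iso-refl : ∀ {M} → IsIso (λ x → x) M M
  iso-refl = ≐ₘ⇒iso ≐ₘ-refl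

  iso-cong : ∀ {f g M N} → f ≗[ M ] g → IsIso f M N → IsIso g M N
  iso-cong {f} {g} {M} {N} f≗g i = record
    { maps = λ x∈ → subst (_∈ ∣ N ∣) (f≗g x∈) (maps x∈)
    ; inj  = λ x∈ y∈ e → inj x∈ y∈ (trans (f≗g x∈) (trans e (sym (f≗g y∈))))
    ; surj = λ y∈ → let (x , x∈ , e) = surj y∈ in x , x∈ , trans (sym (f≗g x∈)) e
    ; rel⇔ = λ R xs∈ → ⇔-trans (rel⇔ R xs∈) (≡⇒⇔ (cong (rel N R) (map-agree f≗g xs∈)))
    ; fun≡ = λ F xs∈ → trans (sym (f≗g (closed M F xs∈))) (trans (fun≡ F xs∈) (cong (fun N F) (map-agree f≗g xs∈))) }
    where open IsIso i

  iso-trans : ∀ {f g M N P} → IsIso f M N → IsIso g N P → IsIso (g ∘ f) M P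
  iso-trans {f} {g} {M} {N} {P} i j = record
    { maps = λ x∈ → J.maps (I.maps x∈)
    ; inj  = λ x∈ y∈ e → I.inj x∈ y∈ (J.inj (I.maps x∈) (I.maps y∈) e)
    ; surj = λ z∈ → let (y , y∈ , e) = J.surj z∈ ; (x , x∈ , e′) = I.surj y∈ in x , x∈ , trans (cong g e′) e
    ; rel⇔ = λ R {xs} xs∈ → ⇔-trans (I.rel⇔ R xs∈)
               (⇔-trans (J.rel⇔ R (All-map I.maps xs∈)) (≡⇒⇔ (cong (rel P R) (map-∘ f g xs))))
    ; fun≡ = λ F {xs} xs∈ → trans (cong g (I.fun≡ F xs∈))
               (trans (J.fun≡ F (All-map I.maps xs∈)) (cong (fun P F) (map-∘ f g xs))) }
    where
    module I = IsIso i
    module J = IsIso j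

  preimage : Map → Structure → Map
  preimage f M y with em {P = ∃[ x ] (x ∈ ∣ M ∣ × f x ≡ y)}
  ... | yes (x , _) = x
  ... | no _        = y

  preimage-∈ : ∀ {f M y} → ∃[ x ] (x ∈ ∣ M ∣ × f x ≡ y) → preimage f M y ∈ ∣ M ∣ × f (preimage f M y) ≡ y
  preimage-∈ {f} {M} {y} ex with em {P = ∃[ x ] (x ∈ ∣ M ∣ × f x ≡ y)}
  ... | yes (_ , x∈ , e) = x∈ , e
  ... | no ¬ex           = contradiction ex ¬ex

  InjectiveOn : Map → Pred Point 1ℓ → Set₁
  InjectiveOn f P = ∀ {x y} → x ∈ P → y ∈ P → f x ≡ f y → x ≡ y

  preimage-cancel : ∀ {f M x} → InjectiveOn f ∣ M ∣ → x ∈ ∣ M ∣ → preimage f M (f x) ≡ x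
  preimage-cancel {f} {M} inj x∈ = let (y∈ , e) = preimage-∈ {f} {M} (_ , x∈ , refl) in inj y∈ x∈ e

  iso-sym : ∀ {f M N} → IsIso f M N → IsIso (preimage f M) N M
  iso-sym {f} {M} {N} i = record
    { maps = g-maps
    ; inj  = λ x∈ y∈ e → trans (sym (fg x∈)) (trans (cong f e) (fg y∈))
    ; surj = λ {x} x∈ → f x , maps x∈ , preimage-cancel {M = M} inj x∈
    ; rel⇔ = λ R ys∈ → ⇔-sym (⇔-trans (rel⇔ R (All-map g-maps ys∈)) (≡⇒⇔ (cong (rel N R) (map-cancel fg ys∈))))
    ; fun≡ = λ F ys∈ → trans
        (cong (preimage f M) (sym (trans (fun≡ F (All-map g-maps ys∈)) (cong (fun N F) (map-cancel fg ys∈)))))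
        (preimage-cancel {M = M} inj (closed M F (All-map g-maps ys∈))) }
    where
    open IsIso i
    g-maps : ∀ {y} → y ∈ ∣ N ∣ → preimage f M y ∈ ∣ M ∣
    g-maps y∈ = proj₁ (preimage-∈ {f} {M} (surj y∈))
    fg : ∀ {y} → y ∈ ∣ N ∣ → f (preimage f M y) ≡ y
    fg y∈ = proj₂ (preimage-∈ {f} {M} (surj y∈))

  iso-⊑ : ∀ {f M N M′ N′} → IsIso f M M′ → IsIso f N N′ → M ⊑ N → M′ ⊑ N′
  iso-⊑ {f} {M} {N} {M′} {N′} i j M⊑N = record
    { incl = incl
    ; rel⇔ = λ R {ys} ys∈ → ⇔-trans
        (⇔-trans (≡⇒⇔ (cong (rel M′ R) (sym (map-cancel I⁻.cancel ys∈)))) (⇔-sym (I.rel⇔ R (All-map I⁻.maps ys∈))))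
        (⇔-trans (⊑.rel⇔ M⊑N R (All-map I⁻.maps ys∈))
          (⇔-trans (J.rel⇔ R (VAll.map (⊑.incl M⊑N) (All-map I⁻.maps ys∈)))
            (≡⇒⇔ (cong (rel N′ R) (map-cancel I⁻.cancel ys∈)))))
    ; fun≡ = λ F {ys} ys∈ → trans
        (trans (cong (fun M′ F) (sym (map-cancel I⁻.cancel ys∈))) (sym (I.fun≡ F (All-map I⁻.maps ys∈))))
        (trans (cong f (⊑.fun≡ M⊑N F (All-map I⁻.maps ys∈)))
          (trans (J.fun≡ F (VAll.map (⊑.incl M⊑N) (All-map I⁻.maps ys∈))) (cong (fun N′ F) (map-cancel I⁻.cancel ys∈)))) }
    where
    module I = IsIso i
    module J = IsIso j
    module I⁻ where
      maps : ∀ {y} → y ∈ ∣ M′ ∣ → preimage f M y ∈ ∣ M ∣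
      maps y∈ = proj₁ (preimage-∈ {f} {M} (I.surj y∈))
      cancel : ∀ {y} → y ∈ ∣ M′ ∣ → f (preimage f M y) ≡ y
      cancel y∈ = proj₂ (preimage-∈ {f} {M} (I.surj y∈))
    incl : ∣ M′ ∣ ⊆ ∣ N′ ∣
    incl y∈ = subst (_∈ ∣ N′ ∣) (I⁻.cancel y∈) (J.maps (⊑.incl M⊑N (I⁻.maps y∈)))

  -- Transport goes along the total map `preimage`, so the image can be formed before `f` is known
  -- to be injective on `M`.
  image : Map → Structure → Structure
  image f M = record
    { ∣_∣    = λ y → ∃[ x ] (x ∈ ∣ M ∣ × f x ≡ y)
    ; rel    = λ R ys → rel M R (Vec.map (preimage f M) ys)
    ; fun    = λ F ys → f (fun M F (Vec.map (preimage f M) ys))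
    ; closed = λ F ys∈ → _ , closed M F (All-map (λ y∈ → proj₁ (preimage-∈ {f} {M} y∈)) ys∈) , refl }

  image-iso : ∀ {f M} → InjectiveOn f ∣ M ∣ → IsIso f M (image f M)
  image-iso {f} {M} inj = record
    { maps = λ x∈ → _ , x∈ , refl
    ; inj  = inj
    ; surj = id
    ; rel⇔ = λ R xs∈ → ≡⇒⇔ (cong (rel M R) (sym (map-cancel (preimage-cancel {M = M} inj) xs∈)))
    ; fun≡ = λ F xs∈ → cong f (cong (fun M F) (sym (map-cancel (preimage-cancel {M = M} inj) xs∈))) }

  iso-restrict : ∀ {f M N N′} → IsIso f N N′ → ∣ M ∣ ⊆ ∣ N ∣ → IsIso f M (image f M)
  iso-restrict i M⊆N = image-iso λ x∈ y∈ → IsIso.inj i (M⊆N x∈) (M⊆N y∈)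

  iso-unique : ∀ {f M N N′} → IsIso f M N → IsIso f M N′ → N ≐ₘ N′
  iso-unique i j = iso-⊑ i j ⊑-refl , iso-⊑ j i ⊑-refl

  module _ {Λ : Set} where

    enumeration : ∀ {M} → HasCard M Λ → ∃[ e ] (∀ {x} → x ∈ ∣ M ∣ → ∃[ y ] e y ≡ x)
    enumeration {M} bij = (λ y → proj₁ (proj₁ (surjective y))) ,
      λ {x} x∈ → to (x , x∈) , injective {proj₁ (surjective (to (x , x∈)))} {x , x∈} (proj₂ (surjective (to (x , x∈))) refl)
      where open Bijection bij

    -- Points of N off R are moved to fresh ones.
    extend-injection : ∀ {R N R′ g} → HasCard N Λ → HasCard R′ Λ → IsIso g R R′ →
                       ∃[ h ] (InjectiveOn h ∣ N ∣ × h ≗[ R ] g)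
    extend-injection {R} {N} {R′} {g} cN cR′ i = (λ x → h x em em) , (λ x∈ y∈ → h-inj x∈ y∈ em em em em) , λ x∈ → h-R x∈ em em
      where
      module N = Bijection cN
      pt = proj₁ (enumeration {R′} cR′)
      pt-onto = proj₂ (enumeration {R′} cR′)
      fr = proj₁ (fresh Λ Λ pt)
      fr-inj = proj₁ (proj₂ (fresh Λ Λ pt))
      fr-new = proj₂ (proj₂ (fresh Λ Λ pt))
      h : ∀ x → Dec (x ∈ ∣ R ∣) → Dec (x ∈ ∣ N ∣) → Point
      h x (yes _) _        = g x
      h x (no _) (yes x∈N) = fr (N.to (x , x∈N))
      h x (no _) (no _)    = x
      h-R : ∀ {x} → x ∈ ∣ R ∣ → ∀ d e → h x d e ≡ g x
      h-R x∈ (yes _) _ = refl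
      h-R x∈ (no x∉) _ = contradiction x∈ x∉
      new : ∀ {x z} → x ∈ ∣ R ∣ → g x ≢ fr z
      new x∈ e = let (y , e′) = pt-onto (IsIso.maps i x∈) in fr-new _ y (sym (trans e′ e))
      h-inj : ∀ {x y} → x ∈ ∣ N ∣ → y ∈ ∣ N ∣ → ∀ d e d′ e′ → h x d e ≡ h y d′ e′ → x ≡ y
      h-inj x∈ y∈ (yes x∈R) e (yes y∈R) e′ eq = IsIso.inj i x∈R y∈R eq
      h-inj x∈ y∈ (yes x∈R) e (no _) (yes _) eq = contradiction eq (new x∈R)
      h-inj x∈ y∈ (no _) (yes _) (yes y∈R) e′ eq = contradiction (sym eq) (new y∈R)
      h-inj x∈ y∈ (no _) (yes x∈N) (no _) (yes y∈N) eq = N.injective {_ , x∈N} {_ , y∈N} (fr-inj eq)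
      h-inj x∈ y∈ (no _) (no x∉) _ _ eq = contradiction x∈ x∉
      h-inj x∈ y∈ (yes _) _ (no _) (no y∉) eq = contradiction y∈ y∉
      h-inj x∈ y∈ (no _) (yes _) (no _) (no y∉) eq = contradiction y∈ y∉

  iso-≲ : ∀ {f M N} → IsIso f M N → ∣ M ∣ ≲ ∣ N ∣
  iso-≲ {f} i = mk≲ (λ x _ → f x) maps inj
    where open IsIso i

  Linear : {A : Set} → Pred A 0ℓ → (A → Structure) → Set₁
  Linear I M = ∀ i j → i ∈ I → j ∈ I → M i ⊑ M j ⊎ M j ⊑ M i

  module _ {A : Set} {I : Pred A 0ℓ} {M : A → Structure} (linear : Linear I M) where

    -- Finite arity is used here: finitely many entries fit into one member of the chain. The index
    -- `i₀` serves the empty tuple.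
    collect : ∀ {P : Pred Point 1ℓ} {i₀} → i₀ ∈ I → (∀ {x} → x ∈ P → ∃[ i ] (i ∈ I × x ∈ ∣ M i ∣)) →
              ∀ {n} {xs : Vec Point n} → VAll.All P xs → ∃[ i ] (i ∈ I × VAll.All ∣ M i ∣ xs)
    collect i₀∈ cover [] = _ , i₀∈ , []
    collect i₀∈ cover (px ∷ pxs) with cover px | collect i₀∈ cover pxs
    ... | i , i∈ , x∈ | j , j∈ , xs∈ with linear i j i∈ j∈
    ...   | inj₁ le = j , j∈ , ⊑.incl le x∈ ∷ xs∈
    ...   | inj₂ le = i , i∈ , x∈ ∷ VAll.map (⊑.incl le) xs∈

    rel-coherent : ∀ {i j} → i ∈ I → j ∈ I → ∀ R {xs} → VAll.All ∣ M i ∣ xs → VAll.All ∣ M j ∣ xs →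
                   rel (M i) R xs ⇔ rel (M j) R xs
    rel-coherent i∈ j∈ R p q with linear _ _ i∈ j∈
    ... | inj₁ le = ⊑.rel⇔ le R p
    ... | inj₂ le = ⇔-sym (⊑.rel⇔ le R q)

    fun-coherent : ∀ {i j} → i ∈ I → j ∈ I → ∀ F {xs} → VAll.All ∣ M i ∣ xs → VAll.All ∣ M j ∣ xs →
                   fun (M i) F xs ≡ fun (M j) F xs
    fun-coherent i∈ j∈ F p q with linear _ _ i∈ j∈
    ... | inj₁ le = ⊑.fun≡ le F p
    ... | inj₂ le = sym (⊑.fun≡ le F q)

    union-⊑ : ∀ {U N i₀} → i₀ ∈ I → IsUnion I M U → (∀ i → i ∈ I → M i ⊑ N) → U ⊑ N
    union-⊑ {U} {N} i₀∈ (M⊑U , cover) M⊑N = record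
      { incl = λ x∈ → let (i , i∈ , x∈i) = cover x∈ in ⊑.incl (M⊑N i i∈) x∈i
      ; rel⇔ = λ R xs∈ → let (i , i∈ , xs∈i) = collect i₀∈ cover xs∈ in
                 ⇔-trans (⇔-sym (⊑.rel⇔ (M⊑U i i∈) R xs∈i)) (⊑.rel⇔ (M⊑N i i∈) R xs∈i)
      ; fun≡ = λ F xs∈ → let (i , i∈ , xs∈i) = collect i₀∈ cover xs∈ in
                 trans (sym (⊑.fun≡ (M⊑U i i∈) F xs∈i)) (⊑.fun≡ (M⊑N i i∈) F xs∈i) }

    module _ {i₀} (i₀∈ : i₀ ∈ I) where

      private
        Covered : ∀ {n} → Vec Point n → Set₁
        Covered xs = ∃[ i ] (i ∈ I × VAll.All ∣ M i ∣ xs)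

        universe : Pred Point 1ℓ
        universe x = ∃[ i ] (i ∈ I × x ∈ ∣ M i ∣)

        ⋃fun : (F : FunSym) (xs : Vec Point (funArity F)) → Dec (Covered xs) → Point
        ⋃fun F xs (yes (i , _)) = fun (M i) F xs
        ⋃fun F xs (no _)        = fun (M i₀) F xs

        ⋃closed : ∀ F {xs} → VAll.All universe xs → (d : Dec (Covered xs)) → ⋃fun F xs d ∈ universe
        ⋃closed F xs∈ (yes (i , i∈ , xs∈i)) = i , i∈ , closed (M i) F xs∈i
        ⋃closed F xs∈ (no ¬c) = contradiction (collect i₀∈ id xs∈) ¬c

        ⋃fun≡ : ∀ {i} → i ∈ I → ∀ F {xs} → VAll.All ∣ M i ∣ xs → (d : Dec (Covered xs)) → fun (M i) F xs ≡ ⋃fun F xs d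
        ⋃fun≡ i∈ F xs∈ (yes (j , j∈ , xs∈j)) = fun-coherent i∈ j∈ F xs∈ xs∈j
        ⋃fun≡ i∈ F xs∈ (no ¬c) = contradiction (_ , i∈ , xs∈) ¬c

      ⋃ : Structure
      ⋃ = record
        { ∣_∣    = universe
        -- The relation of a member is arbitrary on tuples outside its universe, so the tuple is
        -- required to lie inside.
        ; rel    = λ R xs → ∃[ i ] (i ∈ I × VAll.All ∣ M i ∣ xs × rel (M i) R xs)
        ; fun    = λ F xs → ⋃fun F xs em
        ; closed = λ F xs∈ → ⋃closed F xs∈ em }

      ⋃-isUnion : IsUnion I M ⋃
      ⋃-isUnion = (λ i i∈ → record
        { incl = λ x∈ → i , i∈ , x∈
        ; rel⇔ = λ R xs∈ → mk⇔ (λ r → i , i∈ , xs∈ , r)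
                   (λ (j , j∈ , xs∈j , r) → Equivalence.to (rel-coherent j∈ i∈ R xs∈j xs∈) r)
        ; fun≡ = λ F xs∈ → ⋃fun≡ i∈ F xs∈ em }) , id

-- Embeddings, amalgamation and types in cardinality λ.

module FrameTheory (cl : Classical) (τ : Vocabulary) (𝕌 : Points) (Λ : Set) (infinite : ¬ Finite (setoid Λ))
                   (𝔰 : Models.GoodFrameMinusStability τ 𝕌 Λ) where
  open StructureTheory cl τ 𝕌 public
  open Infinite infinite public
  open GoodFrameMinusStability 𝔰 public

  Small : Pred A p → Set _
  Small P = P ≲ U {A = Λ}

  module _ where
    private
      two : U {A = Fin 2} ≲ U {A = Λ}
      two = infinite⇒Fin≲ ¬finite 2

      bit : Bool → Fin 2
      bit false = Fin.zero
      bit true  = Fin.suc Fin.zero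

      bit-injective : ∀ i j → bit i ≡ bit j → i ≡ j
      bit-injective false false _ = refl
      bit-injective true true _ = refl

    abstract
      tag : Bool → Λ → Λ
      tag i l = _≲_.to Λ²≲Λ (l , _≲_.to two (bit i) tt) (tt , tt)

      tag-injective : ∀ {l m} i j → tag i l ≡ tag j m → i ≡ j × l ≡ m
      tag-injective i j e = let e′ = _≲_.inj Λ²≲Λ (tt , tt) (tt , tt) e in
        bit-injective i j (_≲_.inj two tt tt (cong proj₂ e′)) , cong proj₁ e′

  abstract
    ∪-small : {P Q : Pred A p} → Small P → Small Q → Small (λ x → P x ⊎ Q x)
    ∪-small {A = A} {P = P} {Q} f g = mk≲ to (λ _ → tt) inj
      where
      module F = _≲_ f
      module G = _≲_ g
      to : ∀ x → P x ⊎ Q x → Λ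
      to x (inj₁ px) = tag false (F.to x px)
      to x (inj₂ qx) = tag true (G.to x qx)
      inj : ∀ {x y} (u : P x ⊎ Q x) (v : P y ⊎ Q y) → to x u ≡ to y v → x ≡ y
      inj (inj₁ px) (inj₁ py) e = F.inj px py (proj₂ (tag-injective false false e))
      inj (inj₂ qx) (inj₂ qy) e = G.inj qx qy (proj₂ (tag-injective true true e))
      inj (inj₁ _) (inj₂ _) e with () ← proj₁ (tag-injective false true e)
      inj (inj₂ _) (inj₁ _) e with () ← proj₁ (tag-injective true false e)

    ⋃-small : {I : Pred A p} {X : A → Pred B q} {Y : Pred B r} → Small I → (∀ {i} → i ∈ I → Small (X i)) →
              (∀ {x} → x ∈ Y → ∃[ i ] (i ∈ I × x ∈ X i)) → Small Y
    ⋃-small = ⋃-≲ Λ²≲Λ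

    ⪯-trans : ∀ {M N P} → M ⪯ N → N ⪯ P → M ⪯ P
    ⪯-trans r s = IsPartialOrder.trans ⪯-isPartialOrder
      {_ , proj₁ (⪯⇒K r)} {_ , proj₁ (⪯⇒K s)} {_ , proj₂ (⪯⇒K s)} r s

  K-≐ : ∀ {M N} → M ≐ₘ N → M ∈ K → N ∈ K
  K-≐ e = K-iso (≐ₘ⇒iso e)

  ≐ₘ⇒⪯ : ∀ {M N} → M ∈ K → M ≐ₘ N → M ⪯ N
  ≐ₘ⇒⪯ M∈ e = IsPartialOrder.reflexive ⪯-isPartialOrder {_ , M∈} {_ , K-≐ e M∈} e

  ⪯-refl : ∀ {M} → M ∈ K → M ⪯ M
  ⪯-refl M∈ = ≐ₘ⇒⪯ M∈ ≐ₘ-refl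

  ⪯-⊆ : ∀ {M N} → M ⪯ N → ∣ M ∣ ⊆ ∣ N ∣
  ⪯-⊆ M⪯N = ⊑.incl (⪯⇒⊑ M⪯N)

  abstract
    ⪯-coherent : ∀ {M N P} → M ⪯ P → N ⪯ P → ∣ M ∣ ⊆ ∣ N ∣ → M ⪯ N
    ⪯-coherent M⪯P N⪯P M⊆N = coherence (⊆⇒⊑ (⪯⇒⊑ M⪯P) (⪯⇒⊑ N⪯P) M⊆N) (⪯⇒⊑ N⪯P) M⪯P N⪯P

  Kλ-≲ : ∀ {M} → M ∈ Kλ → Small ∣ M ∣
  Kλ-≲ (_ , c) = Bijection⇒≲ c

  Kλ-≳ : ∀ {M} → M ∈ Kλ → U {A = Λ} ≲ ∣ M ∣
  Kλ-≳ (_ , c) = Bijection⇒≳ c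

  abstract
    ⟨_,_,_⟩ : ∀ {M} → M ∈ K → Small ∣ M ∣ → U {A = Λ} ≲ ∣ M ∣ → M ∈ Kλ
    ⟨ M∈ , f , g ⟩ = M∈ , ≅⇒Bijection-setoid (≲-antisym f g)

    Kλ-iso : ∀ {f M N} → IsIso f M N → M ∈ Kλ → N ∈ Kλ
    Kλ-iso i M∈ = ⟨ K-iso i (proj₁ M∈) , ≲-trans (iso-≲ (iso-sym i)) (Kλ-≲ M∈) , ≲-trans (Kλ-≳ M∈) (iso-≲ i) ⟩

  abstract
    -- The bound from `LST` and the size of `P` gives at most λ points; the model `M` contained in
    -- `P` gives at least λ.
    löwenheimSkolem : ∀ {N M} {P : Pred Point 1ℓ} → N ∈ K → M ∈ Kλ → Small P → ∣ M ∣ ⊆ P → P ⊆ ∣ N ∣ →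
                      ∃[ Q ] (Q ∈ Kλ × P ⊆ ∣ Q ∣ × Q ⪯ N)
    löwenheimSkolem {N} {M} {P} N∈ M∈ P≲ M⊆P P⊆N with LST-holds N∈ P P⊆N
    ... | Q , P⊆Q , Q⪯N , i = Q , ⟨ proj₁ (⪯⇒K Q⪯N) , mk≲ (λ x x∈ → code (I.to (x , x∈))) (λ _ → tt)
                                    (λ {x} {y} x∈ y∈ e → I.injective {x , x∈} {y , y∈} (code-inj _ _ e)) ,
                                  ≲-trans (Kλ-≳ M∈) (⊆⇒≲ λ x∈ → P⊆Q (M⊆P x∈)) ⟩ , P⊆Q , Q⪯N
      where
      module I = Injection i
      module L = Injection LST≤λ
      module P = _≲_ P≲
      code : LST ⊎ Σ Point P → Λ
      code (inj₁ l)       = tag false (L.to l)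
      code (inj₂ (x , px)) = tag true (P.to x px)
      code-inj : ∀ u v → code u ≡ code v → SumRel.Pointwise _≡_ (λ u v → proj₁ u ≡ proj₁ v) u v
      code-inj (inj₁ l) (inj₁ m) e = SumRel.inj₁ (L.injective (proj₂ (tag-injective false false e)))
      code-inj (inj₂ (x , px)) (inj₂ (y , py)) e = SumRel.inj₂ (P.inj px py (proj₂ (tag-injective true true e)))
      code-inj (inj₁ _) (inj₂ _) e with () ← proj₁ (tag-injective false true e)
      code-inj (inj₂ _) (inj₁ _) e with () ← proj₁ (tag-injective true false e)

    löwenheimSkolem₂ : ∀ {N M₁ M₂} → M₁ ∈ Kλ → M₂ ∈ Kλ → M₁ ⪯ N → M₂ ⪯ N →
                       ∃[ Q ] (Q ∈ Kλ × M₁ ⪯ Q × M₂ ⪯ Q × Q ⪯ N)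
    löwenheimSkolem₂ M₁∈ M₂∈ p q =
      let (Q , Q∈ , ⊆Q , Q⪯N) = löwenheimSkolem (proj₂ (⪯⇒K p)) M₁∈ (∪-small (Kλ-≲ M₁∈) (Kλ-≲ M₂∈))
                                  inj₁ [ ⪯-⊆ p , ⪯-⊆ q ]′ in
      Q , Q∈ , ⪯-coherent p Q⪯N (λ x → ⊆Q (inj₁ x)) , ⪯-coherent q Q⪯N (λ x → ⊆Q (inj₂ x)) , Q⪯N

    löwenheimSkolem₁ : ∀ {N M x} → M ∈ Kλ → M ⪯ N → x ∈ ∣ N ∣ → ∃[ Q ] (Q ∈ Kλ × M ⪯ Q × x ∈ ∣ Q ∣ × Q ⪯ N)
    löwenheimSkolem₁ {N} {M} {x} M∈ p x∈ =
      let (Q , Q∈ , ⊆Q , Q⪯N) = löwenheimSkolem (proj₂ (⪯⇒K p)) M∈ (∪-small (Kλ-≲ M∈) singleton)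
                                  inj₁ [ ⪯-⊆ p , (λ { refl → x∈ }) ]′ in
      Q , Q∈ , ⪯-coherent p Q⪯N (λ y → ⊆Q (inj₁ y)) , ⊆Q (inj₂ refl) , Q⪯N
      where
      singleton : Small (_≡ x)
      singleton = ≲-trans (mk≲ (λ _ _ → Fin.zero) (λ _ → tt) (λ { refl refl _ → refl })) (infinite⇒Fin≲ ¬finite 1)

  emb-iso : ∀ {f M N} → IsIso f M N → N ∈ K → IsEmbedding f M N
  emb-iso i N∈ = _ , i , ⪯-refl N∈

  emb-incl : ∀ {M N} → M ⪯ N → IsEmbedding (λ x → x) M N
  emb-incl M⪯N = _ , iso-refl , M⪯N

  abstract
    ⪯-image : ∀ {f M N N′} → IsIso f N N′ → M ⪯ N → IsIso f M (image f M) × image f M ⪯ N′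
    ⪯-image i M⪯N = let j = iso-restrict i (⪯-⊆ M⪯N) in j , ⪯-iso i j M⪯N

    emb-trans : ∀ {f g M N P} → IsEmbedding f M N → IsEmbedding g N P → IsEmbedding (g ∘ f) M P
    emb-trans (_ , i , M′⪯N) (_ , j , N′⪯P) = let (k , le) = ⪯-image j M′⪯N in _ , iso-trans i k , ⪯-trans le N′⪯P

  emb-cong : ∀ {f g M N} → f ≗[ M ] g → IsEmbedding f M N → IsEmbedding g M N
  emb-cong e (_ , i , le) = _ , iso-cong e i , le

  emb-⪯ : ∀ {f M N P} → IsEmbedding f M N → N ⪯ P → IsEmbedding f M P
  emb-⪯ (_ , i , le) N⪯P = _ , i , ⪯-trans le N⪯P

  emb-restrict : ∀ {f M N P} → M ⪯ N → IsEmbedding f N P → IsEmbedding f M P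
  emb-restrict M⪯N e = emb-trans (emb-incl M⪯N) e

  emb-maps : ∀ {f M N x} → IsEmbedding f M N → x ∈ ∣ M ∣ → f x ∈ ∣ N ∣
  emb-maps (_ , i , le) x∈ = ⪯-⊆ le (IsIso.maps i x∈)

  emb-injective : ∀ {f M N} → IsEmbedding f M N → InjectiveOn f ∣ M ∣
  emb-injective (_ , i , _) = IsIso.inj i

  abstract
    -- An embedding carries some model as its image, determined only up to equality of models. It
    -- can be exchanged for the canonical `image f M`, on which later constructions agree by
    -- definition.
    emb-image : ∀ {f M N} → IsEmbedding f M N → IsIso f M (image f M) × image f M ⪯ N
    emb-image (M′ , i , le) = let j = image-iso (IsIso.inj i) in
      j , ⪯-trans (≐ₘ⇒⪯ (K-iso j (K-iso (iso-sym i) (proj₁ (⪯⇒K le)))) (iso-unique j i)) le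

  iso-identity : ∀ {f M} → IdentityOn M f → IsIso f M M
  iso-identity e = iso-cong (λ x∈ → sym (e x∈)) iso-refl

  abstract
    -- The isomorphism `g` is extended to `N` by sending the points off `R` to fresh ones, which
    -- cannot collide with `R′`.
    rename : ∀ {R N R′ g} → N ∈ Kλ → R ∈ Kλ → R ⪯ N → IsIso g R R′ →
             ∃[ N′ ] ∃[ h ] (N′ ∈ Kλ × IsIso h N N′ × R′ ⪯ N′ × h ≗[ R ] g)
    rename {R} {N} {R′} {g} N∈ R∈ R⪯N i with extend-injection {R = R} {N = N} (proj₂ N∈) (proj₂ (Kλ-iso i R∈)) i
    ... | h , h-inj , h≗g = image h N , h , Kλ-iso j N∈ , j , ⪯-iso j (iso-cong (λ x∈ → sym (h≗g x∈)) i) R⪯N , h≗g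
      where
      j : IsIso h N (image h N)
      j = image-iso {h} {N} h-inj

    -- An embedding of M into N becomes an inclusion after renaming the points of N.
    pullback : ∀ {f M N} → M ∈ Kλ → N ∈ Kλ → IsEmbedding f M N →
               ∃[ N′ ] ∃[ h ] (N′ ∈ Kλ × IsIso h N N′ × M ⪯ N′ × (∀ {x} → x ∈ ∣ M ∣ → h (f x) ≡ x))
    pullback {f} {M} M∈ N∈ (M′ , i , M′⪯N) =
      let (N′ , h , N′∈ , j , M⪯N′ , e) = rename N∈ (Kλ-iso i M∈) M′⪯N (iso-sym i) in
      N′ , h , N′∈ , j , M⪯N′ , λ x∈ → trans (e (IsIso.maps i x∈)) (preimage-cancel {f} {M} (IsIso.inj i) x∈)

    -- The axiom amalgamates two extensions of a common submodel. So `N₁` is first renamed to extend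
    -- the image of `R` in `N₂`, and the amalgam is renamed afterwards so that `N₂` is included in
    -- it.
    amalgamate : ∀ {R N₁ N₂ g} → R ∈ Kλ → N₁ ∈ Kλ → N₂ ∈ Kλ → R ⪯ N₁ → IsEmbedding g R N₂ →
                 ∃[ P ] ∃[ h ] (P ∈ Kλ × N₂ ⪯ P × IsEmbedding h N₁ P × h ≗[ R ] g)
    amalgamate {g = g} R∈ N₁∈ N₂∈ R⪯N₁ (R′ , i , R′⪯N₂) =
      let (N₁′ , h₁ , N₁′∈ , j₁ , R′⪯N₁′ , e₁) = rename N₁∈ R∈ R⪯N₁ i
          (P , P∈ , (f₁ , F₁ , id₁) , (f₂ , F₂ , id₂)) = amalgamation (Kλ-iso i R∈) N₁′∈ N₂∈ R′⪯N₁′ R′⪯N₂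
          (P′ , h₂ , P′∈ , j₂ , N₂⪯P′ , e₂) = pullback N₂∈ P∈ F₂
      in P′ , h₂ ∘ f₁ ∘ h₁ , P′∈ , N₂⪯P′
       , emb-trans (emb-iso j₁ (proj₁ N₁′∈)) (emb-trans F₁ (emb-iso j₂ (proj₁ P′∈)))
       , λ {x} x∈ → let gx∈ = IsIso.maps i x∈ in
           trans (cong (h₂ ∘ f₁) (e₁ x∈)) (trans (cong h₂ (trans (id₁ gx∈) (sym (id₂ gx∈)))) (e₂ (⪯-⊆ R′⪯N₂ gx∈)))

    -- Equality of types is a chain of one-step embeddings through models of any size. Each
    -- intermediate model is cut down to a model `R` of size λ, where amalgamation over `R` composes
    -- two consecutive steps into a single embedding.
    realize : ∀ {M} {p q : TypeOver M} → p ≡tp q → M ∈ Kλ → ∀ {P Q} → P ∈ Kλ → Q ∈ Kλ →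
              M ⪯ P → P ⪯ ext p → pt p ∈ ∣ P ∣ → M ⪯ Q → Q ⪯ ext q → pt q ∈ ∣ Q ∣ →
              ∃[ N ] ∃[ f ] (N ∈ Kλ × Q ⪯ N × IsEmbedding f P N × IdentityOn M f × f (pt p) ≡ pt q)
    realize [ N , ext⪯N , f , F , f-id , f-pt ] M∈ P∈ Q∈ M⪯P P⪯ p∈ M⪯Q Q⪯ q∈ =
      let (i , fP⪯N) = emb-image (emb-restrict P⪯ F)
          (N′ , N′∈ , fP⪯N′ , Q⪯N′ , _) = löwenheimSkolem₂ (Kλ-iso i P∈) Q∈ fP⪯N (⪯-trans Q⪯ ext⪯N)
      in N′ , f , N′∈ , Q⪯N′ , (_ , i , fP⪯N′) , f-id , f-pt
    realize {M} {p} (_∷_ {y = r} e r≡q) M∈ P∈ Q∈ M⪯P P⪯ p∈ M⪯Q Q⪯ q∈ =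
      let (R , R∈ , M⪯R , r∈ , R⪯) = löwenheimSkolem₁ M∈ (M⪯ext r) (pt∈ r)
          (N , f , N∈ , R⪯N , F , f-id , f-pt) = realize {p = p} {q = r} [ e ] M∈ P∈ R∈ M⪯P P⪯ p∈ M⪯R R⪯ r∈
          (N′ , g , N′∈ , Q⪯N′ , G , g-id , g-pt) = realize r≡q M∈ R∈ Q∈ M⪯R R⪯ r∈ M⪯Q Q⪯ q∈
          (N″ , h , N″∈ , N′⪯N″ , H , h≗g) = amalgamate R∈ N∈ N′∈ R⪯N G
      in N″ , h ∘ f , N″∈ , ⪯-trans Q⪯N′ N′⪯N″ , emb-trans F H
       , (λ x∈ → trans (cong h (f-id x∈)) (trans (h≗g (⪯-⊆ M⪯R x∈)) (g-id x∈)))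
       , trans (cong h f-pt) (trans (h≗g r∈) g-pt)

  ≡tp-embedding : ∀ {M P Q a b f} {M⪯P : M ⪯ P} {M⪯Q : M ⪯ Q} {a∈ : a ∈ ∣ P ∣} {b∈ : b ∈ ∣ Q ∣} →
                  IsEmbedding f P Q → IdentityOn M f → f a ≡ b → tp a P M⪯P a∈ ≡tp tp b Q M⪯Q b∈
  ≡tp-embedding {M⪯Q = M⪯Q} F f-id e = [ _ , ⪯-refl (proj₂ (⪯⇒K M⪯Q)) , _ , F , f-id , e ]

  abstract
    ≡tp-trans : ∀ {M} {p q r : TypeOver M} → p ≡tp q → q ≡tp r → p ≡tp r
    ≡tp-trans [ e ] f = e ∷ f
    ≡tp-trans (e ∷ es) f = e ∷ ≡tp-trans es f

  nf-⪯₀₁ : ∀ {M₀ M₁ a N} → nf M₀ M₁ a N → M₀ ⪯ M₁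
  nf-⪯₀₁ n = proj₁ (nf-bs n)

  nf-⪯₁ : ∀ {M₀ M₁ a N} → nf M₀ M₁ a N → M₁ ⪯ N
  nf-⪯₁ n = proj₁ (proj₂ (nf-bs n))

  nf-∈ : ∀ {M₀ M₁ a N} → nf M₀ M₁ a N → a ∈ ∣ N ∣
  nf-∈ n = proj₁ (proj₂ (proj₂ (nf-bs n)))

  nf-∉ : ∀ {M₀ M₁ a N} → nf M₀ M₁ a N → a ∉ ∣ M₁ ∣
  nf-∉ n = proj₁ (proj₂ (proj₂ (proj₂ (nf-bs n))))

  nf-basic₀ : ∀ {M₀ M₁ a N} → nf M₀ M₁ a N → Basic a M₀ N
  nf-basic₀ n = proj₁ (proj₂ (proj₂ (proj₂ (proj₂ (nf-bs n)))))

  nf-basic₁ : ∀ {M₀ M₁ a N} → nf M₀ M₁ a N → Basic a M₁ N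
  nf-basic₁ n = proj₂ (proj₂ (proj₂ (proj₂ (proj₂ (nf-bs n)))))

  nf-Kλ₀ : ∀ {M₀ M₁ a N} → nf M₀ M₁ a N → M₀ ∈ Kλ
  nf-Kλ₀ n = proj₁ (nf-Kλ n)

  nf-Kλ₁ : ∀ {M₀ M₁ a N} → nf M₀ M₁ a N → M₁ ∈ Kλ
  nf-Kλ₁ n = proj₁ (proj₂ (nf-Kλ n))

  nf-Kλ₂ : ∀ {M₀ M₁ a N} → nf M₀ M₁ a N → N ∈ Kλ
  nf-Kλ₂ n = proj₂ (proj₂ (nf-Kλ n))

  abstract
    nf-expand : ∀ {M₀ M₁ a N N′} → N′ ∈ Kλ → N ⪯ N′ → nf M₀ M₁ a N → nf M₀ M₁ a N′
    nf-expand N′∈ N⪯N′ n = monotonicity (nf-Kλ₀ n) (nf-Kλ₁ n) N′∈ N′∈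
      (⪯-refl (proj₁ (nf-Kλ₀ n))) (nf-⪯₀₁ n) (⪯-refl (proj₁ (nf-Kλ₁ n))) (nf-⪯₁ n) N⪯N′
      (⪯-⊆ (⪯-trans (nf-⪯₁ n) N⪯N′)) (⪯-⊆ N⪯N′ (nf-∈ n)) (⪯-refl (proj₁ N′∈)) n

    nf-shrink : ∀ {M₀ M₁ a N N′} → N′ ∈ Kλ → N′ ⪯ N → ∣ M₁ ∣ ⊆ ∣ N′ ∣ → a ∈ ∣ N′ ∣ → nf M₀ M₁ a N → nf M₀ M₁ a N′
    nf-shrink N′∈ N′⪯N M₁⊆ a∈ n = monotonicity (nf-Kλ₀ n) (nf-Kλ₁ n) (nf-Kλ₂ n) N′∈
      (⪯-refl (proj₁ (nf-Kλ₀ n))) (nf-⪯₀₁ n) (⪯-refl (proj₁ (nf-Kλ₁ n))) (nf-⪯₁ n) (⪯-refl (proj₁ (nf-Kλ₂ n)))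
      M₁⊆ a∈ N′⪯N n

    nf-between : ∀ {M₀ M₁ M₀′ M₁′ a N} → M₀′ ∈ Kλ → M₁′ ∈ Kλ → M₀ ⪯ M₀′ → M₀′ ⪯ M₁′ → M₁′ ⪯ M₁ →
                 nf M₀ M₁ a N → nf M₀′ M₁′ a N
    nf-between M₀′∈ M₁′∈ p q r n = monotonicity M₀′∈ M₁′∈ (nf-Kλ₂ n) (nf-Kλ₂ n)
      p q r (nf-⪯₁ n) (⪯-refl (proj₁ (nf-Kλ₂ n))) (⪯-⊆ (⪯-trans r (nf-⪯₁ n))) (nf-∈ n) (⪯-refl (proj₁ (nf-Kλ₂ n))) n

    nf-embed : ∀ {f M₀ M₁ a N M₀′ M₁′ N′} → N′ ∈ Kλ → IsIso f M₀ M₀′ → IsIso f M₁ M₁′ → IsEmbedding f N N′ →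
               nf M₀ M₁ a N → nf M₀′ M₁′ (f a) N′
    nf-embed N′∈ i₀ i₁ (_ , j , le) n = nf-expand N′∈ le (nf-iso j i₀ i₁ n)

    -- Not forking is witnessed by some representative `q` of the type. An embedding `f` of `N` into
    -- an extension of that representative takes `a` to its point; monotonicity passes to the image
    -- of `N`, and the inverse of `f` brings the relation back.
    nf-≡tp : ∀ {M A a N} {A⪯N : A ⪯ N} {a∈ : a ∈ ∣ N ∣} → N ∈ Kλ → DoesNotFork (tp a N A⪯N a∈) M → nf M A a N
    nf-≡tp {M} {A} {a} {N} {A⪯N} {a∈} N∈ (q , e , n) with realize e (nf-Kλ₁ n) N∈ (nf-Kλ₂ n)
        A⪯N (⪯-refl (proj₁ N∈)) a∈ (nf-⪯₁ n) (⪯-refl (proj₁ (nf-Kλ₂ n))) (nf-∈ n)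
    ... | N′ , f , N′∈ , q⪯N′ , F , f-id , f-pt =
      subst (λ z → nf M A z N) f⁻a (nf-iso (iso-sym i)
        (iso-identity λ x∈ → f⁻-id (⪯-⊆ (nf-⪯₀₁ n) x∈)) (iso-identity f⁻-id)
        (nf-shrink (Kλ-iso i N∈) fN⪯N′ (λ x∈ → _ , ⪯-⊆ A⪯N x∈ , f-id x∈) (_ , a∈ , f-pt) (nf-expand N′∈ q⪯N′ n)))
      where
      i : IsIso f N (image f N)
      i = proj₁ (emb-image F)
      fN⪯N′ : image f N ⪯ N′
      fN⪯N′ = proj₂ (emb-image F)
      f⁻ : ∀ {x} → x ∈ ∣ N ∣ → preimage f N (f x) ≡ x
      f⁻ = preimage-cancel {f} {N} (IsIso.inj i)
      f⁻-id : IdentityOn A (preimage f N)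
      f⁻-id x∈ = trans (cong (preimage f N) (sym (f-id x∈))) (f⁻ (⪯-⊆ A⪯N x∈))
      f⁻a : preimage f N (pt q) ≡ a
      f⁻a = trans (cong (preimage f N) (sym f-pt)) (f⁻ a∈)

  nf⇒DoesNotFork : ∀ {M A a N} (A⪯N : A ⪯ N) (a∈ : a ∈ ∣ N ∣) → nf M A a N → DoesNotFork (tp a N A⪯N a∈) M
  nf⇒DoesNotFork A⪯N a∈ n = tp _ _ A⪯N a∈ , ≡tp-embedding (emb-incl (⪯-refl (proj₂ (⪯⇒K A⪯N)))) (λ _ → refl) refl , n

  abstract
    nf-≐ : ∀ {M A A′ a N} → A ≐ₘ A′ → nf M A a N → nf M A′ a N
    nf-≐ e n = nf-embed (nf-Kλ₂ n) iso-refl (≐ₘ⇒iso e) (emb-incl (⪯-refl (proj₁ (nf-Kλ₂ n)))) n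

-- Transitivity and extension of nonforking.

module NonForking (cl : Classical) (τ : Vocabulary) (𝕌 : Points) (Λ : Set) (infinite : ¬ Finite (setoid Λ))
                  (𝔰 : Models.GoodFrameMinusStability τ 𝕌 Λ) where
  open FrameTheory cl τ 𝕌 Λ infinite 𝔰 public

  -- tp(a,M,N) = tp(a′,M,N′), for models in Kλ.
  SameType : Structure → Point → Structure → Point → Structure → Set₂
  SameType M a N a′ N′ = ∃[ P ] ∃[ f ] (P ∈ Kλ × N′ ⪯ P × IsEmbedding f N P × IdentityOn M f × f a ≡ a′)

  same-sym : ∀ {M a N a′ N′} → N ∈ Kλ → M ⪯ N → a ∈ ∣ N ∣ → SameType M a N a′ N′ → SameType M a′ N′ a N
  same-sym N∈ M⪯N a∈ (P , f , P∈ , N′⪯P , F , f-id , f-pt) =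
    let (P′ , h , P′∈ , i , N⪯P′ , hf) = pullback N∈ P∈ F in
    P′ , h , P′∈ , N⪯P′ , emb-restrict N′⪯P (emb-iso i (proj₁ P′∈))
    , (λ x∈ → trans (cong h (sym (f-id x∈))) (hf (⪯-⊆ M⪯N x∈)))
    , trans (cong h (sym f-pt)) (hf a∈)

  ≡tp⇒same : ∀ {M} {p q : TypeOver M} → M ∈ Kλ → ext p ∈ Kλ → ext q ∈ Kλ → p ≡tp q →
             SameType M (pt p) (ext p) (pt q) (ext q)
  ≡tp⇒same {p = p} {q} M∈ p∈ q∈ e =
    let (N , f , rest) = realize e M∈ p∈ q∈ (M⪯ext p) (⪯-refl (proj₁ p∈)) (pt∈ p) (M⪯ext q) (⪯-refl (proj₁ q∈)) (pt∈ q)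
    in N , f , rest

  same⇒≡tp : ∀ {M a N a′ N′} → SameType M a N a′ N′ → ∀ {m m′ x x′} → tp a N m x ≡tp tp {M} a′ N′ m′ x′
  same⇒≡tp (P , f , _ , N′⪯P , F , f-id , f-pt) = [ P , N′⪯P , f , F , f-id , f-pt ]

  ≡tp-irrelevant : ∀ {M a N} {m m′ x x′} → tp {M} a N m x ≡tp tp a N m′ x′
  ≡tp-irrelevant {m = m} = ≡tp-embedding (emb-incl (⪯-refl (proj₂ (⪯⇒K m)))) (λ _ → refl) refl

  nf-same : ∀ {M A a N a′ N′} → N′ ∈ Kλ → A ⪯ N′ → a′ ∈ ∣ N′ ∣ → SameType A a N a′ N′ → nf M A a N → nf M A a′ N′
  nf-same {M} {A} N′∈ A⪯N′ a′∈ (P , f , P∈ , N′⪯P , F , f-id , refl) n =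
    nf-shrink N′∈ N′⪯P (⪯-⊆ A⪯N′) a′∈
      (nf-embed P∈ (iso-identity λ x∈ → f-id (⪯-⊆ (nf-⪯₀₁ n) x∈)) (iso-identity f-id) F n)

  basic⇒Sbs : ∀ {a M N} → Basic a M N → ∀ {m x} → tp a N m x ∈ Sbs M
  basic⇒Sbs (_ , _ , b) = Sbs-respects ≡tp-irrelevant b

  nf-unique : ∀ {M A a N a′ N′} → nf M A a N → nf M A a′ N′ → SameType M a N a′ N′ → SameType A a N a′ N′
  nf-unique n n′ s = ≡tp⇒same (nf-Kλ₁ n) (nf-Kλ₂ n) (nf-Kλ₂ n′)
    (uniqueness (nf-⪯₀₁ n) (basic⇒Sbs (nf-basic₁ n)) (basic⇒Sbs (nf-basic₁ n′))
      (nf⇒DoesNotFork (nf-⪯₁ n) (nf-∈ n) n) (nf⇒DoesNotFork (nf-⪯₁ n′) (nf-∈ n′) n′)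
      (same⇒≡tp s))

  private
    -- The extension axiom yields a type whose representative may be large; a model `R` of size λ
    -- around its point replaces it.
    nf-extension₀ : ∀ {M M₁ b N A} → nf M M₁ b N → A ∈ Kλ → M ≺ A → ∃[ c ] ∃[ E ] (nf M A c E × SameType M b N c E)
    nf-extension₀ {M} {M₁} {b} {N} {A} n A∈ M≺A
      with extension {p = tp b N (⪯-trans (nf-⪯₀₁ n) (nf-⪯₁ n)) (nf-∈ n)} (basic⇒Sbs (nf-basic₀ n)) A∈ M≺A
    ... | q , _ , (q′ , q≡q′ , nq′) , q≡p with löwenheimSkolem₁ A∈ (M⪯ext q) (pt∈ q)
    ...   | R , R∈ , A⪯R , q∈R , R⪯ = pt q , R
          , nf-≡tp {A⪯N = A⪯R} {q∈R} R∈ (q′ ,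
              ≡tp-trans (≡tp-embedding {M⪯Q = M⪯ext q} {b∈ = pt∈ q} (emb-incl R⪯) (λ _ → refl) refl) q≡q′ , nq′)
          , same-sym R∈ (⪯-trans (proj₁ M≺A) A⪯R) q∈R
              (≡tp⇒same (nf-Kλ₀ n) R∈ (nf-Kλ₂ n)
                (≡tp-trans (≡tp-embedding {M⪯P = ⪯-trans (proj₁ M≺A) A⪯R} {a∈ = q∈R} (emb-incl R⪯) (λ _ → refl) refl) q≡p))

  -- Let `c` realize the nonforking extension to `A` of the type of `b` over `M`. Uniqueness over
  -- `M` shows that `b` and `c` have the same type over `M₀`; uniqueness over `M₀` then gives the
  -- same type over `A`, and `b` inherits nonforking from `c`.
  nf-trans : ∀ {M M₀ A b N} → nf M M₀ b N → nf M₀ A b N → nf M A b N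
  nf-trans {M} {M₀} {A} {b} {N} n n′ = by-cases em
    where
    M⪯A = ⪯-trans (nf-⪯₀₁ n) (nf-⪯₀₁ n′)

    extended : ∃[ c ] ∃[ E ] (nf M A c E × SameType M b N c E) → nf M A b N
    extended (c , E , nE , s) = nf-same N∈ (nf-⪯₁ n′) (nf-∈ n′) (same-sym N∈ (nf-⪯₁ n′) (nf-∈ n′) sameᴬ) nE
      where
      N∈ = nf-Kλ₂ n′
      same₀ : SameType M₀ b N c E
      same₀ = nf-unique n (nf-between (nf-Kλ₀ n) (nf-Kλ₀ n′) (⪯-refl (proj₁ (nf-Kλ₀ n))) (nf-⪯₀₁ n) (nf-⪯₀₁ n′) nE) s
      sameᴬ : SameType A b N c E
      sameᴬ = nf-unique n′ (nf-between (nf-Kλ₀ n′) (nf-Kλ₁ n′) (nf-⪯₀₁ n) (nf-⪯₀₁ n′) (⪯-refl (proj₁ (nf-Kλ₁ n′))) nE) same₀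

    by-cases : Dec (M ≐ₘ A) → nf M A b N
    -- Extension applies to proper extensions only. If `M` and `A` coincide, then so does `M₀`, and
    -- monotonicity is enough.
    by-cases (yes e) = nf-between (nf-Kλ₀ n) (nf-Kλ₁ n′) (⪯-refl (proj₁ (nf-Kλ₀ n))) M⪯A
                         (⪯-trans (≐ₘ⇒⪯ (proj₁ (nf-Kλ₁ n′)) (≐ₘ-sym e)) (nf-⪯₀₁ n)) n
    by-cases (no ¬e) = extended (nf-extension₀ n (nf-Kλ₁ n′) (M⪯A , ¬e))

  -- The extension axiom matches types over `M` only; uniqueness raises the agreement to `M₁`, and
  -- realizing it by an embedding moves `N`, and `b` with it, while `A` stays in place.
  nf-extension : ∀ {M M₁ b N A} → nf M M₁ b N → A ∈ Kλ → M₁ ⪯ A →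
                 ∃[ E ] ∃[ e ] (E ∈ Kλ × A ⪯ E × IsEmbedding e N E × IdentityOn M₁ e × nf M A (e b) E)
  nf-extension {M} {M₁} {b} {N} {A} n A∈ M₁⪯A = by-cases em
    where
    Goal = ∃[ E ] ∃[ e ] (E ∈ Kλ × A ⪯ E × IsEmbedding e N E × IdentityOn M₁ e × nf M A (e b) E)

    extended : ∃[ c ] ∃[ E ] (nf M A c E × SameType M b N c E) → Goal
    extended (c , E , nE , s) = realized
        (nf-unique n (nf-between (nf-Kλ₀ n) (nf-Kλ₁ n) (⪯-refl (proj₁ (nf-Kλ₀ n))) (nf-⪯₀₁ n) M₁⪯A nE) s)
      where
      realized : SameType M₁ b N c E → Goal
      realized (P , f , P∈ , E⪯P , F , f-id , refl) = P , f , P∈ , ⪯-trans (nf-⪯₁ nE) E⪯P , F , f-id , nf-expand P∈ E⪯P nE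

    by-cases : Dec (M ≐ₘ A) → Goal
    by-cases (yes e) = N , (λ x → x) , nf-Kλ₂ n , ⪯-trans A⪯M₁ (nf-⪯₁ n) , emb-incl (⪯-refl (proj₁ (nf-Kλ₂ n))) , (λ _ → refl)
                     , nf-≐ (⪯⇒⊑ M₁⪯A , ⪯⇒⊑ A⪯M₁) n
      where A⪯M₁ = ⪯-trans (≐ₘ⇒⪯ (proj₁ A∈) (≐ₘ-sym e)) (nf-⪯₀₁ n)
    by-cases (no ¬e) = extended (nf-extension₀ n A∈ (⪯-trans (nf-⪯₀₁ n) M₁⪯A , ¬e))

-- Chains that need not be continuous.

module Chains (cl : Classical) (τ : Vocabulary) (𝕌 : Points) (Λ : Set) (infinite : ¬ Finite (setoid Λ))
              (𝔰 : Models.GoodFrameMinusStability τ 𝕌 Λ) where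
  open NonForking cl τ 𝕌 Λ infinite 𝔰 public

  -- The axioms concern continuous chains only.  For an increasing chain X on [i , j),
  -- V k is the union of X over [i , k), and Y l is the chain of the V k started at l.
  module Chain (W : WellOrder) (i j : WellOrder.Carrier W) (i<j : WellOrder._<_ W i j) (X : WellOrder.Carrier W → Structure)
               (increasing : ∀ k l → WellOrder._≤_ W i k → WellOrder._<_ W k l → WellOrder._<_ W l j → X k ⪯ X l)
               (X∈ : ∀ k → WellOrder._≤_ W i k → WellOrder._<_ W k j → X k ∈ Kλ)
               (small : Small (λ k → WellOrder._<_ W k j)) where
    open WellOrder W
    open WellOrderProperties W

    infix 4 _∈[_,_⟩
    _∈[_,_⟩ : Carrier → Carrier → Carrier → Set
    l ∈[ p , k ⟩ = p ≤ l × l < k × l < j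

    i≤i : i ≤ i
    i≤i = inj₂ refl

    X-mono : ∀ {k l} → i ≤ k → k ≤ l → l < j → X k ⪯ X l
    X-mono i≤k (inj₁ k<l) l<j = increasing _ _ i≤k k<l l<j
    X-mono i≤k (inj₂ refl) l<j = ⪯-refl (proj₁ (X∈ _ i≤k l<j))

    linear : ∀ k → Linear (_∈[ i , k ⟩) X
    linear k l m (i≤l , _ , l<j) (i≤m , _ , m<j) with ≤-total l m
    ... | inj₁ l≤m = inj₁ (⪯⇒⊑ (X-mono i≤l l≤m m<j))
    ... | inj₂ m≤l = inj₂ (⪯⇒⊑ (X-mono i≤m m≤l l<j))

    V′ : ∀ k → Dec (i < k) → Structure
    V′ k (yes i<k) = ⋃ (linear k) {i} (i≤i , i<k , i<j)
    V′ k (no _)    = X i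

    V : Carrier → Structure
    V k = V′ k em

    V-isUnion : ∀ {k} → i < k → IsUnion (_∈[ i , k ⟩) X (V k)
    V-isUnion {k} i<k = by-cases em
      where
      by-cases : (d : Dec (i < k)) → IsUnion (_∈[ i , k ⟩) X (V′ k d)
      by-cases (yes p) = ⋃-isUnion (linear k) {i} (i≤i , p , i<j)
      by-cases (no ¬p) = contradiction i<k ¬p

    V-⊑ : ∀ {k N} → i < k → (∀ l → i ≤ l → l < k → l < j → X l ⊑ N) → V k ⊑ N
    V-⊑ {k} i<k X⊑N = union-⊑ (linear k) (i≤i , i<k , i<j) (V-isUnion i<k) λ l (i≤l , l<k , l<j) → X⊑N l i≤l l<k l<j

    Y′ : ∀ l k → Dec (l < k) → Structure
    Y′ l k (yes _) = V k
    Y′ l k (no _)  = X l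

    Y : Carrier → Carrier → Structure
    Y l k = Y′ l k em

    Y-> : ∀ {l k} → l < k → Y l k ≡ V k
    Y-> {l} {k} l<k = by-cases em
      where
      by-cases : (d : Dec (l < k)) → Y′ l k d ≡ V k
      by-cases (yes _) = refl
      by-cases (no ≮)  = contradiction l<k ≮

    Y-≤ : ∀ {l k} → k ≤ l → Y l k ≡ X l
    Y-≤ {l} {k} k≤l = by-cases em
      where
      by-cases : (d : Dec (l < k)) → Y′ l k d ≡ X l
      by-cases (yes l<k) = contradiction l<k (≤⇒≯ k≤l)
      by-cases (no _)    = refl

    -- The union and smoothness axioms as they would read for the non-continuous chain `X`.
    record Good (k : Carrier) : Set₂ where
      field
        V∈K     : V k ∈ K
        upper   : ∀ l → i ≤ l → l < k → X l ⪯ V k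
        minimal : ∀ N → (∀ l → i ≤ l → l < k → X l ⪯ N) → V k ⪯ N

    Dense : Carrier → Set
    Dense k = ∀ α → α < k → ∃[ β ] (α < β × β < k)

    last⊎dense : ∀ {k} → i < k → (∃[ l ] (i ≤ l × l < k × (∀ m → m < k → m ≤ l))) ⊎ Dense k
    last⊎dense {k} i<k = by-cases em
      where
      by-cases : Dec (∃[ l ] (i ≤ l × l < k × (∀ m → m < k → m ≤ l))) → _
      by-cases (yes e) = inj₁ e
      by-cases (no ¬e) = inj₂ dense
        where
        dense : Dense k
        dense α α<k with ≤⊎> i α
        ... | inj₂ α<i = i , α<i , i<k
        ... | inj₁ i≤α = by-contradiction λ ¬∃ → ¬e (α , i≤α , α<k , λ m m<k → ≮⇒≥ λ α<m → ¬∃ (m , α<m , m<k))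

    dense-bound : ∀ {k} → Dense k → ∀ {α β} → α < k → β < k → ∃[ γ ] (α < γ × β < γ × γ < k)
    dense-bound dense {α} {β} α<k β<k with ≤-total α β
    ... | inj₁ α≤β = let (γ , β<γ , γ<k) = dense β β<k in γ , ≤-<-trans α≤β β<γ , β<γ , γ<k
    ... | inj₂ β≤α = let (γ , α<γ , γ<k) = dense α α<k in γ , α<γ , ≤-<-trans β≤α α<γ , γ<k

    Y-isUnion : ∀ l {k} → i ≤ l → l < k → k ≤ j → Dense k → IsUnion (_< k) (Y l) (V k)
    Y-isUnion l {k} i≤l l<k k≤j dense = below , cover
      where
      i<k = ≤-<-trans i≤l l<k
      X⊑V : ∀ {m} → i ≤ m → m < k → X m ⊑ V k
      X⊑V i≤m m<k = proj₁ (V-isUnion i<k) _ (i≤m , m<k , <-≤-trans m<k k≤j)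
      below : ∀ m → m < k → Y l m ⊑ V k
      below m m<k = by-cases em
        where
        by-cases : (d : Dec (l < m)) → Y′ l m d ⊑ V k
        by-cases (yes l<m) = V-⊑ (≤-<-trans i≤l l<m) λ p i≤p p<m _ → X⊑V i≤p (<-trans p<m m<k)
        by-cases (no _)    = X⊑V i≤l l<k
      cover : ∀ {x} → x ∈ ∣ V k ∣ → ∃[ m ] (m < k × x ∈ ∣ Y l m ∣)
      cover {x} x∈ =
        let (p , (i≤p , p<k , p<j) , x∈p) = proj₂ (V-isUnion i<k) x∈
            (m , l<m , p<m , m<k) = dense-bound dense l<k p<k
        in m , m<k , subst (λ S → x ∈ ∣ S ∣) (sym (Y-> l<m))
             (⊑.incl (proj₁ (V-isUnion (≤-<-trans i≤l l<m)) p (i≤p , p<m , p<j)) x∈p)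

    Y-chain : ∀ l k → i ≤ l → l < k → k ≤ j → (∀ m → i < m → m < k → Good m) → ∀ m n → m < n → n < k → Y l m ⪯ Y l n
    Y-chain l k i≤l l<k k≤j good m n m<n n<k = by-cases em em
      where
      by-cases : (d : Dec (l < m)) (e : Dec (l < n)) → Y′ l m d ⪯ Y′ l n e
      by-cases (yes l<m) (yes l<n) = Good.minimal (good m (≤-<-trans i≤l l<m) (<-trans m<n n<k)) (V n)
            λ p i≤p p<m → Good.upper (good n (≤-<-trans i≤l l<n) n<k) p i≤p (<-trans p<m m<n)
      by-cases (yes l<m) (no l≮n) = contradiction (<-trans l<m m<n) l≮n
      by-cases (no _) (yes l<n) = Good.upper (good n (≤-<-trans i≤l l<n) n<k) l i≤l l<n
      by-cases (no _) (no _) = ⪯-refl (proj₁ (X∈ l i≤l (<-≤-trans l<k k≤j)))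

    Y-continuous : ∀ l k → i ≤ l → l < k → k ≤ j → ∀ γ → γ < k → IsLimit γ → IsUnion (_< γ) (Y l) (Y l γ)
    Y-continuous l k i≤l l<k k≤j γ γ<k ((α , α<γ) , dense) = by-cases em
      where
      by-cases : (d : Dec (l < γ)) → IsUnion (_< γ) (Y l) (Y′ l γ d)
      by-cases (yes l<γ) = Y-isUnion l i≤l l<γ (inj₁ (<-≤-trans γ<k k≤j)) dense
      by-cases (no l≮γ)  = (λ m m<γ → subst (_⊑ X l) (sym (eq m<γ)) ⊑-refl)
                         , λ {x} x∈ → α , α<γ , subst (λ S → x ∈ ∣ S ∣) (sym (eq α<γ)) x∈
        where
        eq : ∀ {m} → m < γ → Y l m ≡ X l
        eq m<γ = Y-≤ (inj₁ (<-≤-trans m<γ (≮⇒≥ l≮γ)))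

    -- Induction on `k`. If there is a last index below `k`, the union equals the model at that
    -- index; otherwise `k` is a limit and the earlier unions form a continuous chain to which the
    -- axioms apply.
    good : ∀ k → i < k → k ≤ j → Good k
    good = All.wfRec wellFounded _ (λ k → i < k → k ≤ j → Good k) step
      where
      step : ∀ k → (∀ {m} → m < k → i < m → m ≤ j → Good m) → i < k → k ≤ j → Good k
      step k ih i<k k≤j = by-cases (last⊎dense i<k)
       where
       by-cases : (∃[ l ] (i ≤ l × l < k × (∀ m → m < k → m ≤ l))) ⊎ Dense k → Good k
       by-cases (inj₁ (l , i≤l , l<k , last)) = record
              { V∈K     = K-≐ (≐ₘ-sym V≐X) (proj₁ Xl∈)
              ; upper   = λ m i≤m m<k → ⪯-trans (X-mono i≤m (last m m<k) l<j) X⪯V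
              ; minimal = λ N X⪯N → ⪯-trans V⪯X (X⪯N l i≤l l<k) }
        where
        l<j = <-≤-trans l<k k≤j
        Xl∈ = X∈ l i≤l l<j
        V≐X : V k ≐ₘ X l
        V≐X = V-⊑ i<k (λ m i≤m m<k _ → ⪯⇒⊑ (X-mono i≤m (last m m<k) l<j)) , proj₁ (V-isUnion i<k) l (i≤l , l<k , l<j)
        X⪯V = ≐ₘ⇒⪯ (proj₁ Xl∈) (≐ₘ-sym V≐X)
        V⪯X = ≐ₘ⇒⪯ (proj₂ (⪯⇒K X⪯V)) V≐X
       by-cases (inj₂ dense) = record
              { V∈K     = proj₁ (un i i≤i i<k)
              -- The union axiom puts only the first member of a chain below the union; to reach
              -- `X l`, the chain is started at `l`.
              ; upper   = λ l i≤l l<k → subst (_⪯ V k) (Y-≤ (zero-≤ z l)) (proj₂ (un l i≤l l<k) o z)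
              ; minimal = λ N X⪯N → smoothness W k (Y i) limit (inc i i≤i i<k) (V k) (Y-isUnion i i≤i i<k k≤j dense) N
                                      (Y⪯ N X⪯N) }
        where
        limit : IsLimit k
        limit = (i , i<k) , dense
        good< : ∀ m → i < m → m < k → Good m
        good< m i<m m<k = ih m<k i<m (inj₁ (<-≤-trans m<k k≤j))
        inc : ∀ l → i ≤ l → l < k → IncreasingContinuous _⪯_ W (_< k) (Y l)
        inc l i≤l l<k = (λ m n m<k n<k m<n → Y-chain l k i≤l l<k k≤j good< m n m<n n<k)
                      , (λ γ γ<k lim → Y-continuous l k i≤l l<k k≤j γ γ<k lim)
        un : ∀ l → i ≤ l → l < k → V k ∈ K × (∀ o → IsZero o → Y l o ⪯ V k)
        un l i≤l l<k = union W k (Y l) limit (inc l i≤l l<k) (V k) (Y-isUnion l i≤l l<k k≤j dense)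
        zeroed = least wellFounded {P = λ _ → ⊤} {x = i} tt
        o = proj₁ zeroed
        z : IsZero o
        z β β<o = proj₂ (proj₂ zeroed) β β<o tt
        Y⪯ : ∀ N → (∀ l → i ≤ l → l < k → X l ⪯ N) → ∀ m → m < k → Y i m ⪯ N
        Y⪯ N X⪯N m m<k = below em
          where
          below : (d : Dec (i < m)) → Y′ i m d ⪯ N
          below (yes i<m) = Good.minimal (good< m i<m m<k) N λ l i≤l l<m → X⪯N l i≤l (<-trans l<m m<k)
          below (no _)    = X⪯N i i≤i i<k

    lub : Structure
    lub = V j

    private
      goodⱼ : Good j
      goodⱼ = good j i<j (inj₂ refl)

    V∈Kλ : ∀ k → i < k → k ≤ j → V k ∈ Kλ
    V∈Kλ k i<k k≤j = ⟨ Good.V∈K g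
      , ⋃-small {I = λ l → l ∈[ i , k ⟩} {X = λ l → ∣ X l ∣} (≲-trans (⊆⇒≲ (λ p → proj₂ (proj₂ p))) small)
          (λ {l} (i≤l , _ , l<j) → Kλ-≲ (X∈ l i≤l l<j)) (proj₂ (V-isUnion i<k))
      , ≲-trans (Kλ-≳ (X∈ i i≤i i<j)) (⊆⇒≲ (⪯-⊆ (Good.upper g i i≤i i<k))) ⟩
      where g = good k i<k k≤j

    lub∈ : lub ∈ Kλ
    lub∈ = V∈Kλ j i<j (inj₂ refl)

    ⪯-lub : ∀ l → i ≤ l → l < j → X l ⪯ lub
    ⪯-lub = Good.upper goodⱼ

    lub-⪯ : ∀ {N} → (∀ l → i ≤ l → l < j → X l ⪯ N) → lub ⪯ N
    lub-⪯ {N} = Good.minimal goodⱼ N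

    ∈-lub : ∀ {x} → x ∈ ∣ lub ∣ → ∃[ l ] (i ≤ l × l < j × x ∈ ∣ X l ∣)
    ∈-lub x∈ = let (l , (i≤l , l<j , _) , x∈l) = proj₂ (V-isUnion i<j) x∈ in l , i≤l , l<j , x∈l

    private
      sequence : Dense j → KλSequence W j (Y i)
      sequence dense = all-Kλ
        , (λ m n m≤j n≤j m<n → mono m n m<n n≤j)
        , (λ γ γ≤j lim → cont γ γ≤j lim)
        where
        all-Kλ : ∀ m → m ≤ j → Y i m ∈ Kλ
        all-Kλ m m≤j = by-cases em
          where
          by-cases : (d : Dec (i < m)) → Y′ i m d ∈ Kλ
          by-cases (yes i<m) = V∈Kλ m i<m m≤j
          by-cases (no _)    = X∈ i i≤i i<j
        good< : ∀ m → i < m → m < j → Good m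
        good< m i<m m<j = good m i<m (inj₁ m<j)
        Y⪯lub : ∀ m → m < j → Y i m ⪯ V j
        Y⪯lub m m<j = by-cases em
          where
          by-cases : (d : Dec (i < m)) → Y′ i m d ⪯ V j
          by-cases (yes i<m) = Good.minimal (good< m i<m m<j) (V j) λ l i≤l l<m → Good.upper goodⱼ l i≤l (<-trans l<m m<j)
          by-cases (no _)    = Good.upper goodⱼ i i≤i i<j
        mono : ∀ m n → m < n → n ≤ j → Y i m ⪯ Y i n
        mono m n m<n (inj₁ n<j) = Y-chain i j i≤i i<j (inj₂ refl) good< m n m<n n<j
        mono m n m<n (inj₂ refl) = subst (Y i m ⪯_) (sym (Y-> i<j)) (Y⪯lub m m<n)
        cont : ∀ γ → γ ≤ j → IsLimit γ → IsUnion (_< γ) (Y i) (Y i γ)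
        cont γ (inj₁ γ<j) lim = Y-continuous i j i≤i i<j (inj₂ refl) γ γ<j lim
        cont γ (inj₂ refl) lim = subst (IsUnion (_< γ) (Y i)) (sym (Y-> i<j)) (Y-isUnion i i≤i i<j (inj₂ refl) dense)

      V⪯X : ∀ {k} → i < k → k < j → V k ⪯ X k
      V⪯X {k} i<k k<j = Good.minimal (good k i<k (inj₁ k<j)) (X k) λ l i≤l l<k → increasing l k i≤l l<k k<j

    -- The continuity axiom takes the first member of the chain as base. Hence `M` is replaced by
    -- `X i`, over which `c` stays free over each `V k` because `V k` lies below `X k`, and
    -- transitivity returns from `X i` to `M`.
    nf-lub : ∀ {M c N} → lub ⪯ N → (∀ k → i ≤ k → k < j → nf M (X k) c N) → nf M lub c N
    nf-lub {M} {c} {N} lub⪯N n = by-cases (last⊎dense i<j)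
      where
      nᵢ : nf M (X i) c N
      nᵢ = n i i≤i i<j
      zeroed = least wellFounded {P = λ _ → ⊤} {x = i} tt
      o = proj₁ zeroed
      z : IsZero o
      z β β<o = proj₂ (proj₂ zeroed) β β<o tt
      Yj⪯N : Y i j ⪯ N
      Yj⪯N = subst (_⪯ N) (sym (Y-> i<j)) lub⪯N
      free : ∀ α → α < j → nf (X i) (Y i α) c N
      free α α<j = above em
        where
        above : (d : Dec (i < α)) → nf (X i) (Y′ i α d) c N
        above (yes i<α) = nf-between (X∈ i i≤i i<j) (V∈Kλ α i<α (inj₁ α<j)) (nf-⪯₀₁ nᵢ)
                            (Good.upper (good α i<α (inj₁ α<j)) i i≤i i<α) (V⪯X i<α α<j) (n α (inj₁ i<α) α<j)
        above (no _) = nf-between (X∈ i i≤i i<j) (X∈ i i≤i i<j) (nf-⪯₀₁ nᵢ) (⪯-refl (proj₁ (X∈ i i≤i i<j)))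
                         (⪯-refl (proj₁ (X∈ i i≤i i<j))) nᵢ
      by-cases : (∃[ l ] (i ≤ l × l < j × (∀ m → m < j → m ≤ l))) ⊎ Dense j → nf M lub c N
      by-cases (inj₁ (l , i≤l , l<j , last)) =
        nf-≐ (⪯⇒⊑ (⪯-lub l i≤l l<j) , V-⊑ i<j (λ m i≤m m<j _ → ⪯⇒⊑ (X-mono i≤m (last m m<j) l<j))) (n l i≤l l<j)
      by-cases (inj₂ dense) = nf-trans nᵢ
          (subst₂ (λ S T → nf S T c N) (Y-≤ (zero-≤ z i)) (Y-> i<j) (nf-≡tp (nf-Kλ₂ nᵢ) (proj₂ conclusion)))
        where
        conclusion = continuity W j (Y i) (tp c N Yj⪯N (nf-∈ nᵢ)) ((i , i<j) , dense) (sequence dense) o z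
          λ α α<j Yα⪯Yj → subst (DoesNotFork _) (sym (Y-≤ (zero-≤ z i))) (nf⇒DoesNotFork _ (nf-∈ nᵢ) (free α α<j))

    -- Local character for the chain of unions gives a base `V α`, which monotonicity enlarges to
    -- `X α`.
    nf-localCharacter : ∀ {c N} → Dense j → N ∈ Kλ → lub ⪯ N → Basic c lub N →
                        ∃[ k ] (i ≤ k × k < j × nf (X k) lub c N)
    nf-localCharacter {c} {N} dense N∈ lub⪯N basic = conclude
        (localCharacter W j (Y i) ((i , i<j) , dense) (sequence dense) N∈
          (subst (_⪯ N) (sym (Y-> i<j)) lub⪯N) (subst (λ S → Basic c S N) (sym (Y-> i<j)) basic))
      where
      conclude : ∃[ α ] (α < j × nf (Y i α) (Y i j) c N) → ∃[ k ] (i ≤ k × k < j × nf (X k) lub c N)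
      conclude (α , α<j , n) = by-cases (≤⊎> α i)
        where
        by-cases : α ≤ i ⊎ i < α → ∃[ k ] (i ≤ k × k < j × nf (X k) lub c N)
        by-cases (inj₁ α≤i) = i , i≤i , i<j , subst₂ (λ S T → nf S T c N) (Y-≤ α≤i) (Y-> i<j) n
        by-cases (inj₂ i<α) = α , inj₁ i<α , α<j
          , nf-between (X∈ α (inj₁ i<α) α<j) lub∈ (V⪯X i<α α<j) (⪯-lub α (inj₁ i<α) α<j) (⪯-refl (proj₁ lub∈))
              (subst₂ (λ S T → nf S T c N) (Y-> i<α) (Y-> i<j) n)

  -- The image of the union is the union of the chain of images. That chain lies below `Z`, so
  -- minimality puts its union below `Z`, and continuity of nonforking applies to it.
  lub-embedding : ∀ (W : WellOrder) (let open WellOrder W) i j (i<j : i < j) X increasing X∈ small →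
                  (let module C = Chain W i j i<j X increasing X∈ small) →
                  ∀ {f Z} → (∀ k → i ≤ k → k < j → IsEmbedding f (X k) Z) →
                  IsEmbedding f C.lub Z ×
                  (∀ {M c} → (∀ k → i ≤ k → k < j → nf M (image f (X k)) c Z) → nf M (image f C.lub) c Z)
  lub-embedding W i j i<j X increasing X∈ small {f} {Z} F = (image f C.lub , iso , image⪯Z) , free
    where
    open WellOrder W
    open WellOrderProperties W
    module C = Chain W i j i<j X increasing X∈ small
    iso-at : ∀ k → i ≤ k → k < j → IsIso f (X k) (image f (X k))
    iso-at k i≤k k<j = proj₁ (emb-image (F k i≤k k<j))
    image⪯ : ∀ k → i ≤ k → k < j → image f (X k) ⪯ Z
    image⪯ k i≤k k<j = proj₂ (emb-image (F k i≤k k<j))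
    increasing′ : ∀ k l → i ≤ k → k < l → l < j → image f (X k) ⪯ image f (X l)
    increasing′ k l i≤k k<l l<j = ⪯-iso (iso-at l i≤l l<j) (iso-at k i≤k (<-trans k<l l<j)) (increasing k l i≤k k<l l<j)
      where i≤l = inj₁ (≤-<-trans i≤k k<l)
    image∈ : ∀ k → i ≤ k → k < j → image f (X k) ∈ Kλ
    image∈ k i≤k k<j = Kλ-iso (iso-at k i≤k k<j) (X∈ k i≤k k<j)
    module D = Chain W i j i<j (λ k → image f (X k)) increasing′ image∈ small
    f-inj : InjectiveOn f ∣ C.lub ∣
    f-inj {x} {y} x∈ y∈ = common (C.∈-lub x∈) (C.∈-lub y∈)
      where
      common : ∃[ k ] (i ≤ k × k < j × x ∈ ∣ X k ∣) → ∃[ k ] (i ≤ k × k < j × y ∈ ∣ X k ∣) → f x ≡ f y → x ≡ y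
      common (k , i≤k , k<j , x∈k) (l , i≤l , l<j , y∈l) with ≤-total k l
      ... | inj₁ k≤l = emb-injective (F l i≤l l<j) (⪯-⊆ (C.X-mono i≤k k≤l l<j) x∈k) y∈l
      ... | inj₂ l≤k = emb-injective (F k i≤k k<j) x∈k (⪯-⊆ (C.X-mono i≤l l≤k k<j) y∈l)
    iso : IsIso f C.lub (image f C.lub)
    iso = image-iso f-inj
    D⊑ : D.lub ⊑ image f C.lub
    D⊑ = D.V-⊑ i<j λ k i≤k k<j _ → iso-⊑ (iso-at k i≤k k<j) iso (⪯⇒⊑ (C.⪯-lub k i≤k k<j))
    ⊑D : image f C.lub ⊑ D.lub
    ⊑D = ⊆⇒⊑ ⊑-refl D⊑ λ (x , x∈ , e) → let (k , i≤k , k<j , x∈k) = C.∈-lub x∈ in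
           ⪯-⊆ (D.⪯-lub k i≤k k<j) (x , x∈k , e)
    image⪯D : image f C.lub ⪯ D.lub
    image⪯D = ≐ₘ⇒⪯ (K-iso iso (proj₁ C.lub∈)) (⊑D , D⊑)
    D⪯Z : D.lub ⪯ Z
    D⪯Z = D.lub-⪯ image⪯
    image⪯Z : image f C.lub ⪯ Z
    image⪯Z = ⪯-trans image⪯D D⪯Z
    free : ∀ {M c} → (∀ k → i ≤ k → k < j → nf M (image f (X k)) c Z) → nf M (image f C.lub) c Z
    free n = nf-≐ (D⊑ , ⊑D) (D.nf-lub D⪯Z n)

-- Systems of models over which the `b k` are free.

module Systems (cl : Classical) (τ : Vocabulary) (𝕌 : Points) (Λ : Set) (infinite : ¬ Finite (setoid Λ))
               (𝔰 : Models.GoodFrameMinusStability τ 𝕌 Λ)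
               (W : WellOrder) (δ : WellOrder.Carrier W) (M : Models.Structure τ 𝕌)
               (b : WellOrder.Carrier W → Points.Point 𝕌) where
  open Chains cl τ 𝕌 Λ infinite 𝔰 public
  open WellOrder W
  open WellOrderProperties W

  -- An independent sequence without continuity: at a limit index `N l` may contain more than the
  -- union of the earlier models, and this is the room in which new points are placed. `N*` is a
  -- common extension.
  record System : Set₂ where
    field
      N N⁺ : Carrier → Structure
      N*   : Structure
      N*∈  : N* ∈ Kλ
      free : ∀ k → k < δ → nf M (N k) (b k) (N⁺ k)
      next : ∀ k l → k < l → l < δ → N⁺ k ⪯ N l
      top  : ∀ k → k < δ → N⁺ k ⪯ N*

  module SystemProperties (s : System) where
    open System s public

    N∈ : ∀ k → k < δ → N k ∈ Kλ
    N∈ k k<δ = nf-Kλ₁ (free k k<δ)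

    N⁺∈ : ∀ k → k < δ → N⁺ k ∈ Kλ
    N⁺∈ k k<δ = nf-Kλ₂ (free k k<δ)

    N⪯N⁺ : ∀ k → k < δ → N k ⪯ N⁺ k
    N⪯N⁺ k k<δ = nf-⪯₁ (free k k<δ)

    M⪯N : ∀ k → k < δ → M ⪯ N k
    M⪯N k k<δ = nf-⪯₀₁ (free k k<δ)

    N⪯N* : ∀ k → k < δ → N k ⪯ N*
    N⪯N* k k<δ = ⪯-trans (N⪯N⁺ k k<δ) (top k k<δ)

    b∈N⁺ : ∀ k → k < δ → b k ∈ ∣ N⁺ k ∣
    b∈N⁺ k k<δ = nf-∈ (free k k<δ)

    N-mono : ∀ {k l} → k ≤ l → l < δ → N k ⪯ N l
    N-mono (inj₁ k<l) l<δ = ⪯-trans (N⪯N⁺ _ (<-trans k<l l<δ)) (next _ _ k<l l<δ)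
    N-mono (inj₂ refl) l<δ = ⪯-refl (proj₁ (N∈ _ l<δ))

    N⁺-increasing : ∀ k l → k < l → l < δ → N⁺ k ⪯ N⁺ l
    N⁺-increasing k l k<l l<δ = ⪯-trans (next k l k<l l<δ) (N⪯N⁺ l l<δ)

    N⪯N⁺′ : ∀ {k l} → k ≤ l → l < δ → N k ⪯ N⁺ l
    N⪯N⁺′ k≤l l<δ = ⪯-trans (N-mono k≤l l<δ) (N⪯N⁺ _ l<δ)

  record _⊴_ (s t : System) : Set₂ where
    private
      module S = System s
      module T = System t
    field
      N⪯  : ∀ k → k < δ → S.N k ⪯ T.N k
      N⁺⪯ : ∀ k → k < δ → S.N⁺ k ⪯ T.N⁺ k
      N*⪯ : S.N* ⪯ T.N*

  ⊴-refl : ∀ s → s ⊴ s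
  ⊴-refl s = record
    { N⪯  = λ k k<δ → ⪯-refl (proj₁ (N∈ k k<δ))
    ; N⁺⪯ = λ k k<δ → ⪯-refl (proj₁ (N⁺∈ k k<δ))
    ; N*⪯ = ⪯-refl (proj₁ N*∈) }
    where open SystemProperties s

  ⊴-trans : ∀ {s t u} → s ⊴ t → t ⊴ u → s ⊴ u
  ⊴-trans p q = record
    { N⪯  = λ k k<δ → ⪯-trans (P.N⪯ k k<δ) (Q.N⪯ k k<δ)
    ; N⁺⪯ = λ k k<δ → ⪯-trans (P.N⁺⪯ k k<δ) (Q.N⁺⪯ k k<δ)
    ; N*⪯ = ⪯-trans P.N*⪯ Q.N*⪯ }
    where
    module P = _⊴_ p
    module Q = _⊴_ q

  -- Enlarging a system so that its i-th model contains c.  The enlarged models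
  -- Q k ⪯ E k are built by recursion along a growing embedding g of N*; at stage
  -- k only the values of g on N⁺ k are final.
  module Absorb (s : System) (small : Small (_< δ)) (i : Carrier) (i<δ : i < δ) (c : Point) (B : Structure)
                (N⁺⪯B : ∀ k → k < δ → System.N⁺ s k ⪯ B) (c-free : nf (System.N s i) B c (System.N* s)) where
    open SystemProperties s

    B∈ : B ∈ Kλ
    B∈ = nf-Kλ₁ c-free

    M⪯Ni : M ⪯ N i
    M⪯Ni = M⪯N i i<δ

    -- Once `g` is undone, `Q` and `E` become the new `N j` and `N⁺ j`. Fixing `N i` pointwise
    -- preserves both `M` and the base over which `c` is free.
    record Stage (j : Carrier) (Q E : Structure) (g : Map) : Set₂ where
      field
        emb    : IsEmbedding g N* E
        c∈     : c ∈ ∣ Q ∣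
        fixes  : g c ≡ c
        base   : IdentityOn (N i) g
        covers : ∀ {x} → x ∈ ∣ N j ∣ → g x ∈ ∣ Q ∣
        b-free : nf M Q (g (b j)) E

    State : Set₂
    State = Structure × Structure × Map

    Coherent : Carrier → State → Structure → Map → Set₂
    Coherent k (_ , E′ , g′) Q g = E′ ⪯ Q × g ≗[ N⁺ k ] g′

    Ext : ∀ j → (∀ k → k < j → State) → State → Set₂
    Ext j h (Q , E , g) = i ≤ j → j < δ → Stage j Q E g × (∀ k (p : k < j) → i ≤ k → Coherent k (h k p) Q g)

    -- The stages before `j` are joined. For `j` below `δ` this prepares stage `j`; for `j` equal to
    -- `δ` it joins the finished construction.
    module Below (j : Carrier) (i<j : i < j) (j≤δ : j ≤ δ) (st : Carrier → State)
                 (ext : ∀ k → k < j → Ext k (λ l _ → st l) (st k)) where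

      Qₛ Eₛ : Carrier → Structure
      Qₛ k = proj₁ (st k)
      Eₛ k = proj₁ (proj₂ (st k))
      gₛ : Carrier → Map
      gₛ k = proj₂ (proj₂ (st k))

      <δ : ∀ {k} → k < j → k < δ
      <δ k<j = <-≤-trans k<j j≤δ

      stage : ∀ k → i ≤ k → k < j → Stage k (Qₛ k) (Eₛ k) (gₛ k)
      stage k i≤k k<j = proj₁ (ext k k<j i≤k (<δ k<j))

      E∈ : ∀ k → i ≤ k → k < j → Eₛ k ∈ Kλ
      E∈ k i≤k k<j = nf-Kλ₂ (Stage.b-free (stage k i≤k k<j))

      E⪯Q : ∀ k l → i ≤ k → k < l → l < j → Eₛ k ⪯ Qₛ l
      E⪯Q k l i≤k k<l l<j = proj₁ (proj₂ (ext l l<j (inj₁ (≤-<-trans i≤k k<l)) (<δ l<j)) k k<l i≤k)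

      g-coherent : ∀ k l → i ≤ k → k < l → l < j → gₛ l ≗[ N⁺ k ] gₛ k
      g-coherent k l i≤k k<l l<j = proj₂ (proj₂ (ext l l<j (inj₁ (≤-<-trans i≤k k<l)) (<δ l<j)) k k<l i≤k)

      small′ : Small (_< j)
      small′ = ≲-trans (⊆⇒≲ <δ) small

      E-increasing : ∀ k l → i ≤ k → k < l → l < j → Eₛ k ⪯ Eₛ l
      E-increasing k l i≤k k<l l<j = ⪯-trans (E⪯Q k l i≤k k<l l<j) (nf-⪯₁ (Stage.b-free (stage l (inj₁ (≤-<-trans i≤k k<l)) l<j)))

      module CE = Chain W i j i<j Eₛ E-increasing E∈ small′
      module CN = Chain W i j i<j N⁺ (λ k l _ k<l l<j → N⁺-increasing k l k<l (<δ l<j)) (λ k _ k<j → N⁺∈ k (<δ k<j)) small′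

      i≤i : i ≤ i
      i≤i = inj₂ refl

      Index : Point → Set₁
      Index x = ∃[ k ] (i ≤ k × k < j × x ∈ ∣ N⁺ k ∣)

      f′ : ∀ x → Dec (Index x) → Point
      f′ x (yes (k , _)) = gₛ k x
      f′ x (no _)        = x

      f : Map
      f x = f′ x em

      f≗g : ∀ k → i ≤ k → k < j → f ≗[ N⁺ k ] gₛ k
      f≗g k i≤k k<j {x} x∈ = by-cases em
        where
        compare′ : ∀ l → i ≤ l → l < j → x ∈ ∣ N⁺ l ∣ → gₛ l x ≡ gₛ k x
        compare′ l i≤l l<j x∈l with compare l k
        ... | tri< l<k _ _  = sym (g-coherent l k i≤l l<k k<j x∈l)
        ... | tri≈ _ refl _ = refl
        ... | tri> _ _ k<l  = g-coherent k l i≤k k<l l<j x∈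
        by-cases : (d : Dec (Index x)) → f′ x d ≡ gₛ k x
        by-cases (yes (l , i≤l , l<j , x∈l)) = compare′ l i≤l l<j x∈l
        by-cases (no ¬ix) = contradiction (k , i≤k , k<j , x∈) ¬ix

      gE : ∀ k → i ≤ k → k < j → IsEmbedding (gₛ k) N* CE.lub
      gE k i≤k k<j = emb-⪯ (Stage.emb (stage k i≤k k<j)) (CE.⪯-lub k i≤k k<j)

      f-emb : ∀ k → i ≤ k → k < j → IsEmbedding f (N⁺ k) CE.lub
      f-emb k i≤k k<j = emb-cong (λ x∈ → sym (f≗g k i≤k k<j x∈)) (emb-restrict (top k (<δ k<j)) (gE k i≤k k<j))

      F = lub-embedding W i j i<j N⁺ (λ k l _ k<l l<j → N⁺-increasing k l k<l (<δ l<j)) (λ k _ k<j → N⁺∈ k (<δ k<j))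
            small′ f-emb

      V = CN.lub

      V⪯N* : V ⪯ N*
      V⪯N* = CN.lub-⪯ λ k _ k<j → top k (<δ k<j)

      Ni⪯V : N i ⪯ V
      Ni⪯V = ⪯-trans (N⪯N⁺ i i<δ) (CN.⪯-lub i i≤i i<j)

      f-V : IsIso f V (image f V)
      f-V = proj₁ (emb-image (proj₁ F))

      f-base : IdentityOn (N i) f
      f-base x∈ = trans (f≗g i i≤i i<j (⪯-⊆ (N⪯N⁺ i i<δ) x∈)) (Stage.base (stage i i≤i i<j) x∈)

      -- Each `gₛ k` fixes `c` and carries its freedom from `N⁺ k`, which is part of `B`, to the
      -- image; continuity along the images yields the union.
      c-free-A : nf (N i) (image f V) c CE.lub
      c-free-A = proj₂ F λ k i≤k k<j → subst (λ z → nf (N i) (image f (N⁺ k)) z CE.lub) (Stage.fixes (stage k i≤k k<j))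
        (nf-embed CE.lub∈ (iso-identity (Stage.base (stage k i≤k k<j)))
          (iso-cong (f≗g k i≤k k<j) (proj₁ (emb-image (f-emb k i≤k k<j)))) (gE k i≤k k<j)
          (nf-between (N∈ i i<δ) (N⁺∈ k (<δ k<j)) (⪯-refl (proj₁ (N∈ i i<δ))) (N⪯N⁺′ i≤k (<δ k<j)) (N⁺⪯B k (<δ k<j)) c-free))

      Amalgam : Set₂
      Amalgam = ∃[ A ] ∃[ g ] (A ∈ Kλ × IsEmbedding g N* A × g c ≡ c × IdentityOn (N i) g
                               × (∀ k → i ≤ k → k < j → Eₛ k ⪯ A × g ≗[ N⁺ k ] gₛ k))

      -- The maps agree to a map `f` on the union `V` of the `N⁺ k`. An extension of `f` to `N*`
      -- might send `c` anywhere. But its image there and `c` in the union of the `Eₛ k` are both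
      -- free from `image f V` over `N i` and have the same type over `N i`, so uniqueness lets an
      -- amalgam identify them.
      amalgam : Amalgam
      amalgam = from-renamed (rename N*∈ CN.lub∈ V⪯N* f-V)
        where
        from-renamed : ∃[ N′ ] ∃[ h ] (N′ ∈ Kλ × IsIso h N* N′ × image f V ⪯ N′ × h ≗[ V ] f) → Amalgam
        from-renamed (N′ , h , N′∈ , h-iso , fV⪯N′ , h≗f) = from-same (nf-unique c-free-N′ c-free-A same)
          where
          h-base : IdentityOn (N i) h
          h-base x∈ = trans (h≗f (⪯-⊆ Ni⪯V x∈)) (f-base x∈)
          c∈N* : c ∈ ∣ N* ∣
          c∈N* = nf-∈ c-free
          c-free-N′ : nf (N i) (image f V) (h c) N′
          c-free-N′ = nf-iso h-iso (iso-identity h-base) (iso-cong (λ x∈ → sym (h≗f x∈)) f-V)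
            (nf-between (N∈ i i<δ) CN.lub∈ (⪯-refl (proj₁ (N∈ i i<δ))) Ni⪯V
              (CN.lub-⪯ λ k _ k<j → N⁺⪯B k (<δ k<j)) c-free)
          h⁻h : ∀ {x} → x ∈ ∣ N* ∣ → preimage h N* (h x) ≡ x
          h⁻h = preimage-cancel {h} {N*} (IsIso.inj h-iso)
          gᵢ = gₛ i
          stageᵢ = stage i i≤i i<j
          -- Both points are images of the one `c` in `N*`, under embeddings that fix `N i`.
          same : SameType (N i) (h c) N′ c CE.lub
          same = CE.lub , gᵢ ∘ preimage h N* , CE.lub∈ , ⪯-refl (proj₁ CE.lub∈)
               , emb-trans (emb-iso (iso-sym h-iso) (proj₁ N*∈)) (gE i i≤i i<j)
               , (λ {x} x∈ → trans (cong gᵢ (trans (cong (preimage h N*) (sym (h-base x∈))) (h⁻h (⪯-⊆ (N⪯N* i i<δ) x∈))))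
                               (Stage.base stageᵢ x∈))
               , trans (cong gᵢ (h⁻h c∈N*)) (Stage.fixes stageᵢ)
          from-same : SameType (image f V) (h c) N′ c CE.lub → Amalgam
          from-same (A , f₂ , A∈ , lub⪯A , F₂ , f₂-id , f₂-c) =
            A , f₂ ∘ h , A∈ , emb-trans (emb-iso h-iso (proj₁ N′∈)) F₂ , f₂-c
            , (λ x∈ → trans (agree i i≤i i<j (⪯-⊆ (N⪯N⁺ i i<δ) x∈)) (Stage.base stageᵢ x∈))
            , λ k i≤k k<j → ⪯-trans (CE.⪯-lub k i≤k k<j) lub⪯A , agree k i≤k k<j
            where
            agree : ∀ k → i ≤ k → k < j → (f₂ ∘ h) ≗[ N⁺ k ] gₛ k
            agree k i≤k k<j {x} x∈ =
              let x∈V = ⪯-⊆ (CN.⪯-lub k i≤k k<j) x∈ in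
              trans (cong f₂ (h≗f x∈V)) (trans (f₂-id (x , x∈V , refl)) (f≗g k i≤k k<j x∈))

    module Next (j : Carrier) (i≤j : i ≤ j) (j<δ : j < δ) {A : Structure} {g : Map} (A∈ : A ∈ Kλ)
                (G : IsEmbedding g N* A) (g-c : g c ≡ c) (g-base : IdentityOn (N i) g) where

      Nj⪯B : N j ⪯ B
      Nj⪯B = ⪯-trans (N⪯N⁺ j j<δ) (N⁺⪯B j j<δ)

      b-free* : nf M (N j) (b j) N*
      b-free* = nf-expand N*∈ (top j j<δ) (free j j<δ)

      Result : Set₂
      Result = ∃[ Q ] ∃[ E ] ∃[ g′ ] (A ⪯ Q × Stage j Q E g′ × g′ ≗[ N j ] g)

      -- By symmetry between `b j` in `B` and `c`, some `M₂` contains `c` and `N j` while `b j` is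
      -- free over it. This is amalgamated with `A` over `N*`. Then `b j` is moved by nonforking
      -- extension until it is free over the whole amalgam; the embedding that moves it fixes the
      -- copy of `M₂`, hence `c` and the values of `g` on `N j`.
      result : Result
      result = from-symmetry (symmetry (N∈ j j<δ) B∈ N*∈ Nj⪯B (nf-⪯₁ c-free) (⪯-⊆ (N⁺⪯B j j<δ) (b∈N⁺ j j<δ)) (nf-basic₁ b-free*)
          (nf-between (N∈ j j<δ) B∈ (N-mono i≤j j<δ) Nj⪯B (⪯-refl (proj₁ B∈)) c-free))
        where
        from-symmetry : ∃[ M₂ ] ∃[ M₃ ] (M₂ ∈ Kλ × M₃ ∈ Kλ × c ∈ ∣ M₂ ∣ × N j ⪯ M₂ × M₂ ⪯ M₃ × N* ⪯ M₃
                                         × nf (N j) M₂ (b j) M₃) → Result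
        from-symmetry (M₂ , M₃ , M₂∈ , M₃∈ , c∈M₂ , Nj⪯M₂ , M₂⪯M₃ , N*⪯M₃ , n) =
          from-amalgam (amalgamate N*∈ M₃∈ A∈ N*⪯M₃ G)
          where
          from-amalgam : ∃[ P ] ∃[ h ] (P ∈ Kλ × A ⪯ P × IsEmbedding h M₃ P × h ≗[ N* ] g) → Result
          from-amalgam (P , h , P∈ , A⪯P , H , h≗g) = from-extension (nf-extension n′ P∈ hM₂⪯P)
            where
            h-M₂ : IsIso h M₂ (image h M₂)
            h-M₂ = proj₁ (emb-image (emb-restrict M₂⪯M₃ H))
            hM₂⪯P : image h M₂ ⪯ P
            hM₂⪯P = proj₂ (emb-image (emb-restrict M₂⪯M₃ H))
            h-Nj : IsIso h (N j) (image h (N j))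
            h-Nj = iso-restrict h-M₂ (⪯-⊆ Nj⪯M₂)
            n′ : nf (image h (N j)) (image h M₂) (h (b j)) P
            n′ = nf-embed P∈ h-Nj h-M₂ H n
            h-c : h c ≡ c
            h-c = trans (h≗g (nf-∈ c-free)) g-c
            from-extension : ∃[ E ] ∃[ e ] (E ∈ Kλ × P ⪯ E × IsEmbedding e P E × IdentityOn (image h M₂) e
                                            × nf (image h (N j)) P (e (h (b j))) E) → Result
            -- The new model is all of `P`, so that it contains `A` and thereby the earlier stages.
            from-extension (E , e , E∈ , P⪯E , e-emb , e-id , nE) = P , E , e ∘ h , A⪯P , record
                { emb    = g′-emb
                ; c∈     = subst (_∈ ∣ P ∣) h-c (emb-maps H (⪯-⊆ M₂⪯M₃ c∈M₂))
                ; fixes  = trans (e-id (c , c∈M₂ , refl)) h-c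
                ; base   = g′-base
                ; covers = λ {x} x∈ → subst (_∈ ∣ P ∣) (sym (g′≗h x∈)) (emb-maps H (⪯-⊆ (⪯-trans Nj⪯M₂ M₂⪯M₃) x∈))
                -- Freedom over `P` is obtained with base the copy of `N j`; transitivity with the
                -- old freedom of `b j` over `N j` lowers the base to `M`.
                ; b-free = nf-trans (nf-embed E∈ (iso-identity λ x∈ → g′-base (⪯-⊆ M⪯Ni x∈))
                                                 (iso-cong (λ x∈ → sym (g′≗h x∈)) h-Nj) g′-emb b-free*) nE }
              , g′≗g
              where
              g′≗h : (e ∘ h) ≗[ N j ] h
              g′≗h {x} x∈ = e-id (x , ⪯-⊆ Nj⪯M₂ x∈ , refl)
              g′≗g : (e ∘ h) ≗[ N j ] g
              g′≗g x∈ = trans (g′≗h x∈) (h≗g (⪯-⊆ (N⪯N* j j<δ) x∈))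
              g′-base : IdentityOn (N i) (e ∘ h)
              g′-base x∈ = trans (g′≗g (⪯-⊆ (N-mono i≤j j<δ) x∈)) (g-base x∈)
              g′-emb : IsEmbedding (e ∘ h) N* E
              g′-emb = emb-trans (emb-restrict N*⪯M₃ H) e-emb

    default : State
    default = N* , N* , (λ x → x)

    step : ∀ j (st : Carrier → State) → (∀ k → k < j → Ext k (λ l _ → st l) (st k)) → ∃[ x ] Ext j (λ l _ → st l) x
    step j st ext = by-cases (≤⊎> δ j) (compare i j)
      where
      by-cases : δ ≤ j ⊎ j < δ → _ → ∃[ x ] Ext j (λ l _ → st l) x
      by-cases (inj₁ δ≤j) _ = default , λ _ j<δ → contradiction j<δ (≤⇒≯ δ≤j)
      by-cases (inj₂ j<δ) (tri> _ _ j<i) = default , λ i≤j _ → contradiction j<i (≤⇒≯ i≤j)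
      -- The construction starts at `i` from the identity of `N*`.
      by-cases (inj₂ j<δ) (tri≈ _ refl _) =
        let (Q , E , g′ , _ , S , _) = Next.result i (inj₂ refl) i<δ N*∈ (emb-incl (⪯-refl (proj₁ N*∈))) refl (λ _ → refl)
        in (Q , E , g′) , λ _ _ → S , λ k k<i i≤k → contradiction k<i (≤⇒≯ i≤k)
      by-cases (inj₂ j<δ) (tri< i<j _ _) =
        let (A , g , A∈ , G , g-c , g-base , above) = Below.amalgam j i<j (inj₁ j<δ) st ext
            (Q , E , g′ , A⪯Q , S , g′≗g) = Next.result j (inj₁ i<j) j<δ A∈ G g-c g-base
        in (Q , E , g′) , λ _ _ → S , λ k k<j i≤k →
             ⪯-trans (proj₁ (above k i≤k k<j)) A⪯Q
           , λ x∈ → trans (g′≗g (⪯-⊆ (next k j k<j j<δ) x∈)) (proj₂ (above k i≤k k<j) x∈)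

    stages : ∃[ st ] (∀ j → Ext j (λ l _ → st l) (st j))
    stages = Recursion.recursion wellFounded default Ext step

    Absorbed : Set₂
    Absorbed = ∃[ t ] (s ⊴ t × c ∈ ∣ System.N t i ∣)

    module Final = Below δ i<δ (inj₂ refl) (proj₁ stages) (λ k _ → proj₂ stages k)

    -- Renaming the final amalgam by `h` turns `g` into an inclusion of `N*`. Since `g` agrees with
    -- `gₛ k` on `N⁺ k`, the map `h` undoes every `gₛ k` there: the renamed stages extend the old
    -- models, and every `b k` and `c` return to their places.
    absorb : Absorbed
    absorb = from-amalgam Final.amalgam
      where
      open Final
      from-amalgam : Final.Amalgam → Absorbed
      from-amalgam (A , g , A∈ , G , g-c , g-base , above) = from-pullback (pullback N*∈ A∈ G)
        where
        from-pullback : ∃[ N′ ] ∃[ h ] (N′ ∈ Kλ × IsIso h A N′ × N* ⪯ N′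
                                        × (∀ {x} → x ∈ ∣ N* ∣ → h (g x) ≡ x)) → Absorbed
        from-pullback (N*′ , h , N*′∈ , h-iso , N*⪯N*′ , hg) = t , s⊴t , c∈t (≤⊎> i i)
          where
          -- Models with index below `i` are kept; `next′` joins them to the rebuilt ones.
          sel : Structure → Structure → ∀ k → i ≤ k ⊎ k < i → Structure
          sel S T k (inj₁ _) = image h S
          sel S T k (inj₂ _) = T
          N′ N⁺′ : Carrier → Structure
          N′ k  = sel (Qₛ k) (N k) k (≤⊎> i k)
          N⁺′ k = sel (Eₛ k) (N⁺ k) k (≤⊎> i k)

          E⪯A : ∀ k → i ≤ k → k < δ → Eₛ k ⪯ A
          E⪯A k i≤k k<δ = proj₁ (above k i≤k k<δ)
          Q⪯E : ∀ k → i ≤ k → k < δ → Qₛ k ⪯ Eₛ k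
          Q⪯E k i≤k k<δ = nf-⪯₁ (Stage.b-free (stage k i≤k k<δ))
          h-E : ∀ k → i ≤ k → k < δ → IsIso h (Eₛ k) (image h (Eₛ k))
          h-E k i≤k k<δ = proj₁ (⪯-image h-iso (E⪯A k i≤k k<δ))
          hE⪯N*′ : ∀ k → i ≤ k → k < δ → image h (Eₛ k) ⪯ N*′
          hE⪯N*′ k i≤k k<δ = proj₂ (⪯-image h-iso (E⪯A k i≤k k<δ))
          h-Q : ∀ k → i ≤ k → k < δ → IsIso h (Qₛ k) (image h (Qₛ k))
          h-Q k i≤k k<δ = proj₁ (⪯-image h-iso (⪯-trans (Q⪯E k i≤k k<δ) (E⪯A k i≤k k<δ)))
          hQ⪯N*′ : ∀ k → i ≤ k → k < δ → image h (Qₛ k) ⪯ N*′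
          hQ⪯N*′ k i≤k k<δ = proj₂ (⪯-image h-iso (⪯-trans (Q⪯E k i≤k k<δ) (E⪯A k i≤k k<δ)))

          hgₛ : ∀ k → i ≤ k → k < δ → ∀ {x} → x ∈ ∣ N⁺ k ∣ → h (gₛ k x) ≡ x
          hgₛ k i≤k k<δ x∈ = trans (cong h (sym (proj₂ (above k i≤k k<δ) x∈))) (hg (⪯-⊆ (top k k<δ) x∈))

          h-M : IsIso h M M
          h-M = iso-identity λ {x} x∈ → let x∈Ni = ⪯-⊆ M⪯Ni x∈ in
            trans (cong h (sym (g-base x∈Ni))) (hg (⪯-⊆ (N⪯N* i i<δ) x∈Ni))

          N⪯hQ : ∀ k → i ≤ k → k < δ → N k ⪯ image h (Qₛ k)
          N⪯hQ k i≤k k<δ = ⪯-coherent (⪯-trans (N⪯N* k k<δ) N*⪯N*′) (hQ⪯N*′ k i≤k k<δ)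
            λ {x} x∈ → gₛ k x , Stage.covers (stage k i≤k k<δ) x∈ , hgₛ k i≤k k<δ (⪯-⊆ (N⪯N⁺ k k<δ) x∈)

          N⁺⪯hE : ∀ k → i ≤ k → k < δ → N⁺ k ⪯ image h (Eₛ k)
          N⁺⪯hE k i≤k k<δ = ⪯-coherent (⪯-trans (top k k<δ) N*⪯N*′) (hE⪯N*′ k i≤k k<δ)
            λ {x} x∈ → gₛ k x , emb-maps (Stage.emb (stage k i≤k k<δ)) (⪯-⊆ (top k k<δ) x∈) , hgₛ k i≤k k<δ x∈

          free′ : ∀ k → k < δ → ∀ d → nf M (sel (Qₛ k) (N k) k d) (b k) (sel (Eₛ k) (N⁺ k) k d)
          free′ k k<δ (inj₁ i≤k) = subst (λ z → nf M (image h (Qₛ k)) z (image h (Eₛ k))) (hgₛ k i≤k k<δ (b∈N⁺ k k<δ))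
            (nf-iso (h-E k i≤k k<δ) h-M (h-Q k i≤k k<δ) (Stage.b-free (stage k i≤k k<δ)))
          free′ k k<δ (inj₂ k<i) = free k k<δ

          next′ : ∀ k l → k < l → l < δ → ∀ d e → sel (Eₛ k) (N⁺ k) k d ⪯ sel (Qₛ l) (N l) l e
          next′ k l k<l l<δ (inj₁ i≤k) (inj₁ i≤l) = ⪯-iso (h-Q l i≤l l<δ) (h-E k i≤k (<-trans k<l l<δ)) (E⪯Q k l i≤k k<l l<δ)
          next′ k l k<l l<δ (inj₁ i≤k) (inj₂ l<i) = contradiction (<-trans k<l l<i) (≤⇒≯ i≤k)
          next′ k l k<l l<δ (inj₂ k<i) (inj₁ i≤l) = ⪯-trans (next k l k<l l<δ) (N⪯hQ l i≤l l<δ)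
          next′ k l k<l l<δ (inj₂ k<i) (inj₂ l<i) = next k l k<l l<δ

          top′ : ∀ k → k < δ → ∀ d → sel (Eₛ k) (N⁺ k) k d ⪯ N*′
          top′ k k<δ (inj₁ i≤k) = hE⪯N*′ k i≤k k<δ
          top′ k k<δ (inj₂ k<i) = ⪯-trans (top k k<δ) N*⪯N*′

          t : System
          t = record
            { N = N′ ; N⁺ = N⁺′ ; N* = N*′ ; N*∈ = N*′∈
            ; free = λ k k<δ → free′ k k<δ (≤⊎> i k)
            ; next = λ k l k<l l<δ → next′ k l k<l l<δ (≤⊎> i k) (≤⊎> i l)
            ; top  = λ k k<δ → top′ k k<δ (≤⊎> i k) }

          N⪯′ : ∀ k → k < δ → ∀ d → N k ⪯ sel (Qₛ k) (N k) k d
          N⪯′ k k<δ (inj₁ i≤k) = N⪯hQ k i≤k k<δ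
          N⪯′ k k<δ (inj₂ _)   = ⪯-refl (proj₁ (N∈ k k<δ))

          N⁺⪯′ : ∀ k → k < δ → ∀ d → N⁺ k ⪯ sel (Eₛ k) (N⁺ k) k d
          N⁺⪯′ k k<δ (inj₁ i≤k) = N⁺⪯hE k i≤k k<δ
          N⁺⪯′ k k<δ (inj₂ _)   = ⪯-refl (proj₁ (N⁺∈ k k<δ))

          s⊴t : s ⊴ t
          s⊴t = record
            { N⪯  = λ k k<δ → N⪯′ k k<δ (≤⊎> i k)
            ; N⁺⪯ = λ k k<δ → N⁺⪯′ k k<δ (≤⊎> i k)
            ; N*⪯ = N*⪯N*′ }

          c∈t : ∀ d → c ∈ ∣ sel (Qₛ i) (N i) i d ∣
          c∈t (inj₁ _) = c , Stage.c∈ (stage i (inj₂ refl) i<δ) , trans (cong h (sym g-c)) (hg (nf-∈ c-free))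
          c∈t (inj₂ i<i) = contradiction i<i <-irreflexive

-- Saturating a system until it covers its top model.

module Completion (cl : Classical) (τ : Vocabulary) (𝕌 : Points) (Λ : Set) (infinite : ¬ Finite (setoid Λ))
               (𝔰 : Models.GoodFrameMinusStability τ 𝕌 Λ)
               (W : WellOrder) (δ : WellOrder.Carrier W) (M : Models.Structure τ 𝕌)
               (b : WellOrder.Carrier W → Points.Point 𝕌) where
  open Systems cl τ 𝕌 Λ infinite 𝔰 W δ M b public
  open WellOrder W
  open WellOrderProperties W

  Covers : System → Pred Point 1ℓ
  Covers s x = ∃[ k ] (k < δ × x ∈ ∣ System.N⁺ s k ∣)

  covers-mono : ∀ {s t} → s ⊴ t → Covers s ⊆ Covers t
  covers-mono s⊴t (k , k<δ , x∈) = k , k<δ , ⪯-⊆ (_⊴_.N⁺⪯ s⊴t k k<δ) x∈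

  module Supremum (W₂ : WellOrder) (z j : WellOrder.Carrier W₂) (z-zero : WellOrder.IsZero W₂ z) (z<j : WellOrder._<_ W₂ z j)
                  (t : WellOrder.Carrier W₂ → System)
                  (chain : ∀ k l → WellOrder._<_ W₂ k l → WellOrder._<_ W₂ l j → t k ⊴ t l)
                  (small : Small (λ k → WellOrder._<_ W₂ k j)) where
    module W₂ = WellOrder W₂
    open WellOrderProperties W₂ using () renaming (zero-≤ to zero-≤₂)

    z≤ : ∀ α → z W₂.≤ α
    z≤ = zero-≤₂ z-zero

    module T α = SystemProperties (t α)

    module CN k (k<δ : k < δ) = Chain W₂ z j z<j (λ α → T.N α k)
      (λ α β _ α<β β<j → _⊴_.N⪯ (chain α β α<β β<j) k k<δ) (λ α _ _ → T.N∈ α k k<δ) small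
    module CN⁺ k (k<δ : k < δ) = Chain W₂ z j z<j (λ α → T.N⁺ α k)
      (λ α β _ α<β β<j → _⊴_.N⁺⪯ (chain α β α<β β<j) k k<δ) (λ α _ _ → T.N⁺∈ α k k<δ) small
    module CN* = Chain W₂ z j z<j T.N*
      (λ α β _ α<β β<j → _⊴_.N*⪯ (chain α β α<β β<j)) (λ α _ _ → T.N*∈ α) small

    N′ N⁺′ : ∀ k → δ ≤ k ⊎ k < δ → Structure
    N′ k (inj₁ _)    = CN*.lub
    N′ k (inj₂ k<δ)  = CN.lub k k<δ
    N⁺′ k (inj₁ _)   = CN*.lub
    N⁺′ k (inj₂ k<δ) = CN⁺.lub k k<δ

    -- Continuity of nonforking, here along the chain of systems with `k` fixed, keeps `b k` free
    -- over the union of the `k`-th models.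
    free′ : ∀ k → k < δ → ∀ d → nf M (N′ k d) (b k) (N⁺′ k d)
    free′ k k<δ (inj₁ δ≤k) = contradiction k<δ (≤⇒≯ δ≤k)
    free′ k k<δ (inj₂ p) = CN.nf-lub k p
      (CN.lub-⪯ k p λ α z≤α α<j → ⪯-trans (T.N⪯N⁺ α k p) (CN⁺.⪯-lub k p α z≤α α<j))
      λ α z≤α α<j → nf-expand (CN⁺.lub∈ k p) (CN⁺.⪯-lub k p α z≤α α<j) (T.free α k p)

    next′ : ∀ k l → k < l → l < δ → ∀ d e → N⁺′ k d ⪯ N′ l e
    next′ k l k<l l<δ (inj₁ δ≤k) _ = contradiction (<-trans k<l l<δ) (≤⇒≯ δ≤k)
    next′ k l k<l l<δ _ (inj₁ δ≤l) = contradiction l<δ (≤⇒≯ δ≤l)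
    next′ k l k<l l<δ (inj₂ p) (inj₂ q) = CN⁺.lub-⪯ k p λ α z≤α α<j → ⪯-trans (T.next α k l k<l q) (CN.⪯-lub l q α z≤α α<j)

    top′ : ∀ k → k < δ → ∀ d → N⁺′ k d ⪯ CN*.lub
    top′ k k<δ (inj₁ δ≤k) = contradiction k<δ (≤⇒≯ δ≤k)
    top′ k k<δ (inj₂ p) = CN⁺.lub-⪯ k p λ α z≤α α<j → ⪯-trans (T.top α k p) (CN*.⪯-lub α z≤α α<j)

    N⪯′ : ∀ α → α W₂.< j → ∀ k → k < δ → ∀ d → T.N α k ⪯ N′ k d
    N⪯′ α α<j k k<δ (inj₁ δ≤k) = contradiction k<δ (≤⇒≯ δ≤k)
    N⪯′ α α<j k k<δ (inj₂ p) = CN.⪯-lub k p α (z≤ α) α<j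

    N⁺⪯′ : ∀ α → α W₂.< j → ∀ k → k < δ → ∀ d → T.N⁺ α k ⪯ N⁺′ k d
    N⁺⪯′ α α<j k k<δ (inj₁ δ≤k) = contradiction k<δ (≤⇒≯ δ≤k)
    N⁺⪯′ α α<j k k<δ (inj₂ p) = CN⁺.⪯-lub k p α (z≤ α) α<j

    supremum : System
    supremum = record
      { N = λ k → N′ k (≤⊎> δ k) ; N⁺ = λ k → N⁺′ k (≤⊎> δ k) ; N* = CN*.lub ; N*∈ = CN*.lub∈
      ; free = λ k k<δ → free′ k k<δ (≤⊎> δ k)
      ; next = λ k l k<l l<δ → next′ k l k<l l<δ (≤⊎> δ k) (≤⊎> δ l)
      ; top  = λ k k<δ → top′ k k<δ (≤⊎> δ k) }

    upper : ∀ α → α W₂.< j → t α ⊴ supremum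
    upper α α<j = record
      { N⪯  = λ k k<δ → N⪯′ α α<j k k<δ (≤⊎> δ k)
      ; N⁺⪯ = λ k k<δ → N⁺⪯′ α α<j k k<δ (≤⊎> δ k)
      ; N*⪯ = CN*.⪯-lub α (z≤ α) α<j }

    ∈-N* : ∀ {x} → x ∈ ∣ CN*.lub ∣ → ∃[ α ] (α W₂.< j × x ∈ ∣ T.N* α ∣)
    ∈-N* x∈ = let (α , _ , α<j , x∈α) = CN*.∈-lub x∈ in α , α<j , x∈α

  -- Maximality with respect to a single point. It survives all further enlargements, so the points
  -- can be treated one after another.
  Saturated : System → Point → Set₂
  Saturated t x = ∀ u → t ⊴ u → x ∈ Covers u → x ∈ Covers t

  saturated-mono : ∀ {t u x} → t ⊴ u → Saturated t x → Saturated u x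
  saturated-mono t⊴u sat v u⊴v x∈ = covers-mono t⊴u (sat v (⊴-trans t⊴u u⊴v) x∈)

  saturate₁ : ∀ s x → ∃[ t ] (s ⊴ t × Saturated t x)
  saturate₁ s x = by-cases em
    where
    by-cases : Dec (∃[ u ] (s ⊴ u × x ∈ Covers u)) → ∃[ t ] (s ⊴ t × Saturated t x)
    by-cases (yes (u , s⊴u , x∈)) = u , s⊴u , λ v u⊴v _ → x∈
    by-cases (no ¬∃) = s , ⊴-refl s , λ v s⊴v x∈ → contradiction (v , s⊴v , x∈) ¬∃

  -- The points of `N*` are enumerated by `Λ` and treated along a well-order of `Λ`, with suprema of
  -- systems at limits; there are at most λ steps, so the suprema stay in cardinality λ. The added
  -- top index collects all of them.
  saturate* : ∀ s → ∃[ t ] (s ⊴ t × (∀ x → x ∈ ∣ System.N* s ∣ → Saturated t x))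
  saturate* s = proj₁ family nothing , proj₁ (proj₂ family nothing) , saturated
    where
    W₂ = withTop (Zermelo.wellOrder Λ)
    module W₂ = WellOrder W₂
    module Wₚ = WellOrderProperties W₂
    points = enumeration {Λ = Λ} {System.N* s} (proj₂ (System.N*∈ s))

    Handled : Maybe Λ → System → Set₂
    Handled nothing  t = Lift 2ℓ ⊤
    Handled (just l) t = Saturated t (proj₁ points l)

    Ext : ∀ j → (∀ k → k W₂.< j → System) → System → Set₂
    -- Extending `s` is demanded separately, because the first index has no predecessor to inherit
    -- it from.
    Ext j h t = s ⊴ t × (∀ k (p : k W₂.< j) → h k p ⊴ t) × Handled j t

    small : ∀ j → Small (W₂._< j)
    small j = mk≲ (λ { (just l) _ → l }) (λ _ → tt) λ { {just l} {just m} _ _ refl → refl }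

    bound : ∀ j (st : W₂.Carrier → System) → (∀ k → k W₂.< j → Ext k (λ l _ → st l) (st k)) →
            ∃[ t ] (s ⊴ t × (∀ k → k W₂.< j → st k ⊴ t))
    bound j st ext = by-cases em
      where
      by-cases : Dec (∃[ k ] k W₂.< j) → ∃[ t ] (s ⊴ t × (∀ k → k W₂.< j → st k ⊴ t))
      by-cases (no ¬∃) = s , ⊴-refl s , λ k k<j → contradiction (k , k<j) ¬∃
      by-cases (yes (k , k<j)) = S.supremum , ⊴-trans (proj₁ (ext z z<j)) (S.upper z z<j) , S.upper
        where
        zeroed = least W₂.wellFounded {P = λ _ → ⊤} {x = k} tt
        z = proj₁ zeroed
        z-zero : W₂.IsZero z
        z-zero β β<z = proj₂ (proj₂ zeroed) β β<z tt
        z<j : z W₂.< j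
        z<j = Wₚ.≤-<-trans (Wₚ.zero-≤ z-zero k) k<j
        module S = Supremum W₂ z j z-zero z<j st (λ k l k<l l<j → proj₁ (proj₂ (ext l l<j)) k k<l) (small j)

    step : ∀ j (st : W₂.Carrier → System) → (∀ k → k W₂.< j → Ext k (λ l _ → st l) (st k)) →
           ∃[ t ] Ext j (λ l _ → st l) t
    step nothing st ext = let (t , s⊴t , above) = bound nothing st ext in t , s⊴t , above , _
    step (just l) st ext =
      let (t , s⊴t , above) = bound (just l) st ext
          (u , t⊴u , sat) = saturate₁ t (proj₁ points l)
      in u , ⊴-trans s⊴t t⊴u , (λ k k<j → ⊴-trans (above k k<j) t⊴u) , sat

    family = Recursion.recursion W₂.wellFounded s Ext step

    saturated : ∀ x → x ∈ ∣ System.N* s ∣ → Saturated (proj₁ family nothing) x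
    saturated x x∈ = at (proj₂ points x∈)
      where
      at : ∃[ l ] proj₁ points l ≡ x → Saturated (proj₁ family nothing) x
      at (l , refl) = saturated-mono (proj₁ (proj₂ (proj₂ family nothing)) (just l) tt) (proj₂ (proj₂ (proj₂ family (just l))))

  -- After ω iterations every point of N* has appeared at a finite stage, and has been
  -- dealt with at the next one.
  saturate : ∀ s → ∃[ t ] (s ⊴ t × (∀ x → x ∈ ∣ System.N* t ∣ → Saturated t x))
  saturate s = S.supremum , S.upper (just 0) tt , saturated
    where
    seq : ℕ → System
    seq zero    = s
    seq (suc n) = proj₁ (saturate* (seq n))

    seq-step : ∀ n → seq n ⊴ seq (suc n)
    seq-step n = proj₁ (proj₂ (saturate* (seq n)))

    seq-mono : ∀ {m n} → m ℕ.≤′ n → seq m ⊴ seq n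
    seq-mono {m} (ℕ.≤′-reflexive refl) = ⊴-refl (seq m)
    seq-mono {n = suc n} (ℕ.≤′-step p) = ⊴-trans (seq-mono p) (seq-step n)

    W₃ = withTop ℕ-wellOrder
    module W₃ = WellOrder W₃

    t : Maybe ℕ → System
    t (just n) = seq n
    t nothing  = s

    chain : ∀ k l → k W₃.< l → l W₃.< nothing → t k ⊴ t l
    chain (just m) (just n) m<n _ = seq-mono (ℕₚ.≤⇒≤′ (ℕₚ.<⇒≤ m<n))

    small : Small (W₃._< nothing)
    small = ≲-trans (mk≲ (λ { (just n) _ → n }) (λ _ → tt) λ { {just m} {just n} _ _ refl → refl }) ℕ≲Λ

    z-zero : W₃.IsZero (just 0)
    z-zero (just _) ()

    module S = Supremum W₃ (just 0) nothing z-zero tt t chain small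

    saturated : ∀ x → x ∈ ∣ System.N* S.supremum ∣ → Saturated S.supremum x
    saturated x x∈ = at (S.∈-N* x∈)
      where
      at : ∃[ α ] (α W₃.< nothing × x ∈ ∣ System.N* (t α) ∣) → Saturated S.supremum x
      at (just n , _ , x∈n) = saturated-mono (S.upper (just (suc n)) tt) (proj₂ (proj₂ (saturate* (seq n))) x x∈n)

  -- A saturated system works: a point `c` obtained from density over the union could be absorbed
  -- into an enlargement, so saturation says that it was covered from the start.
  complete : Small (_< δ) → (∃[ α ] α < δ) → (∀ α → α < δ → ∃[ β ] (α < β × β < δ)) →
             ∀ s → ∃[ t ] (s ⊴ t × (∀ x → x ∈ ∣ System.N* t ∣ → x ∈ Covers t))
  complete small (α , α<δ) dense s = t , s⊴t , λ x x∈ → covered (C.∈-lub (⪯-⊆ N*⪯lub x∈))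
    where
    zeroed = least wellFounded {P = λ _ → ⊤} {x = α} tt
    o = proj₁ zeroed
    o-zero : IsZero o
    o-zero β β<o = proj₂ (proj₂ zeroed) β β<o tt
    o<δ : o < δ
    o<δ = ≤-<-trans (zero-≤ o-zero α) α<δ
    saturation = saturate s
    t = proj₁ saturation
    s⊴t : s ⊴ t
    s⊴t = proj₁ (proj₂ saturation)
    open SystemProperties t
    module C = Chain W o δ o<δ N⁺ (λ k l _ → N⁺-increasing k l) (λ k _ → N⁺∈ k) small
    lub⪯N* : C.lub ⪯ N*
    lub⪯N* = C.lub-⪯ λ k _ → top k
    N⁺⪯lub : ∀ k → k < δ → N⁺ k ⪯ C.lub
    N⁺⪯lub k = C.⪯-lub k (zero-≤ o-zero k)
    covered : ∀ {x} → ∃[ k ] (o ≤ k × k < δ × x ∈ ∣ N⁺ k ∣) → x ∈ Covers t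
    covered (k , _ , k<δ , x∈) = k , k<δ , x∈
    equal : C.lub ≐ₘ N*
    equal = by-contradiction λ ¬e → impossible (density C.lub∈ N*∈ (lub⪯N* , ¬e))
      where
      impossible : ¬ (∃[ c ] (c ∈ ∣ N* ∣ × c ∉ ∣ C.lub ∣ × Basic c C.lub N*))
      impossible (c , c∈ , c∉ , basic) = at (C.nf-localCharacter dense N*∈ lub⪯N* basic)
        where
        at : ¬ (∃[ k ] (o ≤ k × k < δ × nf (N⁺ k) C.lub c N*))
        at (k , _ , k<δ , n) = above (dense k k<δ)
          where
          above : ¬ (∃[ i ] (k < i × i < δ))
          -- Local character gives the base `N⁺ k`, whereas absorption asks for some `N i`; as `δ`
          -- is a limit there is `i` above `k`, and `N i` extends `N⁺ k`.
          above (i , k<i , i<δ) = grown (Absorb.absorb t small i i<δ c C.lub N⁺⪯lub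
              (nf-between (N∈ i i<δ) C.lub∈ (next k i k<i i<δ) (⪯-trans (N⪯N⁺ i i<δ) (N⁺⪯lub i i<δ)) (⪯-refl (proj₁ C.lub∈)) n))
            where
            grown : ¬ (∃[ u ] (t ⊴ u × c ∈ ∣ System.N u i ∣))
            -- Saturation of `t` at `c` pulls the covering back from `u` to `t`.
            grown (u , t⊴u , c∈u) = back (proj₂ (proj₂ saturation) c c∈ u t⊴u (i , i<δ , ⪯-⊆ (SystemProperties.N⪯N⁺ u i i<δ) c∈u))
              where
              back : ¬ Covers t c
              back (l , l<δ , c∈l) = c∉ (⪯-⊆ (N⁺⪯lub l l<δ) c∈l)
    N*⪯lub : N* ⪯ C.lub
    N*⪯lub = ≐ₘ⇒⪯ (proj₁ N*∈) (≐ₘ-sym equal)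

-- Independent sequences and appending an element.

module Dimension (cl : Classical) (τ : Vocabulary) (𝕌 : Points) (Λ : Set) (infinite : ¬ Finite (setoid Λ))
                 (𝔰 : Models.GoodFrameMinusStability τ 𝕌 Λ) where
  open Chains cl τ 𝕌 Λ infinite 𝔰 public
  open Independence 𝔰 public

  module IndependentSequenceProperties {W : WellOrder} {α* : WellOrder.Carrier W}
      {M′ : WellOrder.Carrier W → Structure} {a : WellOrder.Carrier W → Point} {M : Structure}
      (seq : IndependentSequence W α* M′ a M) where
    open WellOrder W
    open WellOrderProperties W

    M∈ : M ∈ Kλ
    M∈ = proj₁ seq

    M′∈ : ∀ {α} → α ≤ α* → M′ α ∈ Kλ
    M′∈ = proj₁ (proj₁ (proj₂ seq)) _

    M′-mono : ∀ {α β} → α ≤ β → β ≤ α* → M′ α ⪯ M′ β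
    M′-mono (inj₁ α<β) β≤ = proj₁ (proj₂ (proj₁ (proj₂ seq))) _ _ (inj₁ (<-≤-trans α<β β≤)) β≤ α<β
    M′-mono (inj₂ refl) β≤ = ⪯-refl (proj₁ (M′∈ β≤))

    M′-continuous : ∀ γ → γ ≤ α* → IsLimit γ → IsUnion (_< γ) M′ (M′ γ)
    M′-continuous = proj₂ (proj₂ (proj₁ (proj₂ seq)))

    free : ∀ α β → α < α* → IsSuccessor α β → nf M (M′ α) (a α) (M′ β)
    free = proj₂ (proj₂ (proj₂ seq))

    first : Carrier
    first = proj₁ (least wellFounded {P = λ _ → ⊤} {x = α*} tt)

    first-zero : IsZero first
    first-zero β β<o = proj₂ (proj₂ (least wellFounded {P = λ _ → ⊤} {x = α*} tt)) β β<o tt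

    M⪯first : M ⪯ M′ first
    M⪯first = proj₁ (proj₂ (proj₂ seq)) first first-zero

    first⪯ : ∀ {α} → α ≤ α* → M′ first ⪯ M′ α
    first⪯ = M′-mono (zero-≤ first-zero _)

    M⪯M′ : ∀ {α} → α ≤ α* → M ⪯ M′ α
    M⪯M′ α≤ = ⪯-trans M⪯first (first⪯ α≤)

    successor : ∀ α → α < α* → ∃[ β ] (IsSuccessor α β × β ≤ α*)
    successor α α<α* = let (β , α<β , min) = least wellFounded {P = α <_} α<α* in
      β , (α<β , λ γ α<γ → ≮⇒≥ λ γ<β → min γ γ<β α<γ) , ≮⇒≥ λ α*<β → min α* α*<β α<α*

    a∈ : ∀ {α β} → α < β → β ≤ α* → a α ∈ ∣ M′ β ∣
    a∈ {α} {β} α<β β≤ = let (γ , succ , γ≤) = successor α (<-≤-trans α<β β≤) in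
      ⪯-⊆ (M′-mono (proj₂ succ β α<β) β≤) (nf-∈ (free α γ (<-≤-trans α<β β≤) succ))

    a∉ : ∀ {α} → α < α* → a α ∉ ∣ M′ α ∣
    a∉ {α} α<α* = let (γ , succ , _) = successor α α<α* in nf-∉ (free α γ α<α* succ)

    a-injective : ∀ {α β} → α < α* → β < α* → a α ≡ a β → α ≡ β
    a-injective {α} {β} α< β< e with compare α β
    ... | tri< α<β _ _ = contradiction (subst (_∈ ∣ M′ β ∣) e (a∈ α<β (inj₁ β<))) (a∉ β<)
    ... | tri≈ _ α≡β _ = α≡β
    ... | tri> _ _ β<α = contradiction (subst (_∈ ∣ M′ α ∣) (sym e) (a∈ β<α (inj₁ α<))) (a∉ α<)

    -- The length of the sequence is not bounded in advance, but its elements are distinct points of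
    -- the last model, which has λ points.
    small : Small (_< α*)
    small = ≲-trans (mk≲ (λ α _ → a α) (λ α< → a∈ α< (inj₂ refl)) a-injective) (Kλ-≲ (M′∈ (inj₂ refl)))

  -- An element b that is free over a model containing M₀ and J can be appended
  -- to a copy over M₀ ∪ J ∪ {b} of the sequence witnessing the independence of J.
  module Append {M M₀ N A B : Structure} {J : Pred Point 1ℓ} {b : Point}
                (M₀⪯N : M₀ ⪯ N) (M⪯M₀ : M ⪯ M₀) (J⊆N : J ⊆ ∣ N ∣) (N∈ : N ∈ Kλ)
                (M₀⪯A : M₀ ⪯ A) (J⊆A : J ⊆ ∣ A ∣) (b-free : nf M A b B) (N⪯B : N ⪯ B)
                (W : WellOrder) (α* : WellOrder.Carrier W) (M′ : WellOrder.Carrier W → Structure) (a : WellOrder.Carrier W → Point)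
                (seq : IndependentSequence W α* M′ a M)
                (J≐ : J ≐ (λ x → ∃[ α ] (WellOrder._<_ W α α* × a α ≡ x)))
                (M₀⊆ : ∀ o → WellOrder.IsZero W o → ∣ M₀ ∣ ⊆ ∣ M′ o ∣)
                {N⁺ : Structure} (N⁺∈ : N⁺ ∈ Kλ) (M′⪯N⁺ : M′ α* ⪯ N⁺) (N⪯N⁺ : N ⪯ N⁺) where
    open WellOrder W
    open WellOrderProperties W
    open IndependentSequenceProperties {W} {α*} {M′} {a} {M} seq

    record Copy : Set₂ where
      field
        E     : Structure
        h     : Map
        E∈    : E ∈ Kλ
        N⪯E   : N ⪯ E
        h-emb : IsEmbedding h N⁺ E
        h-id  : IdentityOn M₀ h
        h-J   : ∀ {x} → x ∈ J → h x ≡ x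
        free′ : nf M (image h (M′ α*)) b E

    -- The witness `N⁺` for `J` and the model `B` around `b` are amalgamated over `N`, and `b` is
    -- made free over the whole amalgam `P`. Renaming by `r` so that `P` is included returns `b` to
    -- its place and moves the sequence instead, except for the points of `A`, among them `M₀` and
    -- `J`.
    copy : Copy
    copy = from-amalgam (amalgamate N∈ N⁺∈ (nf-Kλ₂ b-free) N⪯N⁺ (emb-incl N⪯B))
      where
      from-amalgam : ∃[ P ] ∃[ g ] (P ∈ Kλ × B ⪯ P × IsEmbedding g N⁺ P × g ≗[ N ] (λ x → x)) → Copy
      from-amalgam (P , g , P∈ , B⪯P , G , g-id) =
        from-extension (nf-extension b-freeP P∈ (nf-⪯₁ b-freeP))
        where
        b-freeP : nf M A b P
        b-freeP = nf-expand P∈ B⪯P b-free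
        from-extension : ∃[ E ] ∃[ e ] (E ∈ Kλ × P ⪯ E × IsEmbedding e P E × IdentityOn A e × nf M P (e b) E) → Copy
        from-extension (E , e , E∈ , P⪯E , e-emb , e-id , nE) = from-pullback (pullback P∈ E∈ e-emb)
          where
          from-pullback : ∃[ E′ ] ∃[ r ] (E′ ∈ Kλ × IsIso r E E′ × P ⪯ E′ × (∀ {x} → x ∈ ∣ P ∣ → r (e x) ≡ x)) → Copy
          from-pullback (E′ , r , E′∈ , r-iso , P⪯E′ , re) = record
            { E = E′ ; h = r ∘ g ; E∈ = E′∈
            ; N⪯E = ⪯-trans N⪯B (⪯-trans B⪯P P⪯E′)
            ; h-emb = h-emb
            ; h-id = h-id
            ; h-J = λ x∈ → trans (cong r (g-id (J⊆N x∈))) (r-id (J⊆A x∈))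
            ; free′ = nf-between M∈ (Kλ-iso (proj₁ hM′) (M′∈ (inj₂ refl))) (⪯-refl (proj₁ M∈)) M⪯hM′
                        (⪯-coherent (proj₂ hM′) rP⪯E′ λ (x , x∈ , q) → g x , emb-maps G (⪯-⊆ M′⪯N⁺ x∈) , q) nE′ }
            where
            r-id : IdentityOn A r
            r-id {x} x∈ = trans (cong r (sym (e-id x∈))) (re (⪯-⊆ (nf-⪯₁ b-freeP) x∈))
            r-M : IsIso r M M
            r-M = iso-identity λ x∈ → r-id (⪯-⊆ (nf-⪯₀₁ b-free) x∈)
            r-P : IsIso r P (image r P)
            r-P = proj₁ (⪯-image r-iso P⪯E)
            rP⪯E′ : image r P ⪯ E′
            rP⪯E′ = proj₂ (⪯-image r-iso P⪯E)
            nE′ : nf M (image r P) b E′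
            nE′ = subst (λ z → nf M (image r P) z E′) (re (nf-∈ b-freeP)) (nf-iso r-iso r-M r-P nE)
            h-emb : IsEmbedding (r ∘ g) N⁺ E′
            h-emb = emb-trans G (emb-restrict P⪯E (emb-iso r-iso (proj₁ E′∈)))
            h-id : IdentityOn M₀ (r ∘ g)
            h-id x∈ = trans (cong r (g-id (⪯-⊆ M₀⪯N x∈))) (r-id (⪯-⊆ M₀⪯A x∈))
            hM′ : IsIso (r ∘ g) (M′ α*) (image (r ∘ g) (M′ α*)) × image (r ∘ g) (M′ α*) ⪯ E′
            hM′ = emb-image (emb-restrict M′⪯N⁺ h-emb)
            M⪯hM′ : M ⪯ image (r ∘ g) (M′ α*)
            M⪯hM′ = ⪯-iso (proj₁ hM′) (iso-identity λ x∈ → h-id (⪯-⊆ M⪯M₀ x∈)) (M⪯M′ (inj₂ refl))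

    open Copy copy

    W⁺ : WellOrder
    W⁺ = withTop W

    module W⁺ = WellOrder W⁺
    module W⁺ₚ = WellOrderProperties W⁺

    -- The successor of `α*` is the index of the last model of the longer sequence. Since `α*` may
    -- be greatest in `W`, the added top shows that something lies above it.
    α⁺-spec : ∃[ β ] (just α* W⁺.< β × (∀ γ → γ W⁺.< β → ¬ just α* W⁺.< γ))
    α⁺-spec = least W⁺.wellFounded {P = λ β → just α* W⁺.< β} {x = nothing} tt

    α⁺ : W⁺.Carrier
    α⁺ = proj₁ α⁺-spec

    α*<α⁺ : just α* W⁺.< α⁺
    α*<α⁺ = proj₁ (proj₂ α⁺-spec)

    <α⁺⇒≤ : ∀ {α} → just α W⁺.< α⁺ → α ≤ α*
    <α⁺⇒≤ {α} p = ≮⇒≥ λ α*<α → proj₂ (proj₂ α⁺-spec) (just α) p α*<α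

    ≤⇒<α⁺ : ∀ {α} → α ≤ α* → just α W⁺.< α⁺
    ≤⇒<α⁺ (inj₁ α<α*) = W⁺ₚ.<-trans {just _} {just α*} {α⁺} α<α* α*<α⁺
    ≤⇒<α⁺ (inj₂ refl) = α*<α⁺

    selM : ∀ α → α ≤ α* ⊎ α* < α → Structure
    selM α (inj₁ _) = image h (M′ α)
    selM α (inj₂ _) = E

    M⁺ : W⁺.Carrier → Structure
    M⁺ (just α) = selM α (≤⊎> α α*)
    M⁺ nothing  = E

    sel-a : ∀ α → Dec (α < α*) → Point
    sel-a α (yes _) = a α
    sel-a α (no _)  = b

    a⁺ : W⁺.Carrier → Point
    a⁺ (just α) = sel-a α em
    a⁺ nothing  = b

    M⁺-≤ : ∀ {α} → α ≤ α* → M⁺ (just α) ≡ image h (M′ α)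
    M⁺-≤ {α} α≤ = by-cases (≤⊎> α α*)
      where
      by-cases : ∀ d → selM α d ≡ image h (M′ α)
      by-cases (inj₁ _) = refl
      by-cases (inj₂ α*<α) = contradiction α*<α (≤⇒≯ α≤)

    M⁺-> : ∀ β → just α* W⁺.< β → M⁺ β ≡ E
    M⁺-> nothing _ = refl
    M⁺-> (just α) α*<α = by-cases (≤⊎> α α*)
      where
      by-cases : ∀ d → selM α d ≡ E
      by-cases (inj₁ α≤) = contradiction α*<α (≤⇒≯ α≤)
      by-cases (inj₂ _) = refl

    a⁺-< : ∀ {α} → α < α* → a⁺ (just α) ≡ a α
    a⁺-< {α} α< = by-cases em
      where
      by-cases : ∀ d → sel-a α d ≡ a α
      by-cases (yes _) = refl
      by-cases (no ≮) = contradiction α< ≮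

    a⁺-α* : a⁺ (just α*) ≡ b
    a⁺-α* = by-cases em
      where
      by-cases : ∀ d → sel-a α* d ≡ b
      by-cases (yes p) = contradiction p <-irreflexive
      by-cases (no _) = refl

    h-M′ : ∀ {α} → α ≤ α* → IsIso h (M′ α) (image h (M′ α)) × image h (M′ α) ⪯ E
    h-M′ α≤ = emb-image (emb-restrict (⪯-trans (M′-mono α≤ (inj₂ refl)) M′⪯N⁺) h-emb)

    h-M : IsIso h M M
    h-M = iso-identity λ x∈ → h-id (⪯-⊆ M⪯M₀ x∈)

    M⁺∈ : ∀ β → M⁺ β ∈ Kλ
    M⁺∈ nothing = E∈
    M⁺∈ (just α) = by-cases (≤⊎> α α*)
      where
      by-cases : ∀ d → selM α d ∈ Kλ
      by-cases (inj₁ α≤) = Kλ-iso (proj₁ (h-M′ α≤)) (M′∈ α≤)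
      by-cases (inj₂ _) = E∈

    hM′-mono : ∀ {α β} → α ≤ β → β ≤ α* → image h (M′ α) ⪯ image h (M′ β)
    hM′-mono α≤β β≤ = ⪯-iso (proj₁ (h-M′ β≤)) (proj₁ (h-M′ (≤-trans α≤β β≤))) (M′-mono α≤β β≤)

    M⁺-mono : ∀ x y → y W⁺.≤ α⁺ → x W⁺.< y → M⁺ x ⪯ M⁺ y
    M⁺-mono nothing y _ ()
    M⁺-mono (just α) y y≤ x<y = by-cases y y≤ x<y (W⁺ₚ.≤⊎> y (just α*))
      where
      α≤ : α ≤ α*
      α≤ = <α⁺⇒≤ (W⁺ₚ.<-≤-trans {just α} {y} {α⁺} x<y y≤)
      by-cases : ∀ y → y W⁺.≤ α⁺ → just α W⁺.< y → y W⁺.≤ just α* ⊎ just α* W⁺.< y → M⁺ (just α) ⪯ M⁺ y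
      by-cases y _ _ (inj₂ α*<y) = subst₂ _⪯_ (sym (M⁺-≤ α≤)) (sym (M⁺-> y α*<y)) (proj₂ (h-M′ α≤))
      by-cases nothing _ _ (inj₁ (inj₁ ()))
      by-cases nothing _ _ (inj₁ (inj₂ ()))
      by-cases (just β) y≤ α<β (inj₁ β≤) = subst₂ _⪯_ (sym (M⁺-≤ α≤)) (sym (M⁺-≤ β≤α*)) (hM′-mono (inj₁ α<β) β≤α*)
        where
        β≤α* : β ≤ α*
        β≤α* = <α⁺⇒≤ (W⁺ₚ.≤-<-trans {just β} {just α*} {α⁺} β≤ α*<α⁺)

    M⁺-continuous : ∀ γ → γ W⁺.≤ α⁺ → W⁺.IsLimit γ → IsUnion (W⁺._< γ) M⁺ (M⁺ γ)
    -- A successor is no limit, so continuity asks nothing of the last model.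
    M⁺-continuous γ (inj₂ refl) (_ , dense) =
      let (β , α*<β , β<α⁺) = dense (just α*) α*<α⁺ in contradiction α*<β (proj₂ (proj₂ α⁺-spec) β β<α⁺)
    M⁺-continuous nothing (inj₁ p) _ = contradiction p (λ ())
    M⁺-continuous (just γ) (inj₁ p) limit = (λ { (just α) α<γ → M⁺⊑ α α<γ }) , cover
      where
      γ≤ : γ ≤ α*
      γ≤ = <α⁺⇒≤ p
      below : ∀ {α} → α W⁺.< just γ → ∃[ β ] (α ≡ just β × β < γ)
      below {just β} β<γ = β , refl , β<γ
      limit′ : IsLimit γ
      limit′ = nonempty (proj₁ limit) , λ α α<γ → dense (proj₂ limit (just α) α<γ)
        where
        nonempty : ∃[ α ] α W⁺.< just γ → ∃[ α ] α < γ
        nonempty (just α , α<γ) = α , α<γ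
        dense : ∀ {α} → ∃[ β ] (just α W⁺.< β × β W⁺.< just γ) → ∃[ β ] (α < β × β < γ)
        dense (just β , q) = β , q
      union′ : IsUnion (_< γ) M′ (M′ γ)
      union′ = M′-continuous γ γ≤ limit′
      M⁺⊑ : ∀ α → α < γ → M⁺ (just α) ⊑ M⁺ (just γ)
      M⁺⊑ α α<γ = ⪯⇒⊑ (M⁺-mono (just α) (just γ) (inj₁ p) α<γ)
      cover : ∀ {x} → x ∈ ∣ M⁺ (just γ) ∣ → ∃[ β ] (β W⁺.< just γ × x ∈ ∣ M⁺ β ∣)
      cover {x} x∈ = at (subst (λ S → x ∈ ∣ S ∣) (M⁺-≤ γ≤) x∈)
        where
        at : ∃[ y ] (y ∈ ∣ M′ γ ∣ × h y ≡ x) → ∃[ β ] (β W⁺.< just γ × x ∈ ∣ M⁺ β ∣)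
        at (y , y∈ , e) = let (α , α<γ , y∈α) = proj₂ union′ y∈ in
          just α , α<γ , subst (λ S → x ∈ ∣ S ∣) (sym (M⁺-≤ (inj₁ (<-≤-trans α<γ γ≤)))) (y , y∈α , e)

    below-zero : ∀ o → W⁺.IsZero o → ∃[ o′ ] (o ≡ just o′ × IsZero o′ × o′ ≤ α*)
    below-zero nothing z = contradiction tt (z (just α*))
    below-zero (just o) z = o , refl , (λ β β<o → z (just β) β<o) , zero-≤ (λ β β<o → z (just β) β<o) α*

    M⪯zero : ∀ o → W⁺.IsZero o → M ⪯ M⁺ o
    M⪯zero o z = at (below-zero o z)
      where
      at : ∃[ o′ ] (o ≡ just o′ × IsZero o′ × o′ ≤ α*) → M ⪯ M⁺ o
      at (o′ , refl , _ , o≤) = subst (M ⪯_) (sym (M⁺-≤ o≤)) (⪯-iso (proj₁ (h-M′ o≤)) h-M (M⪯M′ o≤))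

    M₀⊆zero : ∀ o → W⁺.IsZero o → ∣ M₀ ∣ ⊆ ∣ M⁺ o ∣
    M₀⊆zero o z {x} x∈ = at (below-zero o z)
      where
      at : ∃[ o′ ] (o ≡ just o′ × IsZero o′ × o′ ≤ α*) → x ∈ ∣ M⁺ o ∣
      at (o′ , refl , z′ , o≤) = subst (λ S → x ∈ ∣ S ∣) (sym (M⁺-≤ o≤)) (x , M₀⊆ o′ z′ x∈ , h-id x∈)

    J-at : ∀ {α} → α < α* → a α ∈ J
    J-at α< = proj₂ J≐ (_ , α< , refl)

    free⁺ : ∀ α β → α W⁺.< α⁺ → W⁺.IsSuccessor α β → nf M (M⁺ α) (a⁺ α) (M⁺ β)
    free⁺ nothing β p _ = contradiction p (λ ())
    free⁺ (just α) β p succ = by-cases β succ (<α⁺⇒≤ p)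
      where
      by-cases : ∀ β → W⁺.IsSuccessor (just α) β → α ≤ α* → nf M (M⁺ (just α)) (a⁺ (just α)) (M⁺ β)
      by-cases nothing (_ , least′) (inj₁ α<α*) with least′ (just α*) α<α*
      ... | inj₁ ()
      ... | inj₂ ()
      by-cases (just β) (α<β , least′) (inj₁ α<α*) =
        subst₂ (λ S T → nf M S (a⁺ (just α)) T) (sym (M⁺-≤ (inj₁ α<α*))) (sym (M⁺-≤ β≤))
          (subst (λ z → nf M (image h (M′ α)) z (image h (M′ β))) (trans (h-J (J-at α<α*)) (sym (a⁺-< α<α*)))
            (nf-iso (proj₁ (h-M′ β≤)) h-M (proj₁ (h-M′ (inj₁ α<α*))) (free α β α<α* (α<β , least-just))))
        where
        least-just : ∀ γ → α < γ → β ≤ γ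
        least-just γ α<γ with least′ (just γ) α<γ
        ... | inj₁ β<γ  = inj₁ β<γ
        ... | inj₂ refl = inj₂ refl
        β≤ : β ≤ α*
        β≤ = least-just α* α<α*
      by-cases β (α<β , _) (inj₂ refl) =
        subst₂ (λ S T → nf M S (a⁺ (just α*)) T) (sym (M⁺-≤ (inj₂ refl))) (sym (M⁺-> β α<β))
          (subst (λ z → nf M (image h (M′ α*)) z E) (sym a⁺-α*) free′)

    J⁺ : Pred Point 1ℓ
    J⁺ x = x ∈ J ⊎ x ≡ b

    J⁺≐ : J⁺ ≐ (λ x → ∃[ α ] (α W⁺.< α⁺ × a⁺ α ≡ x))
    J⁺≐ = to , from
      where
      to : ∀ {x} → x ∈ J⁺ → ∃[ α ] (α W⁺.< α⁺ × a⁺ α ≡ x)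
      to (inj₁ x∈) = let (α , α< , e) = proj₁ J≐ x∈ in just α , ≤⇒<α⁺ (inj₁ α<) , trans (a⁺-< α<) e
      to (inj₂ refl) = just α* , α*<α⁺ , a⁺-α*
      from : ∀ {x} → ∃[ α ] (α W⁺.< α⁺ × a⁺ α ≡ x) → x ∈ J⁺
      from (nothing , p , _) = contradiction p (λ ())
      from {x} (just α , p , e) = by-cases (<α⁺⇒≤ p)
        where
        by-cases : α ≤ α* → x ∈ J⁺
        by-cases (inj₁ α<) = inj₁ (subst (_∈ J) (trans (sym (a⁺-< α<)) e) (J-at α<))
        by-cases (inj₂ refl) = inj₂ (trans (sym e) a⁺-α*)

    independent : Independent J⁺ M ∣ M₀ ∣ N
    independent = N∈ , W⁺ , α⁺ , M⁺ , a⁺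
      , (M∈ , ((λ α _ → M⁺∈ α) , (λ α β _ β≤ α<β → M⁺-mono α β β≤ α<β) , M⁺-continuous) , M⪯zero , free⁺)
      , J⁺≐ , M₀⊆zero
      , E , E∈ , subst (_⪯ E) (sym (M⁺-> α⁺ α*<α⁺)) (⪯-refl (proj₁ E∈)) , N⪯E

-- Comparing two maximal independent sets.

module Comparison (cl : Classical) (τ : Vocabulary) (𝕌 : Points) (Λ : Set) (infinite : ¬ Finite (setoid Λ))
                  (𝔰 : Models.GoodFrameMinusStability τ 𝕌 Λ) where
  open Dimension cl τ 𝕌 Λ infinite 𝔰 public

  module Large {M M₀ N : Structure} {J₁ J₂ : Pred Point 1ℓ} (M₀⪯N : M₀ ⪯ N) (J₁⊆N : J₁ ⊆ ∣ N ∣)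
               (W₁ : WellOrder) (α₁ : WellOrder.Carrier W₁) (a₁ : WellOrder.Carrier W₁ → Point)
               (J₁≐ : J₁ ≐ (λ x → ∃[ α ] (WellOrder._<_ W₁ α α₁ × a₁ α ≡ x)))
               (W₂ : WellOrder) (α₂ : WellOrder.Carrier W₂) (M′ : WellOrder.Carrier W₂ → Structure)
               (a₂ : WellOrder.Carrier W₂ → Point)
               (seq : IndependentSequence W₂ α₂ M′ a₂ M)
               (J₂≐ : J₂ ≐ (λ x → ∃[ α ] (WellOrder._<_ W₂ α α₂ × a₂ α ≡ x)))
               (M₀⊆ : ∀ o → WellOrder.IsZero W₂ o → ∣ M₀ ∣ ⊆ ∣ M′ o ∣)
               {N⁺ : Structure} (N⁺∈ : N⁺ ∈ Kλ) (M′⪯N⁺ : M′ α₂ ⪯ N⁺) (N⪯N⁺ : N ⪯ N⁺)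
               (large : ¬ Regularity.AtMost W₁ α₁ W₂ α₂ (λ β → WellOrder._<_ W₂ β α₂)) where
    open WellOrder W₂
    open WellOrderProperties W₂
    open IndependentSequenceProperties {W₂} {α₂} {M′} {a₂} {M} seq
    module R = Regularity W₁ α₁ W₂ α₂

    δ : Carrier
    δ = R.δ large

    <α₂ : ∀ {k} → k < δ → k < α₂
    <α₂ k<δ = <-≤-trans k<δ (R.δ≤α₂ large)

    open Completion cl τ 𝕌 Λ infinite 𝔰 W₂ δ M a₂
      using (System; module System; module SystemProperties; module _⊴_; _⊴_; Covers; complete)

    sc : ∀ k → Dec (k < α₂) → Carrier
    sc k (yes p) = proj₁ (successor k p)
    sc k (no _)  = k

    sc-successor : ∀ k → k < α₂ → ∀ d → IsSuccessor k (sc k d) × sc k d ≤ α₂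
    sc-successor k k< (yes p) = proj₂ (successor k p)
    sc-successor k k< (no ≮)  = contradiction k< ≮

    s : System
    s = record
      -- The starting system is the given sequence, with the model at the next index as `N⁺ k`.
      { N = M′ ; N⁺ = λ k → M′ (sc k em) ; N* = N⁺ ; N*∈ = N⁺∈
      ; free = λ k k<δ → free k _ (<α₂ k<δ) (proj₁ (sc-successor k (<α₂ k<δ) em))
      ; next = λ k l k<l l<δ → M′-mono (proj₂ (proj₁ (sc-successor k (<α₂ (<-trans k<l l<δ)) em)) l k<l) (inj₁ (<α₂ l<δ))
      ; top  = λ k k<δ → ⪯-trans (M′-mono (proj₂ (sc-successor k (<α₂ k<δ) em)) (inj₂ refl)) M′⪯N⁺ }

    completion : ∃[ t ] (s ⊴ t × (∀ x → x ∈ ∣ System.N* t ∣ → x ∈ Covers t))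
    completion = complete (≲-trans (⊆⇒≲ <α₂) small) (R.δ-nonempty large) (R.δ-dense large) s

    t : System
    t = proj₁ completion

    s⊴t : s ⊴ t
    s⊴t = proj₁ (proj₂ completion)

    module T = SystemProperties t

    N⪯T : N ⪯ T.N*
    N⪯T = ⪯-trans N⪯N⁺ (_⊴_.N*⪯ s⊴t)

    covers : ∀ {i} → WellOrder._<_ W₁ i α₁ → a₁ i ∈ Covers t
    covers i< = proj₂ (proj₂ completion) _ (⪯-⊆ N⪯T (J₁⊆N (proj₂ J₁≐ (_ , i< , refl))))

    index′ : ∀ i → Dec (a₁ i ∈ Covers t) → Carrier
    index′ i (yes (k , _)) = k
    index′ i (no _)        = proj₁ (R.δ-nonempty large)

    index-covers : ∀ i → a₁ i ∈ Covers t → ∀ d → index′ i d < δ × a₁ i ∈ ∣ T.N⁺ (index′ i d) ∣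
    index-covers i c (yes (k , k<δ , x∈)) = k<δ , x∈
    index-covers i c (no ¬c) = contradiction c ¬c

    -- Every `a₁ i` lies in `N`, hence in the covered top model, and so has an index below `δ`.
    -- These indices form a function on the segment below `α₁`, whose boundedness is what `δ` was
    -- chosen for.
    bound : ∃[ m ] (m < δ × (∀ i → WellOrder._<_ W₁ i α₁ → index′ i em ≤ m))
    bound = R.bounded large (λ i → index′ i em) (λ i i< → proj₁ (index-covers i (covers i<) em))

    above : ∃[ j ] (proj₁ bound < j × j < δ)
    -- A strictly larger index is needed: the `N⁺ k` of the covering lie in `N j` only for `k`
    -- before `j`.
    above = R.δ-dense large (proj₁ bound) (proj₁ (proj₂ bound))

    j : Carrier
    j = proj₁ above

    j<δ : j < δ
    j<δ = proj₂ (proj₂ above)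

    J₁⊆ : J₁ ⊆ ∣ T.N j ∣
    J₁⊆ {x} x∈ = at (proj₁ J₁≐ x∈)
      where
      at : ∃[ i ] (WellOrder._<_ W₁ i α₁ × a₁ i ≡ x) → x ∈ ∣ T.N j ∣
      at (i , i< , refl) = ⪯-⊆ (T.next _ j (≤-<-trans (proj₂ (proj₂ bound) i i<) (proj₁ (proj₂ above))) j<δ)
                             (proj₂ (index-covers i (covers i<) em))

    -- Independence states only inclusion of universes in the first model; coherence inside `N⁺`
    -- upgrades it.
    M₀⪯ : M₀ ⪯ T.N j
    M₀⪯ = ⪯-trans (⪯-coherent (⪯-trans M₀⪯N N⪯N⁺) (⪯-trans (first⪯ (inj₂ refl)) M′⪯N⁺) (M₀⊆ first first-zero))
            (⪯-trans (first⪯ (inj₁ (<α₂ j<δ))) (_⊴_.N⪯ s⊴t j j<δ))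

    b∈J₂ : a₂ j ∈ J₂
    b∈J₂ = proj₂ J₂≐ (j , <α₂ j<δ , refl)

    b-free : nf M (T.N j) (a₂ j) T.N*
    b-free = nf-expand T.N*∈ (T.top j j<δ) (T.free j j<δ)

  module _ {M M₀ N : Structure} (N∈ : N ∈ Kλ) (M⪯M₀ : M ⪯ M₀) (M₀⪯N : M₀ ⪯ N) {P : Pred (TypeOver M₀) 2ℓ} where

    maximal⇒≲ : ∀ {J₁ J₂} → IsMaximal (Family M M₀⪯N P) J₁ → J₂ ∈ Family M M₀⪯N P → FiniteSet J₂ ⊎ J₂ ≲ J₁
    maximal⇒≲ {J₁} {J₂}
      ((J₁⊆N , (_ , W₁ , α₁ , M¹ , a₁ , seq₁ , J₁≐ , M₀⊆₁ , N¹ , N¹∈ , M¹⪯ , N⪯N¹) , P₁) , maximal)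
      (J₂⊆N , (_ , W₂ , α₂ , M² , a₂ , seq₂ , J₂≐ , M₀⊆₂ , N² , N²∈ , M²⪯ , N⪯N²) , P₂)
      = from-indices (by-contradiction λ large → absurd large)
      where
      module I₁ = IndependentSequenceProperties {W₁} {α₁} {M¹} {a₁} {M} seq₁
      module R = Regularity W₁ α₁ W₂ α₂
      absurd : ¬ ¬ R.AtMost (λ β → WellOrder._<_ W₂ β α₂)
      -- Maximality puts the appended element into `J₁`, hence into `N j`, whereas an element free
      -- over `N j` lies outside of it.
      absurd large = nf-∉ L.b-free (L.J₁⊆ (maximal (J⁺⊆N , A.independent , P⁺) inj₁ (inj₂ refl)))
        where
        module L = Large {M} {M₀} {N} {J₁} {J₂} M₀⪯N J₁⊆N W₁ α₁ a₁ J₁≐ W₂ α₂ M² a₂ seq₂ J₂≐ M₀⊆₂ N²∈ M²⪯ N⪯N² large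
        module A = Append M₀⪯N M⪯M₀ J₁⊆N N∈ L.M₀⪯ L.J₁⊆ L.b-free L.N⪯T W₁ α₁ M¹ a₁ seq₁ J₁≐ M₀⊆₁ N¹∈ M¹⪯ N⪯N¹
        J⁺⊆N : A.J⁺ ⊆ ∣ N ∣
        J⁺⊆N (inj₁ x∈)   = J₁⊆N x∈
        J⁺⊆N (inj₂ refl) = J₂⊆N L.b∈J₂
        P⁺ : ∀ {x} → x ∈ A.J⁺ → (x∈N : x ∈ ∣ N ∣) → tp x N M₀⪯N x∈N ∈ P
        P⁺ (inj₁ x∈)   = P₁ x∈
        P⁺ (inj₂ refl) = P₂ L.b∈J₂
      J₂≲ : J₂ ≲ (λ β → WellOrder._<_ W₂ β α₂)
      J₂≲ = mk≲ (λ x x∈ → proj₁ (proj₁ J₂≐ x∈)) (λ x∈ → proj₁ (proj₂ (proj₁ J₂≐ x∈)))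
        λ x∈ y∈ e → trans (sym (proj₂ (proj₂ (proj₁ J₂≐ x∈)))) (trans (cong a₂ e) (proj₂ (proj₂ (proj₁ J₂≐ y∈))))
      ≲J₁ : (λ α → WellOrder._<_ W₁ α α₁) ≲ J₁
      ≲J₁ = mk≲ (λ α _ → a₁ α) (λ α< → proj₂ J₁≐ (_ , α< , refl)) I₁.a-injective
      from-indices : R.AtMost (λ β → WellOrder._<_ W₂ β α₂) → FiniteSet J₂ ⊎ J₂ ≲ J₁
      from-indices (inj₁ fin) = inj₁ (≲-finite J₂≲ fin)
      from-indices (inj₂ f)   = inj₂ (≲-trans J₂≲ (≲-trans f ≲J₁))

    -- The comparison is made in both directions. Two injections combine by Cantor-Bernstein; in the
    -- remaining cases one set is finite, and either the other is too or it injects into that one.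
    dimension : ∀ {J₁ J₂} → IsMaximal (Family M M₀⪯N P) J₁ → IsMaximal (Family M M₀⪯N P) J₂ →
                Bijection (Elements J₁) (Elements J₂) ⊎ (Finite (Elements J₁) × Finite (Elements J₂))
    dimension {J₁} {J₂} max₁ max₂ = by-cases (maximal⇒≲ max₂ (proj₁ max₁)) (maximal⇒≲ max₁ (proj₁ max₂))
      where
      by-cases : FiniteSet J₁ ⊎ J₁ ≲ J₂ → FiniteSet J₂ ⊎ J₂ ≲ J₁ →
                 Bijection (Elements J₁) (Elements J₂) ⊎ (Finite (Elements J₁) × Finite (Elements J₂))
      by-cases (inj₁ fin₁) (inj₁ fin₂) = inj₂ (FiniteSet⇒Finite fin₁ , FiniteSet⇒Finite fin₂)
      by-cases (inj₁ fin₁) (inj₂ f)    = inj₂ (FiniteSet⇒Finite fin₁ , FiniteSet⇒Finite (≲-finite f fin₁))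
      by-cases (inj₂ f) (inj₁ fin₂)    = inj₂ (FiniteSet⇒Finite (≲-finite f fin₂) , FiniteSet⇒Finite fin₂)
      by-cases (inj₂ f) (inj₂ g)       = inj₁ (≅⇒Bijection (≲-antisym f g))

proposition3p13 : Classical →
    (τ : Vocabulary) (𝕌 : Points) (Λ : Set) → ¬ Finite (setoid Λ) →
    (let open Points 𝕌) (let open Models τ 𝕌)
    (𝔰 : GoodFrameMinusStability Λ) →
    (let open GoodFrameMinusStability 𝔰) (let open Independence 𝔰)
    (M M₀ N : Structure) → M ∈ Kλ → M₀ ∈ Kλ → N ∈ Kλ →
    M ⪯ M₀ → (M₀⪯N : M₀ ⪯ N) →
    (P : Pred (TypeOver M₀) 2ℓ) → RespectsTypes P → P ⊆ Sbs M₀ →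
    (J₁ J₂ : Pred Point 1ℓ) →
    IsMaximal (Family M M₀⪯N P) J₁ → IsMaximal (Family M M₀⪯N P) J₂ →
    (IndependenceHasContinuity ⊎ Finite (Elements J₁) ⊎ Finite (Elements J₂)) →
    Bijection (Elements J₁) (Elements J₂) ⊎ (Finite (Elements J₁) × Finite (Elements J₂))
proposition3p13 cl τ 𝕌 Λ infinite 𝔰 M M₀ N _ _ N∈ M⪯M₀ M₀⪯N P _ _ J₁ J₂ max₁ max₂ _ =
  Comparison.dimension cl τ 𝕌 Λ infinite 𝔰 N∈ M⪯M₀ M₀⪯N {P} max₁ max₂
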